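{- Let $n>3$ be an integer and $p\ge 3$ an odd integer, let $q$ be an integer, and let $G\in\mathcal{G}(\{p,q\})$ satisfy $\alpha_l(G)<n$. (a) If $q=2p+1$, then $\operatorname{def}(G)\le 3n-8$. Moreover, if $G$ is deficiency-critical, then $\operatorname{def}(G)=3n-8$ if and only if $G\cong T_{n-2}^p$. (b) If $q=2p-1$, then $\operatorname{def}(G)\le n^2-3n+1$. Moreover, if $G$ is deficiency-critical, then $\operatorname{def}(G)=n^2-3n+1$ if and only if $G\cong S_{n-1}^p$.
   Context: All graphs are finite and simple. The deficiency $\operatorname{def}(G)$ is the number of vertices not saturated by a maximum matching of $G$. The local independence number $\alpha_l(G)$ is the largest $t$ such that $G$ has an induced subgraph isomorphic to $K_{1,t}$. For $i\ge 2$, $P_i$ is the path on $i$ vertices and the bone $B_i$ is the tree obtained from $P_i$ by attaching two pendent edges (edges to new degree-one vertices) to each of its two end vertices. For $A\subseteq\{2,3,\dots\}$, $\mathcal{G}(A)$ is the family of connected graphs $G$ such that every induced subgraph of $G$ isomorphic to a bone $B_i$ has $i\in A$. A connected graph $G$ is deficiency-critical if $\operatorname{def}(G')<\operatorname{def}(G)$ for every proper connected induced subgraph $G'$ of $G$. For positive integers $k,p$, $D_k^p$ is the tree obtained by attaching $k$ pendent edges at one end vertex of the path $P_p$; the other end vertex of $P_p$ is called the end of $D_k^p$ (when $p=1$ the single path vertex is the end). Attaching $D_k^p$ at a vertex $v$ of a graph means taking a disjoint copy of $D_k^p$ and identifying its end with $v$. $T_k^p$ is the graph obtained from $K_{2,k}$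 by attaching one copy of $D_k^p$ at each of the two vertices of degree $k$. $S_k^p$ is the tree obtained by taking $k$ pairwise disjoint copies of $D_{k-1}^p$ and identifying all their ends into one common vertex. -}

module Defs where

open import Data.Nat using (ℕ; zero; suc; _+_; _*_; _∸_; _≤_; _<_; _≡ᵇ_; _<ᵇ_)
open import Data.Bool using (Bool; true; false; _∧_; _∨_)
open import Data.Fin using (Fin; toℕ)
open import Data.List using (List; []; _∷_; map; _++_; upTo; allFin; filterᵇ; length; concatMap)
open import Data.Bool.ListAction using (any)
open import Data.Sum using (_⊎_)
open import Data.Maybe using (Maybe; just; nothing)
open import Data.Product using (Σ; _×_; _,_; ∃)
open import Data.Empty using (⊥)
open import Relation.Nullary using (¬_)
open import Relation.Unary using (Pred)
open import Relation.Binary.PropositionalEquality using (_≡_)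
open import Function.Definitions using (Injective)
open import Function.Bundles using (_↔_; Inverse)
open import Level using (0ℓ)
import Data.Nat.Properties as ℕP

record Graph : Set where
  constructor graph
  field
    order : ℕ
    Adj   : Fin order → Fin order → Bool
open Graph public

record IsSimple (G : Graph) : Set where
  field
    symmetric   : ∀ u v → Adj G u v ≡ Adj G v u
    irreflexive : ∀ v → Adj G v v ≡ false

data Reachable (G : Graph) : Fin (order G) → Fin (order G) → Set where
  here : ∀ {u} → Reachable G u u
  step : ∀ {u v w} → Adj G u v ≡ true → Reachable G v w → Reachable G u w

Connected : Graph → Set
Connected G = (0 < order G) × (∀ u v → Reachable G u v)

induce : (G : Graph) {m : ℕ} → (Fin m → Fin (order G)) → Graph
induce G {m} f = graph m (λ i j → Adj G (f i) (f j))

InducedCopy : (H G : Graph) → Set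
InducedCopy H G = Σ (Fin (order H) → Fin (order G)) λ f →
  Injective _≡_ _≡_ f × (∀ i j → Adj H i j ≡ Adj G (f i) (f j))

_≅_ : Graph → Graph → Set
G ≅ H = Σ (Fin (order G) ↔ Fin (order H)) λ f →
  ∀ u v → Adj G u v ≡ Adj H (Inverse.to f u) (Inverse.to f v)

record Matching (G : Graph) : Set where
  field
    mate    : Fin (order G) → Maybe (Fin (order G))
    mateSym : ∀ u v → mate u ≡ just v → mate v ≡ just u
    mateAdj : ∀ u v → mate u ≡ just v → Adj G u v ≡ true
open Matching public

size : {G : Graph} → Matching G → ℕ
size {G} M = length (filterᵇ (λ u → lower u (mate M u)) (allFin (order G)))
  where
  lower : Fin (order G) → Maybe (Fin (order G)) → Bool
  lower u (just v) = toℕ u <ᵇ toℕ v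
  lower u nothing  = false

isUnsat : {n : ℕ} → Maybe (Fin n) → Bool
isUnsat (just _) = false
isUnsat nothing  = true

unsaturated : {G : Graph} → Matching G → ℕ
unsaturated {G} M = length (filterᵇ (λ u → isUnsat (mate M u)) (allFin (order G)))

IsMaximum : {G : Graph} → Matching G → Set
IsMaximum {G} M = ∀ (M' : Matching G) → size M' ≤ size M

Def : Graph → ℕ → Set
Def G d = Σ (Matching G) λ M → IsMaximum M × unsaturated M ≡ d

DeficiencyCritical : Graph → Set
DeficiencyCritical G = Connected G ×
  (∀ (m : ℕ) (f : Fin m → Fin (order G)) → Injective _≡_ _≡_ f → m < order G →
     Connected (induce G f) →
     ∀ d' d → Def (induce G f) d' → Def G d → d' < d)

fromEdges : (N : ℕ) → List (ℕ × ℕ) → Graph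
fromEdges N es = graph N (λ i j → any (λ { (a , b) →
  ((toℕ i ≡ᵇ a) ∧ (toℕ j ≡ᵇ b)) ∨ ((toℕ i ≡ᵇ b) ∧ (toℕ j ≡ᵇ a)) }) es)

star : ℕ → Graph
star t = fromEdges (suc t) (map (λ r → (0 , suc r)) (upTo t))

pathEdges : ℕ → List (ℕ × ℕ)
pathEdges i = map (λ j → (j , suc j)) (upTo (i ∸ 1))

-- bone B_i (i ≥ 2): path 0..i-1, pendants i, i+1 at 0 and i+2, i+3 at i-1
bone : ℕ → Graph
bone i = fromEdges (i + 4)
  (pathEdges i ++ ((0 , i) ∷ (0 , i + 1) ∷ (i ∸ 1 , i + 2) ∷ (i ∸ 1 , i + 3) ∷ []))

-- Attaching D_k^p (p ≥ 1) at vertex v, new vertices numbered from o.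
-- The path of D_k^p is v = w_0, w_1 = o, ..., w_{p-1} = o + p - 2,
-- and w_{p-1} carries k pendants o+(p-1), ..., o+(p-1)+k-1.
chain : ℕ → ℕ → ℕ → ℕ
chain v o zero    = v
chain v o (suc j) = o + j

attachD : (v o k p : ℕ) → List (ℕ × ℕ)
attachD v o k p =
  map (λ j → (chain v o j , chain v o (suc j))) (upTo (p ∸ 1)) ++
  map (λ r → (chain v o (p ∸ 1) , o + (p ∸ 1) + r)) (upTo k)

-- number of new vertices added by attaching D_k^p
sizeD : ℕ → ℕ → ℕ
sizeD k p = (p ∸ 1) + k

-- T_k^p: K_{2,k} with parts {0,1} and {2..k+1}, D_k^p attached at 0 and at 1
T : ℕ → ℕ → Graph
T k p = fromEdges (2 + k + 2 * sizeD k p)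
  (concatMap (λ m → (0 , 2 + m) ∷ (1 , 2 + m) ∷ []) (upTo k) ++
   attachD 0 (2 + k) k p ++
   attachD 1 (2 + k + sizeD k p) k p)

-- S_k^p: k copies of D_{k-1}^p with ends identified into vertex 0
S : ℕ → ℕ → Graph
S k p = fromEdges (1 + k * sizeD (k ∸ 1) p)
  (concatMap (λ c → attachD 0 (1 + c * sizeD (k ∸ 1) p) (k ∸ 1) p) (upTo k))

Odd : ℕ → Set
Odd p = ∃ λ k → p ≡ suc (2 * k)

InClass : ℕ → ℕ → Graph → Set
InClass p q G = Connected G ×
  (∀ i → 2 ≤ i → InducedCopy (bone i) G → (i ≡ p) ⊎ (i ≡ q))

LocalIndepBelow : Graph → ℕ → Set
LocalIndepBelow G n = ∀ t → InducedCopy (star t) G → t < n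

{-# OPTIONS --safe #-}

-- A matching is built greedily along a rooted tree: deepest adjacent vertices are matched with each other, and otherwise
-- a vertex u is removed together with all its children, at the cost of (number of children) - 1 unmatched vertices.
-- So the deficiency is bounded by the number of vertices with two independent children (branching vertices), weighted.
--
-- In a critical graph the same removal steps show: if a connected set S contains all leafy vertices (those with two
-- pendant leaves), then every vertex outside S is adjacent to S, and these vertices are independent. Any induced path
-- between two leafy vertices, or from a leafy vertex to the centre of a claw, completes to a bone and so has p or q
-- vertices. If q = 2p + 1, a third leafy vertex would give a forbidden bone, so S can be taken to be an induced path
-- with p or q vertices; only its vertices number p and q branch, counted from the root. If q = 2p - 1, the leafy vertices
-- are the centre or the ends of a spider, whose legs are paths on p vertices meeting at the centre; with at least three
-- legs and the root at the centre only the ends of the legs branch. In the extremal cases the branching vertices have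
-- n - 2 children each, which yields an induced copy of T or S; by criticality it is all of G, because a vertex cover
-- shows that the copy has full deficiency.

module Submission where

open import Defs
open import Data.Nat using (ℕ; zero; suc; _+_; _*_; _∸_; _≤_; _<_; z≤n; s≤s; s≤s⁻¹; _≤?_; _<?_; _<ᵇ_; _≤ᵇ_)
open import Data.Nat.Properties
open import Data.Nat.DivMod using (_/_; _%_; m≡m%n+[m/n]*n; m%n<n; m<n*o⇒m/o<n; +-distrib-/-∣ʳ; m<n⇒m/n≡0; m*n/n≡m; [m+kn]%n≡m%n; m<n⇒m%n≡m)
open import Data.Nat.Divisibility using (n∣m*n)
open import Data.List.Properties using (length-++; length-map; length-upTo)
open import Data.Nat.Tactic.RingSolver using (solve)
open import Data.Bool using (Bool; true; false; _∧_; _∨_; not; if_then_else_)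
import Data.Bool.Properties as 𝔹
open import Data.Fin using (Fin; zero; suc; toℕ; fromℕ<)
import Data.Fin.Properties as 𝔽
open import Data.List using (List; []; _∷_; map; _++_; upTo; allFin; tabulate; filterᵇ; length; concatMap)
open import Data.List.Membership.Propositional using (_∈_)
open import Data.List.Membership.Propositional.Properties using (∈-map⁺; ∈-map⁻; ∈-upTo⁺; ∈-upTo⁻; ∈-++⁺ˡ; ∈-++⁺ʳ; ∈-++⁻)
open import Data.List.Relation.Unary.Any using (here; there)
open import Data.Maybe using (Maybe; just; nothing)
open import Data.Maybe.Properties using (just-injective)
open import Data.Product using (Σ; _×_; _,_; ∃; proj₁; proj₂)
open import Data.Sum using (_⊎_; inj₁; inj₂; [_,_]′)
open import Data.Empty using (⊥; ⊥-elim)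
open import Function using (_∘_; id)
open import Function.Bundles using (_⇔_; _↔_; mk⇔; Inverse; mk↔ₛ′)
open import Function.Definitions using (Injective)
open import Relation.Binary.Definitions using (tri<; tri≈; tri>)
open import Relation.Nullary using (¬_; Dec; yes; no; does)
open import Relation.Nullary.Decidable using (dec-true; dec-false; _×-dec_; _⊎-dec_; ¬?)
open import Relation.Binary.PropositionalEquality hiding (J)

-- The two values come from the greedy matching. A root has at most n - 1 independent children; a
-- vertex further along the path or leg has at most n - 2, since its predecessor is one more
-- independent neighbour. Branching thus costs n - 2 at the root and n - 3 elsewhere: a root and two
-- further vertices give (n - 2) + 2(n - 3) = 3n - 8, a centre with n - 1 legs gives (n - 2) + (n -
-- 1)(n - 3) = n^2 - 3n + 1. The number 2p + 1 counts the vertices between the leafy ends of T, with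
-- one middle vertex between two arms of p; 2p - 1 counts two legs of S that share the centre. The
-- parity of p enters twice. A path that leads from a further leafy vertex to a known path may
-- arrive at two consecutive vertices of it; the two resulting bones have lengths of different
-- parity, while p and q are both odd. And since p - 1 is even, every second vertex of an arm can be
-- taken into a vertex cover that also covers the pendants. Growing a spider is not just a matter of
-- adding legs: a new leafy vertex can be a second centre, and then the centre has to move.

contra : ∀ {l r} k → l ≤ r → l ≡ suc (r + k) → ⊥
contra {_} {r} k le refl = <-irrefl refl (≤-trans (s≤s (m≤m+n r k)) le)

true≢false : ∀ {b} → b ≡ true → b ≡ false → ⊥
true≢false refl ()

¬true⇒false : ∀ {b} → ¬ (b ≡ true) → b ≡ false
¬true⇒false {true} h = ⊥-elim (h refl)
¬true⇒false {false} h = refl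

bool-ext : ∀ {a b} → (a ≡ true → b ≡ true) → (b ≡ true → a ≡ true) → a ≡ b
bool-ext {true} {b} f g = sym (f refl)
bool-ext {false} {true} f g = g refl
bool-ext {false} {false} f g = refl

∨-case : ∀ {a b} → a ∨ b ≡ true → a ≡ true ⊎ b ≡ true
∨-case {true} e = inj₁ refl
∨-case {false} e = inj₂ e

∨-inl : ∀ {a b} → a ≡ true → a ∨ b ≡ true
∨-inl refl = refl

∨-inr : ∀ {a b} → b ≡ true → a ∨ b ≡ true
∨-inr {a} refl = 𝔹.∨-zeroʳ a

∧-in : ∀ {a b} → a ≡ true → b ≡ true → a ∧ b ≡ true
∧-in refl refl = refl

∧-l : ∀ {a b} → a ∧ b ≡ true → a ≡ true
∧-l {true} e = refl

∧-r : ∀ {a b} → a ∧ b ≡ true → b ≡ true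
∧-r {true} e = e

not-in : ∀ {a} → ¬ (a ≡ true) → not a ≡ true
not-in {true} h = ⊥-elim (h refl)
not-in {false} h = refl

not-out : ∀ {a} → not a ≡ true → ¬ (a ≡ true)
not-out {false} e ()

does⇒ : ∀ {ℓ} {P : Set ℓ} (d : Dec P) → does d ≡ true → P
does⇒ (yes p) e = p

infix 4 _==_
_==_ : ∀ {n} → Fin n → Fin n → Bool
u == v = does (u 𝔽.≟ v)

==⇒≡ : ∀ {n} {u v : Fin n} → (u == v) ≡ true → u ≡ v
==⇒≡ {u = u} {v} = does⇒ (u 𝔽.≟ v)

==-refl : ∀ {n} (u : Fin n) → (u == u) ≡ true
==-refl u = dec-true (u 𝔽.≟ u) refl

-- Sums and counting over Fin n

sumF : ∀ {n} → (Fin n → ℕ) → ℕ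
sumF {zero} f = 0
sumF {suc n} f = f zero + sumF (f ∘ suc)

b2n : Bool → ℕ
b2n true = 1
b2n false = 0

count : ∀ {n} → (Fin n → Bool) → ℕ
count P = sumF (b2n ∘ P)

sumF-mono : ∀ {n} {f g : Fin n → ℕ} → (∀ i → f i ≤ g i) → sumF f ≤ sumF g
sumF-mono {zero} h = z≤n
sumF-mono {suc n} h = +-mono-≤ (h zero) (sumF-mono (h ∘ suc))

sumF-cong : ∀ {n} {f g : Fin n → ℕ} → (∀ i → f i ≡ g i) → sumF f ≡ sumF g
sumF-cong {zero} h = refl
sumF-cong {suc n} h = cong₂ _+_ (h zero) (sumF-cong (h ∘ suc))

sumF-+ : ∀ {n} (f g : Fin n → ℕ) → sumF (λ i → f i + g i) ≡ sumF f + sumF g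
sumF-+ {zero} f g = refl
sumF-+ {suc n} f g = trans (cong (f zero + g zero +_) (sumF-+ (f ∘ suc) (g ∘ suc)))
  (mid (f zero) (g zero) (sumF (f ∘ suc)) (sumF (g ∘ suc)))
  where
  mid : ∀ a b c d → a + b + (c + d) ≡ a + c + (b + d)
  mid a b c d = solve (a ∷ b ∷ c ∷ d ∷ [])

sumF-zero : ∀ n → sumF {n} (λ _ → 0) ≡ 0
sumF-zero zero = refl
sumF-zero (suc n) = sumF-zero n

sumF-const : ∀ n w → sumF {n} (λ _ → w) ≡ n * w
sumF-const zero w = refl
sumF-const (suc n) w = cong (w +_) (sumF-const n w)

sumF-strict : ∀ {n} {f g : Fin n → ℕ} → (∀ i → f i ≤ g i) → ∀ i → f i < g i → sumF f < sumF g
sumF-strict h zero lt = +-mono-<-≤ lt (sumF-mono (h ∘ suc))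
sumF-strict h (suc i) lt = +-mono-≤-< (h zero) (sumF-strict (h ∘ suc) i lt)

point : ∀ {n} → Fin n → ℕ → Fin n → ℕ
point x w v = if x == v then w else 0

point-self : ∀ {n} (x : Fin n) w → point x w x ≡ w
point-self x w rewrite ==-refl x = refl

point-suc : ∀ {n} (x y : Fin n) w → point (suc x) w (suc y) ≡ point x w y
point-suc x y w with x 𝔽.≟ y
... | yes _ = refl
... | no _ = refl

sumF-point : ∀ {n} (x : Fin n) w → sumF (point x w) ≡ w
sumF-point {suc n} zero w = trans (cong (w +_) (sumF-zero n)) (+-identityʳ w)
sumF-point {suc n} (suc x) w = trans (sumF-cong (λ y → point-suc x y w)) (sumF-point x w)

b2n-mono : ∀ {a b} → (a ≡ true → b ≡ true) → b2n a ≤ b2n b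
b2n-mono {false} h = z≤n
b2n-mono {true} h rewrite h refl = ≤-refl

count-mono : ∀ {n} {P Q : Fin n → Bool} → (∀ u → P u ≡ true → Q u ≡ true) → count P ≤ count Q
count-mono h = sumF-mono (λ i → b2n-mono (h i))

count-∨ : ∀ {n} (P Q : Fin n → Bool) → count (λ u → P u ∨ Q u) ≤ count P + count Q
count-∨ P Q = ≤-trans (sumF-mono (λ u → lem (P u) (Q u))) (≤-reflexive (sumF-+ (b2n ∘ P) (b2n ∘ Q)))
  where
  lem : ∀ a b → b2n (a ∨ b) ≤ b2n a + b2n b
  lem true b = s≤s z≤n
  lem false b = ≤-refl

count-single : ∀ {n} (x : Fin n) → count (x ==_) ≡ 1
count-single x = trans (sumF-cong (λ v → lem (x == v))) (sumF-point x 1)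
  where
  lem : ∀ b → b2n b ≡ (if b then 1 else 0)
  lem true = refl
  lem false = refl

count-insert : ∀ {n} (P Q : Fin n → Bool) x → (∀ u → P u ≡ true → Q u ≡ true) →
  P x ≡ false → Q x ≡ true → suc (count P) ≤ count Q
count-insert P Q x sub px qx = ≤-trans (≤-reflexive (sym eq)) (sumF-mono le)
  where
  eq : sumF (λ u → b2n (x == u) + b2n (P u)) ≡ suc (count P)
  eq = trans (sumF-+ (λ u → b2n (x == u)) (b2n ∘ P)) (cong (_+ count P) (count-single x))
  le : ∀ u → b2n (x == u) + b2n (P u) ≤ b2n (Q u)
  le u with x 𝔽.≟ u
  ... | yes refl rewrite px | qx = ≤-refl
  ... | no _ = b2n-mono (sub u)

count-all : ∀ n → count {n} (λ _ → true) ≡ n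
count-all n = trans (sumF-const n 1) (*-identityʳ n)

count-≤n : ∀ {n} (P : Fin n → Bool) → count P ≤ n
count-≤n {n} P = ≤-trans (count-mono {P = P} {Q = λ _ → true} (λ _ _ → refl)) (≤-reflexive (count-all n))

enum : ∀ {n} (P : Fin n → Bool) → Fin (count P) → Fin n
enum {suc n} P i with P zero
enum {suc n} P zero | true = zero
enum {suc n} P (suc i) | true = suc (enum (P ∘ suc) i)
enum {suc n} P i | false = suc (enum (P ∘ suc) i)

enum-inj : ∀ {n} (P : Fin n → Bool) {i j} → enum P i ≡ enum P j → i ≡ j
enum-inj {suc n} P {i} {j} e with P zero
enum-inj {suc n} P {zero} {zero} e | true = refl
enum-inj {suc n} P {suc i} {suc j} e | true = cong suc (enum-inj (P ∘ suc) (𝔽.suc-injective e))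
enum-inj {suc n} P {i} {j} e | false = enum-inj (P ∘ suc) (𝔽.suc-injective e)

enum-true : ∀ {n} (P : Fin n → Bool) i → P (enum P i) ≡ true
enum-true {suc n} P i with P zero in eq
enum-true {suc n} P zero | true = eq
enum-true {suc n} P (suc i) | true = enum-true (P ∘ suc) i
enum-true {suc n} P i | false = enum-true (P ∘ suc) i

enum-sur : ∀ {n} (P : Fin n → Bool) v → P v ≡ true → ∃ λ i → enum P i ≡ v
enum-sur {suc n} P zero pv with P zero
... | true = zero , refl
enum-sur {suc n} P (suc v) pv with P zero | enum-sur (P ∘ suc) v pv
... | true | i , e = suc i , cong suc e
... | false | i , e = i , cong suc e

count-lower : ∀ {n t} (P : Fin n → Bool) (g : Fin t → Fin n) → (∀ {i j} → g i ≡ g j → i ≡ j) →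
  (∀ i → P (g i) ≡ true) → t ≤ count P
count-lower P g inj pg = 𝔽.injective⇒≤ {f = λ i → proj₁ (enum-sur P (g i) (pg i))} λ {i} {j} e →
  inj (trans (sym (proj₂ (enum-sur P (g i) (pg i)))) (trans (cong (enum P) e) (proj₂ (enum-sur P (g j) (pg j)))))

count-inj : ∀ {m n} (P : Fin m → Bool) (Q : Fin n → Bool) (g : ∀ i → P i ≡ true → Fin n) →
  (∀ i p → Q (g i p) ≡ true) → (∀ {i j} p q → g i p ≡ g j q → i ≡ j) → count P ≤ count Q
count-inj P Q g gq inj = count-lower Q (λ i → g (enum P i) (enum-true P i))
  (λ {i} {j} e → enum-inj P (inj (enum-true P i) (enum-true P j) e)) (λ i → gq _ (enum-true P i))

count-upper : ∀ {n t} (P : Fin n → Bool) (g : Fin n → ℕ) → (∀ u → P u ≡ true → g u < t) →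
  (∀ {u v} → P u ≡ true → P v ≡ true → g u ≡ g v → u ≡ v) → count P ≤ t
count-upper {n} {t} P g lt inj = ≤-trans
  (count-inj P (λ _ → true) (λ i p → fromℕ< (lt i p)) (λ _ _ → refl)
    (λ {i} {j} p q e → inj p q (trans (sym (𝔽.toℕ-fromℕ< (lt i p))) (trans (cong toℕ e) (𝔽.toℕ-fromℕ< (lt j q))))))
  (≤-reflexive (count-all t))

length-filter : ∀ {n m} (P : Fin n → Bool) (f : Fin m → Fin n) →
  length (filterᵇ P (tabulate f)) ≡ count (P ∘ f)
length-filter {m = zero} P f = refl
length-filter {m = suc m} P f with P (f zero)
... | true = cong suc (length-filter P (f ∘ suc))
... | false = length-filter P (f ∘ suc)

length-filter-all : ∀ {n} (P : Fin n → Bool) → length (filterᵇ P (allFin n)) ≡ count P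
length-filter-all P = length-filter P id

-- The predicate counted by size is local to Defs; unification recovers it.
sizeP : ∀ {G} (M : Matching G) → Σ (Fin (order G) → Bool) λ P → size M ≡ length (filterᵇ P (allFin _))
sizeP M = _ , refl

sizeP-just : ∀ {G} (M : Matching G) {u v} → mate M u ≡ just v → proj₁ (sizeP M) u ≡ (toℕ u <ᵇ toℕ v)
sizeP-just M {u} e rewrite e = refl

least : (P : ℕ → Bool) → ∀ k → P k ≡ true → ∃ λ j → j ≤ k × P j ≡ true × (∀ i → i < j → P i ≡ false)
least P zero h = 0 , z≤n , h , λ i ()
least P (suc k) h with P 0 in e
... | true = 0 , z≤n , e , λ i ()
... | false with least (P ∘ suc) k h
... | j , jk , pj , mn = suc j , s≤s jk , pj , λ { zero _ → e ; (suc i) (s≤s lt) → mn i lt }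

anyF : ∀ {n} → (Fin n → Bool) → Bool
anyF P = does (𝔽.any? (λ v → P v 𝔹.≟ true))

anyF-in : ∀ {n} (P : Fin n → Bool) v → P v ≡ true → anyF P ≡ true
anyF-in P v h = dec-true (𝔽.any? (λ v → P v 𝔹.≟ true)) (v , h)

anyF-out : ∀ {n} (P : Fin n → Bool) → anyF P ≡ true → ∃ λ v → P v ≡ true
anyF-out P = does⇒ (𝔽.any? (λ v → P v 𝔹.≟ true))

zero-or : ∀ j → j ≡ 0 ⊎ 0 < j
zero-or zero = inj₁ refl
zero-or (suc j) = inj₂ (s≤s z≤n)

fin-other : ∀ {k} → 2 ≤ k → (i : Fin k) → ∃ λ b → i ≢ b
fin-other (s≤s (s≤s _)) zero = suc zero , λ ()
fin-other (s≤s (s≤s _)) (suc i) = zero , λ ()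

fin-third : ∀ {k} → 3 ≤ k → (a b : Fin k) → ∃ λ d → a ≢ d × b ≢ d
fin-third (s≤s (s≤s (s≤s _))) zero zero = suc zero , (λ ()) , (λ ())
fin-third (s≤s (s≤s (s≤s _))) zero (suc zero) = suc (suc zero) , (λ ()) , (λ ())
fin-third (s≤s (s≤s (s≤s _))) zero (suc (suc _)) = suc zero , (λ ()) , (λ ())
fin-third (s≤s (s≤s (s≤s _))) (suc zero) zero = suc (suc zero) , (λ ()) , (λ ())
fin-third (s≤s (s≤s (s≤s _))) (suc zero) (suc _) = zero , (λ ()) , (λ ())
fin-third (s≤s (s≤s (s≤s _))) (suc (suc _)) zero = suc zero , (λ ()) , (λ ())
fin-third (s≤s (s≤s (s≤s _))) (suc (suc _)) (suc _) = zero , (λ ()) , (λ ())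

-- Matchings, deficiency and vertex covers

<ᵇ-true : ∀ {m n} → m < n → (m <ᵇ n) ≡ true
<ᵇ-true {m} {n} h = dec-true (m <? n) h

<ᵇ-out : ∀ {m n} → (m <ᵇ n) ≡ true → m < n
<ᵇ-out {m} {n} h = does⇒ (m <? n) h

unsat-count : ∀ {G} (M : Matching G) → unsaturated M ≡ count (λ u → isUnsat (mate M u))
unsat-count M = length-filter-all (λ u → isUnsat (mate M u))

module _ {G : Graph} (sim : IsSimple G) where
  open IsSimple sim

  mate-inj : (M : Matching G) → ∀ {u v w} → mate M u ≡ just w → mate M v ≡ just w → u ≡ v
  mate-inj M e e' = just-injective (trans (sym (mateSym M _ _ e)) (mateSym M _ _ e'))

  module Handshake (M : Matching G) where
    L U : Fin (order G) → Bool
    L = proj₁ (sizeP M)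
    up : Fin (order G) → Maybe (Fin (order G)) → Bool
    up u (just v) = toℕ v <ᵇ toℕ u
    up u nothing = false
    U u = up u (mate M u)

    irr : ∀ {u} → mate M u ≡ just u → ⊥
    irr {u} e = true≢false (mateAdj M u u e) (irreflexive u)

    part : ∀ u → b2n (L u) + b2n (U u) + b2n (isUnsat (mate M u)) ≡ 1
    part u with mate M u in e
    ... | nothing = refl
    ... | just v with <-cmp (toℕ u) (toℕ v)
    ... | tri< a _ c rewrite <ᵇ-true a | dec-false (toℕ v <? toℕ u) c = refl
    ... | tri> a _ c rewrite <ᵇ-true c | dec-false (toℕ u <? toℕ v) a = refl
    ... | tri≈ _ b _ with refl ← 𝔽.toℕ-injective b = ⊥-elim (irr e)

    L-mate : ∀ u → L u ≡ true → ∃ λ v → mate M u ≡ just v × toℕ u < toℕ v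
    L-mate u l with mate M u
    ... | just v = v , refl , <ᵇ-out l

    U-mate : ∀ u → U u ≡ true → ∃ λ v → mate M u ≡ just v × toℕ v < toℕ u
    U-mate u l with mate M u
    ... | just v = v , refl , <ᵇ-out l

    mk-U : ∀ {u v} → mate M u ≡ just v → toℕ v < toℕ u → U u ≡ true
    mk-U e h rewrite e = <ᵇ-true h

    L≤U : count L ≤ count U
    L≤U = count-inj L U (λ u l → proj₁ (L-mate u l))
      (λ u l → let (v , e , h) = L-mate u l in mk-U (mateSym M _ _ e) h)
      (λ {i} {j} p q e → mate-inj M (proj₁ (proj₂ (L-mate i p)))
         (trans (proj₁ (proj₂ (L-mate j q))) (cong just (sym e))))

    U≤L : count U ≤ count L
    U≤L = count-inj U L (λ u l → proj₁ (U-mate u l))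
      (λ u l → let (v , e , h) = U-mate u l in trans (sizeP-just M (mateSym M _ _ e)) (<ᵇ-true h))
      (λ {i} {j} p q e → mate-inj M (proj₁ (proj₂ (U-mate i p)))
         (trans (proj₁ (proj₂ (U-mate j q))) (cong just (sym e))))

    size≡ : size M ≡ count L
    size≡ = trans (proj₂ (sizeP M)) (length-filter-all L)

    -- Each vertex is the smaller end of its matching edge, the larger end, or unmatched, and `mate`
    -- swaps the first two kinds. This turns maximum size, in which `Def` is phrased, into the least
    -- number of unmatched vertices.
    handshake : size M + size M + unsaturated M ≡ order G
    handshake = trans (cong₂ _+_ (cong₂ _+_ size≡ (trans size≡ (≤-antisym L≤U U≤L))) (unsat-count M))
      (trans (sym (trans (sumF-+ (λ u → b2n (L u) + b2n (U u)) _) (cong (_+ count (λ u → isUnsat (mate M u))) (sumF-+ (b2n ∘ L) (b2n ∘ U)))))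
        (trans (sumF-cong part) (trans (sumF-const (order G) 1) (*-identityʳ _))))

  open Handshake using (handshake)

  def-≤ : ∀ {d} → Def G d → (M' : Matching G) → d ≤ unsaturated M'
  def-≤ (M , max , refl) M' = +-cancelˡ-≤ (size M + size M) _ _
    (≤-trans (≤-reflexive (trans (handshake M) (sym (handshake M'))))
      (+-monoˡ-≤ (unsaturated M') (+-mono-≤ (max M') (max M'))))

  Def-unique : ∀ {d d'} → Def G d → Def G d' → d ≡ d'
  Def-unique D@(M , _ , refl) D'@(M' , _ , refl) = ≤-antisym (def-≤ D M') (def-≤ D' M)

  emptyMatching : Matching G
  emptyMatching = record { mate = λ _ → nothing ; mateSym = λ _ _ () ; mateAdj = λ _ _ () }

  -- A matching that is not maximum has a larger one, so without a maximum there would be matchings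
  -- with more edges than vertices. The double negation is enough because every use ends in a
  -- contradiction.
  ¬¬Def : ¬ ¬ (∃ λ d → Def G d)
  ¬¬Def nd = big (suc (order G)) λ { (M , h) → contra 0
      (≤-trans h (≤-trans (m≤m+n (size M) (size M)) (≤-trans (m≤m+n _ (unsaturated M)) (≤-reflexive (handshake M)))))
      (sym (+-identityʳ _)) }
    where
    big : ∀ k → ¬ ¬ (Σ (Matching G) λ M → k ≤ size M)
    big zero h = h (emptyMatching , z≤n)
    big (suc k) h = big k λ { (M , km) → nd (unsaturated M , M ,
      (λ M' → ≤-trans (≮⇒≥ (λ lt → h (M' , lt))) km) , refl) }

  -- A matched vertex lies in the cover or has its mate there, and distinct vertices have distinct
  -- mates, so at most twice as many vertices are matched as the cover has entries. The cover is a
  -- list of numbers, read through `g`, so that one list serves every copy of T or S.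
  cover-bound : (M : Matching G) (S : List ℕ) (g : Fin (order G) → ℕ) → (∀ {u v} → g u ≡ g v → u ≡ v) →
    (∀ u v → Adj G u v ≡ true → (g u ∈ S) ⊎ (g v ∈ S)) → order G ≤ unsaturated M + (length S + length S)
  cover-bound M S g inj cov = ≤-trans (≤-reflexive (sym (count-all _)))
    (≤-trans (count-mono {P = λ _ → true} {Q = λ u → isUnsat (mate M u) ∨ (C u ∨ CM u)} split)
      (≤-trans (count-∨ (λ u → isUnsat (mate M u)) (λ u → C u ∨ CM u))
        (+-mono-≤ (≤-reflexive (sym (unsat-count M)))
          (≤-trans (count-∨ C CM) (+-mono-≤ C≤ (≤-trans CM≤C C≤))))))
    where
    memb : List ℕ → Fin (order G) → Bool
    memb [] u = false
    memb (x ∷ xs) u = does (g u ≟ x) ∨ memb xs u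
    C = memb S
    cm : Maybe (Fin (order G)) → Bool
    cm (just v) = C v
    cm nothing = false
    CM : Fin (order G) → Bool
    CM u = cm (mate M u)
    memb-in : ∀ xs {u} → g u ∈ xs → memb xs u ≡ true
    memb-in (x ∷ xs) {u} (here e) = ∨-inl (dec-true (g u ≟ x) e)
    memb-in (x ∷ xs) (there m) = ∨-inr (memb-in xs m)
    memb≤ : ∀ xs → count (memb xs) ≤ length xs
    memb≤ [] = ≤-reflexive (sumF-zero (order G))
    memb≤ (x ∷ xs) = ≤-trans (count-∨ (λ u → does (g u ≟ x)) (memb xs)) (+-mono-≤
      (count-upper (λ u → does (g u ≟ x)) (λ _ → 0) (λ _ _ → s≤s z≤n)
        (λ {u} {v} p q _ → inj (trans (does⇒ (g u ≟ x) p) (sym (does⇒ (g v ≟ x) q)))))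
      (memb≤ xs))
    C≤ : count C ≤ length S
    C≤ = memb≤ S
    cm-just : ∀ m → cm m ≡ true → ∃ λ v → m ≡ just v × C v ≡ true
    cm-just (just v) h = v , refl , h
    CM≤C : count CM ≤ count C
    CM≤C = count-inj CM C (λ u h → proj₁ (cm-just (mate M u) h)) (λ u h → proj₂ (proj₂ (cm-just (mate M u) h)))
      (λ {i} {j} p q e → mate-inj M (proj₁ (proj₂ (cm-just (mate M i) p)))
         (trans (proj₁ (proj₂ (cm-just (mate M j) q))) (cong just (sym e))))
    split : ∀ u → true ≡ true → isUnsat (mate M u) ∨ (C u ∨ CM u) ≡ true
    split u _ with mate M u in e
    ... | nothing = refl
    ... | just v with cov u v (mateAdj M u v e)
    ... | inj₁ h = ∨-inl (memb-in S h)
    ... | inj₂ h = ∨-inr {C u} (memb-in S h)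

induce-simple : ∀ {G m} → IsSimple G → (f : Fin m → Fin (order G)) → IsSimple (induce G f)
induce-simple sim f = record { symmetric = λ u v → IsSimple.symmetric sim (f u) (f v)
                             ; irreflexive = λ v → IsSimple.irreflexive sim (f v) }

critical-use : ∀ {G d} → IsSimple G → DeficiencyCritical G → Def G d →
  ∀ {m} (f : Fin m → Fin (order G)) → Injective _≡_ _≡_ f → m < order G → Connected (induce G f) →
  ¬ ¬ (Σ (Matching (induce G f)) λ M → unsaturated M < d)
critical-use sim (_ , crit) D f inj lt con k = ¬¬Def (induce-simple sim f) λ { (d' , D'@(M , _ , e)) →
  k (M , subst (_< _) (sym e) (crit _ f inj lt con d' _ D' D)) }

module Remove {G : Graph} (sim : IsSimple G) (a b : Fin (order G)) (ab : Adj G a b ≡ true) where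
  open IsSimple sim
  private V = Fin (order G)

  a≢b : a ≢ b
  a≢b refl = true≢false ab (irreflexive a)

  A : V → Bool
  A u = not (a == u) ∧ not (b == u)

  A-in : ∀ {u} → u ≢ a → u ≢ b → A u ≡ true
  A-in ua ub = ∧-in (not-in λ h → ua (sym (==⇒≡ h))) (not-in λ h → ub (sym (==⇒≡ h)))

  A-a : ∀ {u} → A u ≡ true → u ≢ a
  A-a {u} h refl = not-out (∧-l h) (==-refl a)

  A-b : ∀ {u} → A u ≡ true → u ≢ b
  A-b {u} h refl = not-out (∧-r {not (a == b)} h) (==-refl b)

  H : Graph
  H = induce G (enum A)

  idx : ∀ u → u ≢ a → u ≢ b → ∃ λ i → enum A i ≡ u
  idx u ua ub = enum-sur A u (A-in ua ub)

  liftM : Maybe (Fin (count A)) → Maybe V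
  liftM (just j) = just (enum A j)
  liftM nothing = nothing

  module _ (M : Matching H) where
    mt : V → Maybe V
    mt u with u 𝔽.≟ a | u 𝔽.≟ b
    ... | yes _ | _ = just b
    ... | no _ | yes _ = just a
    ... | no ua | no ub = liftM (mate M (proj₁ (idx u ua ub)))

    mt-a : mt a ≡ just b
    mt-a with a 𝔽.≟ a | a 𝔽.≟ b
    ... | yes _ | _ = refl
    ... | no h | _ = ⊥-elim (h refl)

    mt-b : mt b ≡ just a
    mt-b with b 𝔽.≟ a | b 𝔽.≟ b
    ... | yes e | _ = ⊥-elim (a≢b (sym e))
    ... | no _ | yes _ = refl
    ... | no _ | no h = ⊥-elim (h refl)

    mt-e : ∀ i → mt (enum A i) ≡ liftM (mate M i)
    mt-e i with enum A i 𝔽.≟ a | enum A i 𝔽.≟ b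
    ... | yes e | _ = ⊥-elim (A-a (enum-true A i) e)
    ... | no _ | yes e = ⊥-elim (A-b (enum-true A i) e)
    ... | no ua | no ub = cong (liftM ∘ mate M) (enum-inj A (proj₂ (idx (enum A i) ua ub)))

    data View : V → Set where
      va : View a
      vb : View b
      ve : ∀ i → View (enum A i)

    view : ∀ u → View u
    view u with u 𝔽.≟ a | u 𝔽.≟ b
    ... | yes refl | _ = va
    ... | no _ | yes refl = vb
    ... | no ua | no ub with idx u ua ub
    ... | i , refl = ve i

    liftM-just : ∀ {m v} → liftM m ≡ just v → ∃ λ j → m ≡ just j × enum A j ≡ v
    liftM-just {just j} refl = j , refl , refl

    both : ∀ u v → mt u ≡ just v → (mt v ≡ just u) × (Adj G u v ≡ true)
    both u v e with view u
    ... | va with refl ← trans (sym mt-a) e = mt-b , ab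
    ... | vb with refl ← trans (sym mt-b) e = mt-a , trans (symmetric b a) ab
    ... | ve i with liftM-just (trans (sym (mt-e i)) e)
    ... | j , mj , refl = trans (mt-e j) (cong liftM (mateSym M i j mj)) , mateAdj M i j mj

    extended : Matching G
    extended = record { mate = mt ; mateSym = λ u v e → proj₁ (both u v e) ; mateAdj = λ u v e → proj₂ (both u v e) }

    unsat-ix : ∀ u → isUnsat (mt u) ≡ true → ∃ λ i → enum A i ≡ u × isUnsat (mate M i) ≡ true
    unsat-ix u h with view u
    ... | va = ⊥-elim (true≢false h (cong isUnsat mt-a))
    ... | vb = ⊥-elim (true≢false h (cong isUnsat mt-b))
    ... | ve i = i , refl , lem (mate M i) (trans (sym (cong isUnsat (mt-e i))) h)
      where
      lem : ∀ m → isUnsat (liftM m) ≡ true → isUnsat m ≡ true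
      lem nothing h = refl

    extended-unsat : unsaturated extended ≤ unsaturated M
    extended-unsat = ≤-trans (≤-reflexive (unsat-count extended)) (≤-trans
      (count-inj (λ u → isUnsat (mt u)) (λ i → isUnsat (mate M i)) (λ u h → proj₁ (unsat-ix u h))
        (λ u h → proj₂ (proj₂ (unsat-ix u h)))
        (λ {i} {j} p q e → trans (sym (proj₁ (proj₂ (unsat-ix i p)))) (trans (cong (enum A) e) (proj₁ (proj₂ (unsat-ix j q))))))
      (≤-reflexive (sym (unsat-count M))))

  -- The extended matching gives def(G) ≤ def(H), while criticality demands def(H) < def(G) for the
  -- connected proper subgraph H.
  not-critical : ∀ {d} → DeficiencyCritical G → Def G d → Connected H → ⊥
  not-critical crit D con = critical-use sim crit D (enum A) (enum-inj A)
    (≤-trans (count-insert A (λ _ → true) a (λ _ _ → refl) (¬true⇒false λ h → A-a h refl) refl) (≤-reflexive (count-all _)))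
    con λ { (M , lt) → <-irrefl refl (≤-trans lt (≤-trans (def-≤ sim D (extended M)) (extended-unsat M))) }

-- The greedy matching along levels

argmax : ∀ {n} (P : Fin n → Bool) (f : Fin n → ℕ) →
  (∀ v → P v ≡ false) ⊎ (∃ λ v → P v ≡ true × (∀ u → P u ≡ true → f u ≤ f v))
argmax {zero} P f = inj₁ λ ()
argmax {suc n} P f with argmax (P ∘ suc) (f ∘ suc) | P zero in e
... | inj₁ none | false = inj₁ λ { zero → e ; (suc v) → none v }
... | inj₁ none | true = inj₂ (zero , e , λ { zero _ → ≤-refl ; (suc v) h → ⊥-elim (true≢false h (none v)) })
... | inj₂ (v , pv , mx) | false = inj₂ (suc v , pv , λ { zero h → ⊥-elim (true≢false h e) ; (suc u) h → mx u h })
... | inj₂ (v , pv , mx) | true with ≤-total (f zero) (f (suc v))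
... | inj₁ le = inj₂ (suc v , pv , λ { zero _ → le ; (suc u) h → mx u h })
... | inj₂ ge = inj₂ (zero , e , λ { zero _ → ≤-refl ; (suc u) h → ≤-trans (mx u h) ge })

-- Removing from the deepest level either two adjacent vertices, or a vertex together with all its
-- children, keeps the tree structure of the levels; the second step leaves at most c u vertices unmatched.
module Process {G : Graph} (sim : IsSimple G) (lv : Fin (order G) → ℕ) (r : Fin (order G))
  (root : ∀ v → lv v ≡ 0 → v ≡ r)
  (parent : ∀ v m → lv v ≡ suc m → ∃ λ u → Adj G u v ≡ true × lv u ≡ m)
  (c : Fin (order G) → ℕ) (c-root : 1 ≤ c r)
  (children : ∀ u (W : Fin (order G) → Bool) →
     (∀ w → W w ≡ true → Adj G u w ≡ true × lv w ≡ suc (lv u)) →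
     (∀ w w' → W w ≡ true → W w' ≡ true → Adj G w w' ≡ false) → count W ≤ suc (c u))
  where
  open IsSimple sim
  private V = Fin (order G)

  -- The invariant of the removal steps: no remaining vertex loses its last parent, so the remaining
  -- levels can be treated as a tree again.
  Closed : (V → Bool) → Set
  Closed A = ∀ v m → A v ≡ true → lv v ≡ suc m → ∃ λ u → A u ≡ true × Adj G u v ≡ true × lv u ≡ m

  weight : (V → Bool) → ℕ
  weight A = sumF (λ v → if A v then c v else 0)

  unsatIn : (V → Bool) → (V → Maybe V) → ℕ
  unsatIn A mt = count (λ u → A u ∧ isUnsat (mt u))

  Supported : (V → Bool) → (V → Maybe V) → Set
  Supported A mt = ∀ u v → mt u ≡ just v → mt v ≡ just u × Adj G u v ≡ true × A u ≡ true

  module AddEdge (A : V → Bool) (mt : V → Maybe V) (sup : Supported A mt) (x y : V)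
    (xy : Adj G x y ≡ true) (x∉ : A x ≡ false) (y∉ : A y ≡ false) where
    mt' : V → Maybe V
    mt' z = if x == z then just y else (if y == z then just x else mt z)

    x≢y : x ≢ y
    x≢y refl = true≢false xy (irreflexive x)

    mt'-x : mt' x ≡ just y
    mt'-x rewrite ==-refl x = refl

    mt'-y : mt' y ≡ just x
    mt'-y rewrite dec-false (x 𝔽.≟ y) x≢y | ==-refl y = refl

    mt'-o : ∀ {z} → z ≢ x → z ≢ y → mt' z ≡ mt z
    mt'-o {z} zx zy rewrite dec-false (x 𝔽.≟ z) (zx ∘ sym) | dec-false (y 𝔽.≟ z) (zy ∘ sym) = refl

    sup' : (B : V → Bool) → (∀ z → A z ≡ true → B z ≡ true) → B x ≡ true → B y ≡ true → Supported B mt'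
    sup' B sub bx by u v e with u 𝔽.≟ x | u 𝔽.≟ y
    ... | yes refl | _ with refl ← trans (sym mt'-x) e = mt'-y , xy , bx
    ... | no _ | yes refl with refl ← trans (sym mt'-y) e = mt'-x , trans (symmetric y x) xy , by
    ... | no ux | no uy with sup u v (trans (sym (mt'-o ux uy)) e)
    ... | vu , uv , au with sup v u vu
    ... | _ , _ , av = trans (mt'-o (λ { refl → true≢false av x∉ }) (λ { refl → true≢false av y∉ })) vu , uv , sub u au

    unsat' : ∀ {z} → isUnsat (mt' z) ≡ true → z ≢ x × z ≢ y × isUnsat (mt z) ≡ true
    unsat' {z} h = zx , zy , trans (sym (cong isUnsat (mt'-o zx zy))) h
      where
      zx : z ≢ x
      zx refl = true≢false h (cong isUnsat mt'-x)
      zy : z ≢ y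
      zy refl = true≢false h (cong isUnsat mt'-y)

  Result : (V → Bool) → Set
  Result A = Σ (V → Maybe V) λ mt → Supported A mt × unsatIn A mt ≤ weight A

  noMates : (A : V → Bool) → Supported A (λ _ → nothing)
  noMates A u v ()

  module Minus (A : V → Bool) (D : V → Bool) where
    A' : V → Bool
    A' z = A z ∧ not (D z)

    sub : ∀ z → A' z ≡ true → A z ≡ true
    sub z h = ∧-l h

    out : ∀ {z} → A' z ≡ true → D z ≡ true → ⊥
    out {z} h = not-out (∧-r {A z} h)

    in' : ∀ {z} → A z ≡ true → ¬ (D z ≡ true) → A' z ≡ true
    in' a nd = ∧-in a (not-in nd)

    notin : ∀ {z} → D z ≡ true → A' z ≡ false
    notin d = ¬true⇒false λ h → out h d

  run : ∀ k (A : V → Bool) → count A ≤ k → Closed A → Result A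
  run k A ck cl with argmax A lv
  run k A ck cl | inj₁ none = (λ _ → nothing) , noMates A , ≤-trans (count-mono {Q = A} (λ u h → ∧-l h))
    (≤-trans (≤-reflexive (trans (sumF-cong (λ v → cong b2n (none v))) (sumF-zero (order G)))) z≤n)
  run zero A ck cl | inj₂ (v , av , mx) = ⊥-elim (1+n≰n
    (≤-trans (count-insert (λ _ → false) A v (λ _ ()) refl av) (≤-trans ck z≤n)))
  run (suc k) A ck cl | inj₂ (v , av , mx) with lv v in lve
  -- Only the root is left and stays unmatched; its weight is at least 1 by `c-root`.
  ... | zero with refl ← root v lve = (λ _ → nothing) , noMates A ,
    ≤-trans (count-mono {Q = v ==_} (λ u h → subst (λ z → (v == z) ≡ true)
        (sym (root u (n≤0⇒n≡0 (mx u (∧-l h))))) (==-refl v)))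
      (≤-trans (≤-reflexive (count-single v)) (≤-trans c-root
        (≤-trans (≤-reflexive (sym (sumF-point v (c v)))) (sumF-mono pt))))
    where
    pt : ∀ z → point v (c v) z ≤ (if A z then c z else 0)
    pt z with v 𝔽.≟ z
    ... | yes refl rewrite av = ≤-refl
    ... | no _ = z≤n
  ... | suc m with 𝔽.any? (λ x → 𝔽.any? (λ y → (A x ∧ A y ∧ Adj G x y) 𝔹.≟ true
                              ×-dec (lv x ≟ suc m) ×-dec (lv y ≟ suc m)))
  -- Both vertices lie on the deepest remaining level, so neither is a parent; matching them costs
  -- nothing.
  ... | yes (x , y , axy , lx , ly) = AE.mt' , AE.sup' A sub ax ay , ≤-trans (count-mono tr) (≤-trans (proj₂ (proj₂ IH)) (sumF-mono wt))
    where
    ax : A x ≡ true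
    ax = ∧-l axy
    ay : A y ≡ true
    ay = ∧-l (∧-r {A x} axy)
    D : V → Bool
    D z = (x == z) ∨ (y == z)
    open Minus A D
    dx : D x ≡ true
    dx = ∨-inl (==-refl x)
    dy : D y ≡ true
    dy = ∨-inr {x == y} (==-refl y)
    deep : ∀ {z} → D z ≡ true → lv z ≡ suc m
    deep {z} h with ∨-case {x == z} h
    ... | inj₁ e rewrite sym (==⇒≡ {u = x} e) = lx
    ... | inj₂ e rewrite sym (==⇒≡ {u = y} e) = ly
    cl' : Closed A'
    cl' w m' aw lw with cl w m' (sub w aw) lw
    ... | u , au , uw , lu = u , in' au (λ d → 1+n≰n (≤-trans (≤-reflexive (cong suc (trans (sym (deep d)) lu)))
      (≤-trans (≤-reflexive (sym lw)) (mx w (sub w aw))))) , uw , lu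
    IH : Result A'
    IH = run k A' (s≤s⁻¹ (≤-trans (count-insert A' A x sub (notin dx) ax) ck)) cl'
    module AE = AddEdge A' (proj₁ IH) (proj₁ (proj₂ IH)) x y (∧-r {A y} (∧-r {A x} axy)) (notin dx) (notin dy)
    tr : ∀ u → A u ∧ isUnsat (AE.mt' u) ≡ true → A' u ∧ isUnsat (proj₁ IH u) ≡ true
    tr u h with AE.unsat' (∧-r {A u} h)
    ... | ux , uy , s = ∧-in (in' (∧-l h) λ d → [ (λ e → ux (sym (==⇒≡ e))) , (λ e → uy (sym (==⇒≡ e))) ]′ (∨-case {x == u} d)) s
    wt : ∀ z → (if A' z then c z else 0) ≤ (if A z then c z else 0)
    wt z with A z | D z
    ... | true | true = z≤n
    ... | true | false = ≤-refl
    ... | false | _ = ≤-refl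
  -- Now the children of the parent u on this level are independent. They all go together with u, so
  -- none is orphaned, and matching u with v leaves one vertex fewer unmatched than there are
  -- children.
  ... | no nopair with cl v m av lve
  ... | u , au , uv , lu = AE.mt' , AE.sup' A sub au av , ≤-trans (count-mono tr)
      (≤-trans (count-∨ (λ z → A' z ∧ isUnsat (proj₁ IH z)) W-v) (≤-trans (+-mono-≤ (proj₂ (proj₂ IH)) cW) wt'))
    where
    W D W-v : V → Bool
    W z = A z ∧ Adj G u z ∧ does (lv z ≟ suc m)
    D z = (u == z) ∨ W z
    W-v z = W z ∧ not (v == z)
    open Minus A D
    W-in : ∀ {z} → A z ≡ true → Adj G u z ≡ true → lv z ≡ suc m → W z ≡ true
    W-in {z} a e l = ∧-in a (∧-in e (dec-true (lv z ≟ suc m) l))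
    W-lv : ∀ {z} → W z ≡ true → lv z ≡ suc m
    W-lv {z} h = does⇒ (lv z ≟ suc m) (∧-r {Adj G u z} (∧-r {A z} h))
    W-adj : ∀ {z} → W z ≡ true → Adj G u z ≡ true
    W-adj {z} h = ∧-l (∧-r {A z} h)
    du : D u ≡ true
    du = ∨-inl (==-refl u)
    wv : W v ≡ true
    wv = W-in av uv lve
    cl' : Closed A'
    cl' w m' aw lw with cl w m' (sub w aw) lw
    ... | t , at , tw , lt = t , in' at bad , tw , lt
      where
      bad : D t ≡ true → ⊥
      bad d with ∨-case {u == t} d
      ... | inj₁ e with refl ← ==⇒≡ {u = u} e = out aw (∨-inr {u == w} (W-in (sub w aw) tw
                 (trans lw (cong suc (trans (sym lt) lu)))))
      ... | inj₂ e = 1+n≰n (≤-trans (≤-reflexive (cong suc (trans (sym (W-lv e)) lt)))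
        (≤-trans (≤-reflexive (sym lw)) (mx w (sub w aw))))
    IH : Result A'
    IH = run k A' (s≤s⁻¹ (≤-trans (count-insert A' A u sub (notin du) au) ck)) cl'
    module AE = AddEdge A' (proj₁ IH) (proj₁ (proj₂ IH)) u v uv (notin du) (notin (∨-inr {u == v} wv))
    tr : ∀ z → A z ∧ isUnsat (AE.mt' z) ≡ true → (A' z ∧ isUnsat (proj₁ IH z)) ∨ W-v z ≡ true
    tr z h with AE.unsat' (∧-r {A z} h) | W z 𝔹.≟ true
    ... | zu , zv , s | yes wz = ∨-inr {A' z ∧ isUnsat (proj₁ IH z)} (∧-in wz (not-in λ e → zv (sym (==⇒≡ e))))
    ... | zu , zv , s | no wz = ∨-inl (∧-in (in' (∧-l h) λ d → [ (λ e → zu (sym (==⇒≡ e))) , wz ]′ (∨-case {u == z} d)) s)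
    cW : count W-v ≤ c u
    cW = s≤s⁻¹ (≤-trans (count-insert W-v W v (λ z h → ∧-l h)
        (¬true⇒false λ h → not-out (∧-r {W v} h) (==-refl v)) wv)
      (children u W (λ w h → W-adj h , trans (W-lv h) (cong suc (sym lu)))
        (λ w w' h h' → ¬true⇒false λ e → nopair (w , w' , ∧-in (∧-l {A w} h) (∧-in (∧-l {A w'} h') e) , W-lv h , W-lv h'))))
    wt' : weight A' + c u ≤ weight A
    wt' = ≤-trans (≤-reflexive (trans (cong (weight A' +_) (sym (sumF-point u (c u)))) (sym (sumF-+ (λ z → if A' z then c z else 0) (point u (c u))))))
      (sumF-mono le)
      where
      le : ∀ z → (if A' z then c z else 0) + point u (c u) z ≤ (if A z then c z else 0)
      le z with u 𝔽.≟ z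
      ... | yes refl rewrite au = ≤-refl
      ... | no _ with A z | W z
      ... | true | true = z≤n
      ... | true | false = ≤-reflexive (+-identityʳ _)
      ... | false | _ = z≤n

  full : Result (λ _ → true)
  full = run (order G) (λ _ → true) (count-≤n _) λ v m _ e → let (u , uv , lu) = parent v m e in u , refl , uv , lu

  process-bound : ∀ {d} → Def G d → d ≤ sumF c
  process-bound D = ≤-trans (def-≤ sim D record
      { mate = proj₁ full ; mateSym = λ u v e → proj₁ (proj₁ (proj₂ full) u v e)
      ; mateAdj = λ u v e → proj₁ (proj₂ (proj₁ (proj₂ full) u v e)) })
    (≤-trans (≤-reflexive (length-filter-all (λ u → isUnsat (proj₁ full u)))) (proj₂ (proj₂ full)))

-- Induced copies, induced paths and bones

edge-∈ : ∀ N es (i j : Fin N) → Adj (fromEdges N es) i j ≡ true → (toℕ i , toℕ j) ∈ es ⊎ (toℕ j , toℕ i) ∈ es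
edge-∈ N ((a , b) ∷ es) i j h with ∨-case {(does (toℕ i ≟ a) ∧ does (toℕ j ≟ b)) ∨ (does (toℕ i ≟ b) ∧ does (toℕ j ≟ a))} h
... | inj₂ h' = [ inj₁ ∘ there , inj₂ ∘ there ]′ (edge-∈ N es i j h')
... | inj₁ h' with ∨-case {does (toℕ i ≟ a) ∧ does (toℕ j ≟ b)} h'
... | inj₁ e = inj₁ (here (cong₂ _,_ (does⇒ (toℕ i ≟ a) (∧-l e)) (does⇒ (toℕ j ≟ b) (∧-r {does (toℕ i ≟ a)} e))))
... | inj₂ e = inj₂ (here (cong₂ _,_ (does⇒ (toℕ j ≟ a) (∧-r {does (toℕ i ≟ b)} e)) (does⇒ (toℕ i ≟ b) (∧-l e))))

∈-edge : ∀ N es (i j : Fin N) → (toℕ i , toℕ j) ∈ es ⊎ (toℕ j , toℕ i) ∈ es → Adj (fromEdges N es) i j ≡ true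
∈-edge N ((a , b) ∷ es) i j (inj₁ (there h)) = ∨-inr {(does (toℕ i ≟ a) ∧ does (toℕ j ≟ b)) ∨ (does (toℕ i ≟ b) ∧ does (toℕ j ≟ a))} (∈-edge N es i j (inj₁ h))
∈-edge N ((a , b) ∷ es) i j (inj₂ (there h)) = ∨-inr {(does (toℕ i ≟ a) ∧ does (toℕ j ≟ b)) ∨ (does (toℕ i ≟ b) ∧ does (toℕ j ≟ a))} (∈-edge N es i j (inj₂ h))
∈-edge N ((a , b) ∷ es) i j (inj₁ (here refl)) = ∨-inl (∨-inl (∧-in (dec-true (toℕ i ≟ toℕ i) refl) (dec-true (toℕ j ≟ toℕ j) refl)))
∈-edge N ((a , b) ∷ es) i j (inj₂ (here refl)) = ∨-inl (∨-inr {does (toℕ i ≟ toℕ j) ∧ does (toℕ j ≟ toℕ i)}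
  (∧-in (dec-true (toℕ i ≟ toℕ i) refl) (dec-true (toℕ j ≟ toℕ j) refl)))

module Base {G : Graph} (sim : IsSimple G) where
  open IsSimple sim public

  V : Set
  V = Fin (order G)

  E : V → V → Set
  E u v = Adj G u v ≡ true

  Far : V → V → Set
  Far u v = Adj G u v ≡ false × u ≢ v

  E? : ∀ u v → Dec (E u v)
  E? u v = Adj G u v 𝔹.≟ true

  E-sym : ∀ {u v} → E u v → E v u
  E-sym {u} {v} e = trans (symmetric v u) e

  E-≢ : ∀ {u v} → E u v → u ≢ v
  E-≢ {u} e refl = true≢false e (irreflexive u)

  ¬E⇒ : ∀ {u v} → ¬ E u v → Adj G u v ≡ false
  ¬E⇒ = ¬true⇒false

  Far-sym : ∀ {u v} → Far u v → Far v u
  Far-sym {u} {v} (a , n) = trans (symmetric v u) a , n ∘ sym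

  Far-E : ∀ {u v} → Far u v → ¬ E u v
  Far-E (a , _) e = true≢false e a

  copy : ∀ N es (f : Fin N → V) → (∀ {i j} → f i ≡ f j → i ≡ j) →
    (∀ i j → (toℕ i , toℕ j) ∈ es → E (f i) (f j)) →
    (∀ i j → E (f i) (f j) → (toℕ i , toℕ j) ∈ es ⊎ (toℕ j , toℕ i) ∈ es) →
    InducedCopy (fromEdges N es) G
  copy N es f inj to from = f , inj , λ i j → bool-ext
    (λ h → [ to i j , (λ m → E-sym (to j i m)) ]′ (edge-∈ N es i j h))
    (λ h → ∈-edge N es i j (from i j h))

  star-bound : ∀ {n} → LocalIndepBelow G n → ∀ {t} u (g : Fin t → V) → (∀ {i j} → g i ≡ g j → i ≡ j) →
    (∀ i → E u (g i)) → (∀ i j → Adj G (g i) (g j) ≡ false) → t < n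
  star-bound loc {t} u g inj ug gg = loc t (copy (suc t) _ f (λ {i} {j} → finj i j) to from)
    where
    f : Fin (suc t) → V
    f zero = u
    f (suc i) = g i
    finj : ∀ i j → f i ≡ f j → i ≡ j
    finj zero zero _ = refl
    finj zero (suc j) e = ⊥-elim (E-≢ (ug j) e)
    finj (suc i) zero e = ⊥-elim (E-≢ (ug i) (sym e))
    finj (suc i) (suc j) e = cong suc (inj e)
    to : ∀ i j → (toℕ i , toℕ j) ∈ map (λ r → (0 , suc r)) (upTo t) → E (f i) (f j)
    to i j m with ∈-map⁻ (λ r → (0 , suc r)) m
    to zero (suc j) m | _ = ug j
    to (suc i) j m | _ , _ , ()
    to zero zero m | _ , _ , ()
    from : ∀ i j → E (f i) (f j) → (toℕ i , toℕ j) ∈ map (λ r → (0 , suc r)) (upTo t) ⊎ (toℕ j , toℕ i) ∈ map (λ r → (0 , suc r)) (upTo t)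
    from zero zero e = ⊥-elim (E-≢ e refl)
    from zero (suc j) e = inj₁ (∈-map⁺ (λ r → (0 , suc r)) (∈-upTo⁺ (𝔽.toℕ<n j)))
    from (suc i) zero e = inj₂ (∈-map⁺ (λ r → (0 , suc r)) (∈-upTo⁺ (𝔽.toℕ<n i)))
    from (suc i) (suc j) e = ⊥-elim (true≢false e (gg i j))

  indep-count : ∀ {n} → LocalIndepBelow G n → ∀ u (P : V → Bool) → (∀ w → P w ≡ true → E u w) →
    (∀ w w' → P w ≡ true → P w' ≡ true → Adj G w w' ≡ false) → count P < n
  indep-count loc u P uP PP = star-bound loc u (enum P) (enum-inj P) (λ i → uP _ (enum-true P i))
    (λ i j → PP _ _ (enum-true P i) (enum-true P j))

  -- An induced path g 0 , … , g m; m is the index of the last vertex, not the number of vertices.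
  record Ind (g : ℕ → V) (m : ℕ) : Set where
    constructor mkInd
    field
      adj : ∀ j → j < m → E (g j) (g (suc j))
      far : ∀ i j → suc i < j → j ≤ m → Far (g i) (g j)
  open Ind public

  module _ {g : ℕ → V} {m : ℕ} (I : Ind g m) where
    ind-≢ : ∀ {i j} → i < j → j ≤ m → g i ≢ g j
    ind-≢ {i} {j} ij jm with suc i ≟ j
    ... | yes refl = E-≢ (adj I i jm)
    ... | no ne = proj₂ (far I i j (≤∧≢⇒< ij ne) jm)

    ind-inj : ∀ {i j} → i ≤ m → j ≤ m → g i ≡ g j → i ≡ j
    ind-inj {i} {j} im jm e with <-cmp i j
    ... | tri< a _ _ = ⊥-elim (ind-≢ a jm e)
    ... | tri≈ _ b _ = b
    ... | tri> _ _ c = ⊥-elim (ind-≢ c im (sym e))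

    ind-adj : ∀ {i j} → i ≤ m → j ≤ m → E (g i) (g j) → suc i ≡ j ⊎ suc j ≡ i
    ind-adj {i} {j} im jm e with <-cmp i j
    ... | tri≈ _ refl _ = ⊥-elim (E-≢ e refl)
    ... | tri< a _ _ with suc i ≟ j
    ... | yes r = inj₁ r
    ... | no ne = ⊥-elim (Far-E (far I i j (≤∧≢⇒< a ne) jm) e)
    ind-adj {i} {j} im jm e | tri> _ _ c with suc j ≟ i
    ... | yes r = inj₂ r
    ... | no ne = ⊥-elim (Far-E (far I j i (≤∧≢⇒< c ne) im) (E-sym e))

    ind-prefix : ∀ {k} → k ≤ m → Ind g k
    ind-prefix km = mkInd (λ j jk → adj I j (≤-trans jk km)) (λ i j ij jk → far I i j ij (≤-trans jk km))

    ind-shift : ∀ l k → l + k ≤ m → Ind (λ j → g (l + j)) k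
    ind-shift l k h = mkInd
      (λ j jk → subst (λ x → E (g (l + j)) (g x)) (sym (+-suc l j)) (adj I (l + j) (≤-trans (+-monoʳ-< l jk) h)))
      (λ i j ij jk → far I (l + i) (l + j) (≤-trans (≤-reflexive (cong suc (sym (+-suc l i)))) (+-monoʳ-< l ij)) (≤-trans (+-monoʳ-≤ l jk) h))

    ind-rev : Ind (λ j → g (m ∸ j)) m
    ind-rev = mkInd
      (λ j jm → E-sym (subst (λ x → E (g (m ∸ suc j)) (g x)) (sym (+-∸-assoc 1 jm)) (adj I (m ∸ suc j) (≤-trans (≤-reflexive (sym (+-∸-assoc 1 jm))) (m∸n≤m m j)))))
      (λ i j ij jm → Far-sym (far I (m ∸ j) (m ∸ i)
        (≤-trans (s≤s (∸-monoʳ-< ij jm)) (≤-reflexive (sym (+-∸-assoc 1 (≤-trans (<⇒≤ ij) jm)))))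
        (m∸n≤m m i)))

  glue : (ℕ → V) → ℕ → (ℕ → V) → ℕ → V
  glue g f h j with j ≤? f
  ... | yes _ = g j
  ... | no _ = h (j ∸ suc f)

  glue-l : ∀ {g f h j} → j ≤ f → glue g f h j ≡ g j
  glue-l {g} {f} {h} {j} le with j ≤? f
  ... | yes _ = refl
  ... | no n = ⊥-elim (n le)

  glue-r : ∀ {g f h} j → glue g f h (suc (f + j)) ≡ h j
  glue-r {g} {f} {h} j with suc (f + j) ≤? f
  ... | yes le = ⊥-elim (<-irrefl refl (≤-trans (s≤s (m≤m+n f j)) le))
  ... | no n = cong h (m+n∸m≡n f j)

  data Split (f : ℕ) : ℕ → Set where
    left : ∀ {j} → j ≤ f → Split f j
    right : ∀ j → Split f (suc (f + j))

  split : ∀ f j → Split f j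
  split f j with j ≤? f
  ... | yes le = left le
  ... | no n = subst (Split f) (m+[n∸m]≡n (≰⇒> n)) (right (j ∸ suc f))

  -- The clause `i < f ⊎ 0 < j` exempts exactly the pair g f, h 0 that the new edge links.
  ind-glue : ∀ {g f h e} → Ind g f → Ind h e → E (g f) (h 0) →
    (∀ i j → i ≤ f → j ≤ e → i < f ⊎ 0 < j → Far (g i) (h j)) → Ind (glue g f h) (suc (f + e))
  ind-glue {g} {f} {h} {e} Ig Ih lk cr = mkInd A F
    where
    A : ∀ j → j < suc (f + e) → E (glue g f h j) (glue g f h (suc j))
    A j lt with split f j
    ... | right j' rewrite glue-r {g} {f} {h} j' | sym (+-suc f j') | glue-r {g} {f} {h} (suc j') =
      adj Ih j' (+-cancelˡ-≤ f _ _ (s≤s⁻¹ lt))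
    ... | left le with m≤n⇒m<n∨m≡n le
    ... | inj₁ lt' rewrite glue-l {g} {f} {h} le | glue-l {g} {f} {h} lt' = adj Ig j lt'
    ... | inj₂ refl = subst₂ E (sym (glue-l {g} {f} {h} ≤-refl))
          (sym (trans (cong (λ x → glue g f h (suc x)) (sym (+-identityʳ f))) (glue-r {g} {f} {h} 0))) lk
    F : ∀ i j → suc i < j → j ≤ suc (f + e) → Far (glue g f h i) (glue g f h j)
    F i j ij je with split f i | split f j
    ... | left a | left b rewrite glue-l {g} {f} {h} a | glue-l {g} {f} {h} b = far Ig i j ij b
    ... | right i' | left b = ⊥-elim (<-irrefl refl (≤-trans (s≤s (m≤m+n f i')) (≤-trans (≤-trans (n≤1+n _) (≤-trans (n≤1+n _) ij)) b)))
    ... | right i' | right j' rewrite glue-r {g} {f} {h} i' | glue-r {g} {f} {h} j' =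
      far Ih i' j' (+-cancelˡ-< f _ _ (≤-trans (≤-reflexive (cong suc (+-suc f i'))) (s≤s⁻¹ ij))) (+-cancelˡ-≤ f _ _ (s≤s⁻¹ je))
    ... | left a | right j' rewrite glue-l {g} {f} {h} a | glue-r {g} {f} {h} j' =
      cr i j' a (+-cancelˡ-≤ f _ _ (s≤s⁻¹ je)) (lem j' ij)
      where
      lem : ∀ j' → suc i < suc (f + j') → i < f ⊎ 0 < j'
      lem zero h = inj₁ (≤-trans (s≤s⁻¹ h) (≤-reflexive (+-identityʳ f)))
      lem (suc j') h = inj₂ (s≤s z≤n)

  record Leafy (u : V) : Set where
    constructor mkLeafy
    field
      {l₁ l₂} : V
      l₁≢l₂ : l₁ ≢ l₂
      e₁ : E u l₁
      e₂ : E u l₂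
      only₁ : ∀ v → E v l₁ → v ≡ u
      only₂ : ∀ v → E v l₂ → v ≡ u

  Leafy? : ∀ u → Dec (Leafy u)
  Leafy? u with 𝔽.any? (λ a → 𝔽.any? (λ b → ¬? (a 𝔽.≟ b) ×-dec E? u a ×-dec E? u b ×-dec
      𝔽.all? (λ v → ¬? (E? v a) ⊎-dec (v 𝔽.≟ u)) ×-dec 𝔽.all? (λ v → ¬? (E? v b) ⊎-dec (v 𝔽.≟ u))))
  ... | yes (a , b , ne , ua , ub , oa , ob) = yes (mkLeafy ne ua ub
        (λ v e → [ (λ h → ⊥-elim (h e)) , id ]′ (oa v)) (λ v e → [ (λ h → ⊥-elim (h e)) , id ]′ (ob v)))
  ... | no h = no λ { (mkLeafy {a} {b} ne ua ub oa ob) → h (a , b , ne , ua , ub , (λ v → lem (E? v a) (oa v)) , (λ v → lem (E? v b) (ob v))) }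
    where
    lem : ∀ {A B : Set} → Dec A → (A → B) → ¬ A ⊎ B
    lem (yes a) f = inj₂ (f a)
    lem (no n) f = inj₁ n

  module Bone {g : ℕ → V} {m : ℕ} (I : Ind g (suc m)) (pend : ℕ → V) where
    anc : ℕ → ℕ
    anc 0 = 0
    anc 1 = 0
    anc _ = suc m

    es = pathEdges (suc (suc m)) ++ ((0 , suc (suc m)) ∷ (0 , suc (suc m) + 1) ∷ (suc m , suc (suc m) + 2) ∷ (suc m , suc (suc m) + 3) ∷ [])

    anc≤ : ∀ x → anc x ≤ suc m
    anc≤ 0 = z≤n
    anc≤ 1 = z≤n
    anc≤ (suc (suc x)) = ≤-refl

    module _ (pe : ∀ x → x < 4 → E (g (anc x)) (pend x))
             (pf : ∀ x j → x < 4 → j ≤ suc m → j ≢ anc x → Far (g j) (pend x))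
             (pp : ∀ x y → x < 4 → y < 4 → x ≢ y → Far (pend x) (pend y)) where

      F : ℕ → V
      F = glue g (suc m) pend

      f : Fin (suc (suc m) + 4) → V
      f i = F (toℕ i)

      path-∈ : ∀ j → j < suc m → (j , suc j) ∈ es
      path-∈ j lt = ∈-++⁺ˡ (∈-map⁺ (λ j → (j , suc j)) (∈-upTo⁺ lt))

      pend-∈ : ∀ x → x < 4 → (anc x , suc (suc m) + x) ∈ es
      pend-∈ 0 _ = ∈-++⁺ʳ (pathEdges (suc (suc m))) (here (cong (0 ,_) (+-identityʳ _)))
      pend-∈ 1 _ = ∈-++⁺ʳ (pathEdges (suc (suc m))) (there (here refl))
      pend-∈ 2 _ = ∈-++⁺ʳ (pathEdges (suc (suc m))) (there (there (here refl)))
      pend-∈ 3 _ = ∈-++⁺ʳ (pathEdges (suc (suc m))) (there (there (there (here refl))))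
      pend-∈ (suc (suc (suc (suc x)))) (s≤s (s≤s (s≤s (s≤s ()))))

      <4 : ∀ {x} → suc (suc m + x) < suc (suc m) + 4 → x < 4
      <4 h = +-cancelˡ-< (suc m) _ _ (s≤s⁻¹ h)

      E-pend : ∀ i x → i ≤ suc m → x < 4 → E (g i) (pend x) → i ≡ anc x
      E-pend i x im x4 e with i ≟ anc x
      ... | yes r = r
      ... | no ne = ⊥-elim (Far-E (pf x i x4 im ne) e)

      g≢pend : ∀ i x → i ≤ suc m → x < 4 → g i ≢ pend x
      g≢pend i x im x4 with i ≟ anc x
      ... | yes refl = E-≢ (pe x x4)
      ... | no ne = proj₂ (pf x i x4 im ne)

      Finj : ∀ i j → i < suc (suc m) + 4 → j < suc (suc m) + 4 → F i ≡ F j → i ≡ j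
      Finj i j iN jN e with split (suc m) i | split (suc m) j
      ... | left a | left b = ind-inj I a b (trans (sym (glue-l {g} {suc m} {pend} a)) (trans e (glue-l {g} {suc m} {pend} b)))
      ... | left a | right y = ⊥-elim (g≢pend i y a (<4 jN) (trans (sym (glue-l {g} {suc m} {pend} a)) (trans e (glue-r {g} {suc m} {pend} y))))
      ... | right x | left b = ⊥-elim (g≢pend j x b (<4 iN) (trans (sym (glue-l {g} {suc m} {pend} b)) (trans (sym e) (glue-r {g} {suc m} {pend} x))))
      ... | right x | right y with x ≟ y
      ... | yes refl = refl
      ... | no ne = ⊥-elim (proj₂ (pp x y (<4 iN) (<4 jN) ne) (trans (sym (glue-r {g} {suc m} {pend} x)) (trans e (glue-r {g} {suc m} {pend} y))))

      from : ∀ i j → i < suc (suc m) + 4 → j < suc (suc m) + 4 → E (F i) (F j) → (i , j) ∈ es ⊎ (j , i) ∈ es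
      from i j iN jN e with split (suc m) i | split (suc m) j
      ... | left a | left b with ind-adj I a b (subst₂ E (glue-l {g} {suc m} {pend} a) (glue-l {g} {suc m} {pend} b) e)
      ... | inj₁ refl = inj₁ (path-∈ i b)
      ... | inj₂ refl = inj₂ (path-∈ j a)
      from i j iN jN e | left a | right y with refl ← E-pend i y a (<4 jN) (subst₂ E (glue-l {g} {suc m} {pend} a) (glue-r {g} {suc m} {pend} y) e) = inj₁ (pend-∈ y (<4 jN))
      from i j iN jN e | right x | left b with refl ← E-pend j x b (<4 iN) (E-sym (subst₂ E (glue-r {g} {suc m} {pend} x) (glue-l {g} {suc m} {pend} b) e)) = inj₂ (pend-∈ x (<4 iN))
      from i j iN jN e | right x | right y with x ≟ y
      ... | yes refl = ⊥-elim (E-≢ e refl)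
      ... | no ne = ⊥-elim (Far-E (pp x y (<4 iN) (<4 jN) ne) (subst₂ E (glue-r {g} {suc m} {pend} x) (glue-r {g} {suc m} {pend} y) e))

      pE : ∀ x → x < 4 → E (F (anc x)) (F (suc (suc m) + x))
      pE x x4 = subst₂ E (sym (glue-l {g} {suc m} {pend} (anc≤ x))) (sym (glue-r {g} {suc m} {pend} x)) (pe x x4)

      to : ∀ i j → (i , j) ∈ es → E (F i) (F j)
      to i j mem with ∈-++⁻ (pathEdges (suc (suc m))) mem
      ... | inj₂ (here refl) = subst (λ z → E (F 0) (F z)) (+-identityʳ (suc (suc m))) (pE 0 (s≤s z≤n))
      ... | inj₂ (there (here refl)) = pE 1 (s≤s (s≤s z≤n))
      ... | inj₂ (there (there (here refl))) = pE 2 (s≤s (s≤s (s≤s z≤n)))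
      ... | inj₂ (there (there (there (here refl)))) = pE 3 (s≤s (s≤s (s≤s (s≤s z≤n))))
      ... | inj₁ mp with ∈-map⁻ (λ j → (j , suc j)) mp
      ... | j' , mem' , refl = subst₂ E (sym (glue-l {g} {suc m} {pend} (<⇒≤ (∈-upTo⁻ mem')))) (sym (glue-l {g} {suc m} {pend} (∈-upTo⁻ mem'))) (adj I j' (∈-upTo⁻ mem'))

      boneCopy : InducedCopy (bone (suc (suc m))) G
      boneCopy = copy _ es f (λ {i} {j} e → 𝔽.toℕ-injective (Finj _ _ (𝔽.toℕ<n i) (𝔽.toℕ<n j) e))
        (λ i j → to (toℕ i) (toℕ j)) (λ i j → from _ _ (𝔽.toℕ<n i) (𝔽.toℕ<n j))

  -- The leaves at the start are far from everything else by themselves, so conditions are imposed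
  -- only on the claw at the other end.
  bone₁ : ∀ {g m} → Ind g (suc m) → Leafy (g 0) → ∀ {b₁ b₂} → E (g (suc m)) b₁ → E (g (suc m)) b₂ → Far b₁ b₂ →
    (∀ j → j ≤ m → Far (g j) b₁) → (∀ j → j ≤ m → Far (g j) b₂) → InducedCopy (bone (suc (suc m))) G
  bone₁ {g} {m} I L {b₁} {b₂} eb₁ eb₂ bb f₁ f₂ = Bone.boneCopy I pend pe pf pp
    where
    module L = Leafy L
    pend : ℕ → V
    pend 0 = L.l₁
    pend 1 = L.l₂
    pend 2 = b₁
    pend _ = b₂
    pe : ∀ x → x < 4 → E (g (Bone.anc I pend x)) (pend x)
    pe 0 _ = L.e₁
    pe 1 _ = L.e₂
    pe 2 _ = eb₁
    pe (suc (suc (suc x))) _ = eb₂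
    leaf-far : ∀ {l} → E (g 0) l → (∀ v → E v l → v ≡ g 0) → ∀ j → j ≤ suc m → j ≢ 0 → Far (g j) l
    leaf-far e o zero jm j0 = ⊥-elim (j0 refl)
    leaf-far {l} e o (suc j) jm j0 = ¬E⇒ (λ h → ind-≢ I {0} {suc j} (s≤s z≤n) jm (sym (o _ h))) , ne j jm
      where
      ne : ∀ j → suc j ≤ suc m → g (suc j) ≢ l
      ne (suc j) jm refl = ind-≢ I {0} {suc j} (s≤s z≤n) (≤-trans (n≤1+n _) jm) (sym (o _ (adj I (suc j) jm)))
      -- If g 1 were a leaf of g 0, its next neighbour, b₁ when the path ends there and g 2
      -- otherwise, would have to be g 0.
      ne zero jm refl with 1 ≟ suc m
      ... | yes refl = proj₂ (f₁ 0 z≤n) (sym (o _ (E-sym eb₁)))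
      ... | no n1 = ind-≢ I {0} {2} (s≤s z≤n) (≤∧≢⇒< jm n1) (sym (o _ (E-sym (adj I 1 (≤∧≢⇒< jm n1)))))
    pf : ∀ x j → x < 4 → j ≤ suc m → j ≢ Bone.anc I pend x → Far (g j) (pend x)
    pf 0 j _ jm ne = leaf-far L.e₁ L.only₁ j jm ne
    pf 1 j _ jm ne = leaf-far L.e₂ L.only₂ j jm ne
    pf 2 j _ jm ne = f₁ j (s≤s⁻¹ (≤∧≢⇒< jm ne))
    pf (suc (suc (suc x))) j _ jm ne = f₂ j (s≤s⁻¹ (≤∧≢⇒< jm ne))
    ll : Far L.l₁ L.l₂
    ll = ¬E⇒ (λ h → E-≢ L.e₁ (sym (L.only₂ _ h))) , L.l₁≢l₂
    lb : ∀ {l b} → E (g 0) l → (∀ v → E v l → v ≡ g 0) → E (g (suc m)) b → Far (g 0) b → Far l b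
    lb e o eb fb = ¬E⇒ (λ h → proj₂ fb (sym (o _ (E-sym h)))) , λ { refl → ind-≢ I (s≤s z≤n) ≤-refl (sym (o _ eb)) }
    pp : ∀ x y → x < 4 → y < 4 → x ≢ y → Far (pend x) (pend y)
    pp 0 0 _ _ ne = ⊥-elim (ne refl)
    pp 0 1 _ _ _ = ll
    pp 0 2 _ _ _ = lb L.e₁ L.only₁ eb₁ (f₁ 0 z≤n)
    pp 0 (suc (suc (suc _))) _ _ _ = lb L.e₁ L.only₁ eb₂ (f₂ 0 z≤n)
    pp 1 0 _ _ _ = Far-sym ll
    pp 1 1 _ _ ne = ⊥-elim (ne refl)
    pp 1 2 _ _ _ = lb L.e₂ L.only₂ eb₁ (f₁ 0 z≤n)
    pp 1 (suc (suc (suc _))) _ _ _ = lb L.e₂ L.only₂ eb₂ (f₂ 0 z≤n)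
    pp 2 0 a b ne = Far-sym (lb L.e₁ L.only₁ eb₁ (f₁ 0 z≤n))
    pp 2 1 a b ne = Far-sym (lb L.e₂ L.only₂ eb₁ (f₁ 0 z≤n))
    pp 2 2 _ _ ne = ⊥-elim (ne refl)
    pp 2 (suc (suc (suc _))) _ _ _ = bb
    pp (suc (suc (suc x))) 0 a b ne = Far-sym (lb L.e₁ L.only₁ eb₂ (f₂ 0 z≤n))
    pp (suc (suc (suc x))) 1 a b ne = Far-sym (lb L.e₂ L.only₂ eb₂ (f₂ 0 z≤n))
    pp (suc (suc (suc x))) 2 a b ne = Far-sym bb
    pp 3 3 _ _ ne = ⊥-elim (ne refl)
    pp (suc (suc (suc (suc _)))) _ (s≤s (s≤s (s≤s (s≤s ())))) _ _
    pp 3 (suc (suc (suc (suc _)))) _ (s≤s (s≤s (s≤s (s≤s ())))) _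

  bone₂ : ∀ {g m} → Ind g (suc m) → Leafy (g 0) → Leafy (g (suc m)) → InducedCopy (bone (suc (suc m))) G
  bone₂ {g} {m} I L R = bone₁ I L R.e₁ R.e₂ (¬E⇒ (λ h → E-≢ R.e₁ (sym (R.only₂ _ h))) , R.l₁≢l₂)
    (λ j jm → far' R.e₁ R.only₁ j jm) (λ j jm → far' R.e₂ R.only₂ j jm)
    where
    module L = Leafy L
    module R = Leafy R
    far' : ∀ {l} → E (g (suc m)) l → (∀ v → E v l → v ≡ g (suc m)) → ∀ j → j ≤ m → Far (g j) l
    far' {l} e o j jm = ¬E⇒ (λ h → ind-≢ I (s≤s jm) ≤-refl (o _ h)) , ne j jm
      where
      ne : ∀ j → j ≤ m → g j ≢ l
      ne (suc j) jm refl = ind-≢ I {j} {suc m} (s≤s (≤-trans (n≤1+n _) jm)) ≤-refl (o _ (adj I j (≤-trans jm (n≤1+n _))))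
      -- g 0 is not a leaf itself, because it has two distinct neighbours of its own.
      ne zero jm refl = L.l₁≢l₂ (trans (o _ (E-sym L.e₁)) (sym (o _ (E-sym L.e₂))))

-- Reachability inside a set, and more on counting

data RIn {G : Graph} (P : Fin (order G) → Set) : Fin (order G) → Fin (order G) → Set where
  rhere : ∀ {u} → P u → RIn P u u
  rstep : ∀ {u v w} → P u → Adj G u v ≡ true → RIn {G} P v w → RIn P u w

RIn-map : ∀ {G} {P Q : Fin (order G) → Set} → (∀ {u} → P u → Q u) → ∀ {u v} → RIn {G} P u v → RIn {G} Q u v
RIn-map {G} f (rhere p) = rhere (f p)
RIn-map {G} f (rstep p e r) = rstep (f p) e (RIn-map {G} f r)

reach-trans : ∀ {G u v w} → Reachable G u v → Reachable G v w → Reachable G u w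
reach-trans here s = s
reach-trans (step e r) s = step e (reach-trans r s)

reach-sym : ∀ {G} → IsSimple G → ∀ {u v} → Reachable G u v → Reachable G v u
reach-sym sim here = here
reach-sym sim (step e r) = reach-trans (reach-sym sim r) (step (trans (IsSimple.symmetric sim _ _) e) here)

hub-connected : ∀ {G} → IsSimple G → ∀ s → (∀ v → Reachable G v s) → Connected G
hub-connected {G} sim s h = ≤-trans (s≤s z≤n) (𝔽.toℕ<n s) , λ u v → reach-trans (h u) (reach-sym sim (h v))

enum-connected : ∀ {G} → IsSimple G → (A : Fin (order G) → Bool) → ∀ s → A s ≡ true →
  (∀ v → A v ≡ true → RIn {G} (λ u → A u ≡ true) v s) → Connected (induce G (enum A))
enum-connected {G} sim A s as h = hub-connected (induce-simple sim (enum A)) (proj₁ S') λ i →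
    go (h (enum A i) (enum-true A i)) i (proj₁ S') refl (proj₂ S')
  where
  S' = enum-sur A s as
  P-of : ∀ {u w} → RIn {G} (λ u → A u ≡ true) u w → A u ≡ true
  P-of (rhere p) = p
  P-of (rstep p _ _) = p
  go : ∀ {u w} → RIn {G} (λ u → A u ≡ true) u w → ∀ i j → enum A i ≡ u → enum A j ≡ w → Reachable (induce G (enum A)) i j
  go (rhere p) i j ei ej with refl ← enum-inj A (trans ei (sym ej)) = here
  go (rstep p e r) i j refl ej with enum-sur A _ (P-of r)
  ... | k , ek = step (trans (cong (Adj G (enum A i)) ek) e) (go r k j ek ej)

count≤1 : ∀ {n} (W : Fin n → Bool) → (∀ w w' → W w ≡ true → W w' ≡ true → w ≡ w') → count W ≤ 1
count≤1 W h = count-upper W (λ _ → 0) (λ _ _ → s≤s z≤n) (λ p q _ → h _ _ p q)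

sumF-swap : ∀ {m n} (f : Fin m → Fin n → ℕ) → sumF (λ v → sumF (λ i → f i v)) ≡ sumF (λ i → sumF (f i))
sumF-swap {zero} {n} f = sumF-zero n
sumF-swap {suc m} f = trans (sumF-+ (f zero) (λ v → sumF (λ i → f (suc i) v))) (cong (sumF (f zero) +_) (sumF-swap (f ∘ suc)))

sumF-≥ : ∀ {m} (f : Fin m → ℕ) i → f i ≤ sumF f
sumF-≥ f zero = m≤m+n _ _
sumF-≥ f (suc i) = ≤-trans (sumF-≥ (f ∘ suc) i) (m≤n+m _ (f zero))

dec-elim : ∀ {a b} {A : Set a} {B : Set b} → Dec A → (A → B) → (¬ A → B) → B
dec-elim (yes a) f g = f a
dec-elim (no n) f g = g n

-- The embeddings of T and S take pendants as functions on all of ℕ; `d` is the value past the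
-- vertices that `P` provides.
pickℕ : ∀ {n} (P : Fin n → Bool) k → k ≤ count P → Fin n → ∃ λ (e : ℕ → Fin n) →
  (∀ i → i < k → P (e i) ≡ true) × (∀ i j → i < k → j < k → e i ≡ e j → i ≡ j)
pickℕ {n} P k kc d = e , (λ i lt → subst (λ x → P x ≡ true) (sym (e-spec i lt)) (enum-true P _)) ,
    λ i j il jl eq → trans (sym (𝔽.toℕ-fromℕ< (≤-trans il kc))) (trans (cong toℕ (enum-inj P
      (trans (sym (e-spec i il)) (trans eq (e-spec j jl))))) (𝔽.toℕ-fromℕ< (≤-trans jl kc)))
  where
  e : ℕ → Fin n
  e i = dec-elim (i <? count P) (λ lt → enum P (fromℕ< lt)) (λ _ → d)
  e-spec : ∀ i (lt : i < k) → e i ≡ enum P (fromℕ< (≤-trans lt kc))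
  e-spec i lt with i <? count P
  ... | yes lt' = cong (enum P) (𝔽.fromℕ<-cong i i refl lt' (≤-trans lt kc))
  ... | no n' = ⊥-elim (n' (≤-trans lt kc))

pred-large : ∀ {a b} → suc a ≤ b ∸ 1 → suc (suc a) ≤ b
pred-large {b = suc b} h = s≤s h

≤-suc-pred : ∀ a → a ≤ suc (a ∸ 1)
≤-suc-pred zero = z≤n
≤-suc-pred (suc a) = ≤-refl

points₃ : ∀ {n} (x y z : Fin n) (a b c : ℕ) → Fin n → ℕ
points₃ x y z a b c v = point x a v + point y b v + point z c v

module _ {n} (x y z : Fin n) (a b c : ℕ) where
  sumF-points₃ : sumF (points₃ x y z a b c) ≡ a + b + c
  sumF-points₃ = trans (sumF-+ (λ v → point x a v + point y b v) (point z c))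
    (cong₂ _+_ (trans (sumF-+ (point x a) (point y b)) (cong₂ _+_ (sumF-point x a) (sumF-point y b))) (sumF-point z c))

  points₃-1 : a ≤ points₃ x y z a b c x
  points₃-1 = ≤-trans (≤-reflexive (sym (point-self x a))) (≤-trans (m≤m+n _ (point y b x)) (m≤m+n _ (point z c x)))

  points₃-2 : b ≤ points₃ x y z a b c y
  points₃-2 = ≤-trans (≤-reflexive (sym (point-self y b))) (≤-trans (m≤n+m _ (point x a y)) (m≤m+n _ (point z c y)))

  points₃-3 : c ≤ points₃ x y z a b c z
  points₃-3 = ≤-trans (≤-reflexive (sym (point-self z c))) (m≤n+m _ (point x a z + point y b z))

-- Linear arithmetic and the lengths of bones

infixl 6 _⊞_

-- Linear expressions over ℕ, reflected so that a certificate is checked by evaluating a Boolean.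
-- Coefficients are written as repeated sums.
data Ex : Set where
  K : ℕ → Ex
  X : ℕ → Ex
  _⊞_ : Ex → Ex → Ex

module Coefficients where
  dot : List ℕ → List ℕ → ℕ
  dot [] ρ = 0
  dot (c ∷ cs) [] = 0
  dot (c ∷ cs) (x ∷ ρ) = c * x + dot cs ρ

  at : List ℕ → ℕ → ℕ
  at [] i = 0
  at (x ∷ ρ) zero = x
  at (x ∷ ρ) (suc i) = at ρ i

  add : List ℕ → List ℕ → List ℕ
  add [] bs = bs
  add (a ∷ as) [] = a ∷ as
  add (a ∷ as) (b ∷ bs) = (a + b) ∷ add as bs

  unit : ℕ → List ℕ
  unit zero = 1 ∷ []
  unit (suc i) = 0 ∷ unit i

  dot-add : ∀ as bs ρ → dot (add as bs) ρ ≡ dot as ρ + dot bs ρ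
  dot-add [] bs ρ = refl
  dot-add (a ∷ as) [] ρ = sym (+-identityʳ _)
  dot-add (a ∷ as) (b ∷ bs) [] = refl
  dot-add (a ∷ as) (b ∷ bs) (x ∷ ρ) = begin
    (a + b) * x + dot (add as bs) ρ             ≡⟨ cong₂ _+_ (*-distribʳ-+ x a b) (dot-add as bs ρ) ⟩
    (a * x + b * x) + (dot as ρ + dot bs ρ)     ≡⟨ +-assoc (a * x) (b * x) _ ⟩
    a * x + (b * x + (dot as ρ + dot bs ρ))     ≡⟨ cong (a * x +_) (trans (sym (+-assoc (b * x) (dot as ρ) _))
                                                     (trans (cong (_+ dot bs ρ) (+-comm (b * x) (dot as ρ))) (+-assoc (dot as ρ) (b * x) _))) ⟩
    a * x + (dot as ρ + (b * x + dot bs ρ))     ≡⟨ sym (+-assoc (a * x) (dot as ρ) _) ⟩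
    (a * x + dot as ρ) + (b * x + dot bs ρ)     ∎
    where open ≡-Reasoning

  dot-unit : ∀ i ρ → dot (unit i) ρ ≡ at ρ i
  dot-unit zero [] = refl
  dot-unit zero (x ∷ ρ) = trans (+-identityʳ _) (+-identityʳ x)
  dot-unit (suc i) [] = refl
  dot-unit (suc i) (x ∷ ρ) = dot-unit i ρ

⟦_⟧ : Ex → List ℕ → ℕ
⟦ K n ⟧ ρ = n
⟦ X i ⟧ ρ = Coefficients.at ρ i
⟦ a ⊞ b ⟧ ρ = ⟦ a ⟧ ρ + ⟦ b ⟧ ρ

module Normal where
  open Coefficients
  coeffs : Ex → List ℕ
  coeffs (K n) = n ∷ []
  coeffs (X i) = 0 ∷ unit i
  coeffs (a ⊞ b) = add (coeffs a) (coeffs b)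

  coeffs-sound : ∀ e ρ → ⟦ e ⟧ ρ ≡ dot (coeffs e) (1 ∷ ρ)
  coeffs-sound (K n) ρ = sym (trans (+-identityʳ _) (*-identityʳ n))
  coeffs-sound (X i) ρ = sym (dot-unit i ρ)
  coeffs-sound (a ⊞ b) ρ = trans (cong₂ _+_ (coeffs-sound a ρ) (coeffs-sound b ρ)) (sym (dot-add (coeffs a) (coeffs b) (1 ∷ ρ)))

  covers : List ℕ → List ℕ → Bool
  covers as [] = true
  covers [] (zero ∷ bs) = covers [] bs
  covers [] (suc b ∷ bs) = false
  covers (a ∷ as) (b ∷ bs) = (b ≤ᵇ a) ∧ covers as bs

  -- The variables are natural numbers, so comparing coefficient by coefficient suffices; the
  -- constant term counts as the coefficient of a variable fixed at 1.
  covers-sound : ∀ as bs ρ → covers as bs ≡ true → dot bs ρ ≤ dot as ρ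
  covers-sound as [] ρ e = z≤n
  covers-sound as (b ∷ bs) [] e = z≤n
  covers-sound [] (zero ∷ bs) (x ∷ ρ) e = covers-sound [] bs ρ e
  covers-sound (a ∷ as) (b ∷ bs) (x ∷ ρ) e = +-mono-≤ (*-monoˡ-≤ x (does⇒ (b ≤? a) (∧-l e))) (covers-sound as bs ρ (∧-r {b ≤ᵇ a} e))

open Normal using (coeffs; coeffs-sound; covers; covers-sound)

-- The two sides are the sums of the hypotheses of a Farkas certificate, and the check compares coefficients.
refute : ∀ ρ a b → ⟦ a ⟧ ρ ≤ ⟦ b ⟧ ρ → covers (coeffs a) (coeffs (K 1 ⊞ b)) ≡ true → ⊥
refute ρ a b le e = 1+n≰n (≤-trans (≤-reflexive (coeffs-sound (K 1 ⊞ b) ρ))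
  (≤-trans (covers-sound (coeffs a) (coeffs (K 1 ⊞ b)) (1 ∷ ρ) e) (≤-trans (≤-reflexive (sym (coeffs-sound a ρ))) le)))

infixl 6 _⊕_
_⊕_ : ∀ {a b c d} → a ≤ b → c ≤ d → a + c ≤ b + d
_⊕_ = +-mono-≤

le : ∀ {a b} → a ≡ b → a ≤ b
le = ≤-reflexive

ge : ∀ {a b} → a ≡ b → b ≤ a
ge e = ≤-reflexive (sym e)

-- In what follows a path is given by the index N of its last vertex, and f, l = N - k are the first and the
-- last position adjacent to the first vertex of a path with last index e.
module Arith (p q : ℕ) (p≥3 : 3 ≤ p) where
  Q : ℕ → Set
  Q i = (i ≡ p) ⊎ (i ≡ q)

  module Odds (h : ℕ) (p-odd : p ≡ suc (2 * h)) (h' : ℕ) (q-odd : q ≡ suc (2 * h')) where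
    Q-odd : ∀ {i} → Q i → ∃ λ y → i ≡ suc (2 * y)
    Q-odd (inj₁ refl) = h , p-odd
    Q-odd (inj₂ refl) = h' , q-odd

    -- The bones through the consecutive neighbours f and f + 1 have f + e + 2 and k + e + 2 path
    -- vertices, together N + 2e + 3. This is odd because N + 1 is odd, but two odd numbers have an
    -- even sum.
    adjacent-odd : ∀ {f k e N} → Q (suc N) → suc f + k ≡ N → Q (suc (suc (f + e))) → Q (suc (suc (k + e))) → ⊥
    adjacent-odd {f} {k} {e} qN refl qf qk with Q-odd qN | Q-odd qf | Q-odd qk
    ... | w , ew | y , ey | y' , ey' = even≢odd (y + y' + 1) (w + e + 1) (begin
      2 * (y + y' + 1)             ≡⟨ s₁ y y' ⟩
      suc (2 * y) + suc (2 * y')   ≡⟨ cong₂ _+_ (sym ey) (sym ey') ⟩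
      suc (suc (f + e)) + suc (suc (k + e)) ≡⟨ s₂ f k e ⟩
      suc (suc f + k) + (2 * e + 2) ≡⟨ cong (_+ (2 * e + 2)) ew ⟩
      suc (2 * w) + (2 * e + 2)    ≡⟨ s₃ w e ⟩
      suc (2 * (w + e + 1)) ∎)
      where
      open ≡-Reasoning
      s₁ : ∀ y y' → 2 * (y + y' + 1) ≡ suc (2 * y) + suc (2 * y')
      s₁ y y' = solve (y ∷ y' ∷ [])
      s₂ : ∀ f k e → suc (suc (f + e)) + suc (suc (k + e)) ≡ suc (suc f + k) + (2 * e + 2)
      s₂ f k e = solve (f ∷ k ∷ e ∷ [])
      s₃ : ∀ w e → suc (2 * w) + (2 * e + 2) ≡ suc (2 * (w + e + 1))
      s₃ w e = solve (w ∷ e ∷ [])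

  module Short (N : ℕ) (pN : suc N ≡ p) (p<q : p < q) where
    -- A bone that stops inside a path on p vertices has fewer than p path vertices, hence neither p
    -- nor q of them. The same count refutes `wide`.
    inner : ∀ {f k} → f + k ≡ N → 0 < k → Q (suc f) → ⊥
    inner {f} {k} fk k0 (inj₁ a) = refute (N ∷ f ∷ k ∷ p ∷ []) (K 1 ⊞ X 0 ⊞ (X 1 ⊞ X 2) ⊞ (K 1 ⊞ K 0) ⊞ X 3) (X 3 ⊞ X 0 ⊞ X 2 ⊞ (K 1 ⊞ X 1)) (le pN ⊕ le fk ⊕ k0 ⊕ ge a) refl
    inner {f} {k} fk k0 (inj₂ a) = refute (N ∷ f ∷ k ∷ q ∷ p ∷ []) (K 1 ⊞ X 0 ⊞ (X 1 ⊞ X 2) ⊞ X 3 ⊞ (K 1 ⊞ X 4)) (X 4 ⊞ X 0 ⊞ (K 1 ⊞ X 1) ⊞ X 3) (le pN ⊕ le fk ⊕ ge a ⊕ p<q) refl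

    wide : ∀ {f l k} → suc f < l → l + k ≡ N → Q (suc (suc f)) → ⊥
    wide {f} {l} {k} fl lk (inj₁ a) = refute (N ∷ l ∷ k ∷ f ∷ p ∷ []) (K 1 ⊞ X 0 ⊞ (X 1 ⊞ X 2) ⊞ (K 1 ⊞ (K 1 ⊞ X 3)) ⊞ X 4) (X 4 ⊞ X 0 ⊞ X 1 ⊞ (K 2 ⊞ X 3)) (le pN ⊕ le lk ⊕ fl ⊕ ge a) refl
    wide {f} {l} {k} fl lk (inj₂ a) = refute (N ∷ l ∷ k ∷ f ∷ q ∷ p ∷ []) (K 1 ⊞ X 0 ⊞ (X 1 ⊞ X 2) ⊞ (K 1 ⊞ (K 1 ⊞ X 3)) ⊞ X 4 ⊞ (K 1 ⊞ X 5)) (X 5 ⊞ X 0 ⊞ X 1 ⊞ (K 2 ⊞ X 3) ⊞ X 4) (le pN ⊕ le lk ⊕ fl ⊕ ge a ⊕ p<q) refl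

  module CaseA (qp : q ≡ suc (p + p)) where
    p<q : p < q
    p<q = ≤-trans (s≤s (m≤m+n p p)) (ge qp)

    -- A tail at an end of a path on p vertices gives two bones whose lengths differ by p - 1. This
    -- cannot happen when q - p = p + 1; when q - p = p - 1 it is how a second leg arises, see
    -- `CaseB`.
    short-end : ∀ {N e} → suc N ≡ p → Q (suc (suc e)) → Q (suc (suc (N + e))) → ⊥
    short-end {N} {e} pN (inj₁ a) (inj₁ b) = refute (N ∷ e ∷ p ∷ []) (K 2 ⊞ X 0 ⊞ X 1 ⊞ X 2) (X 2 ⊞ (K 1 ⊞ X 0)) (le b ⊕ ge pN) refl
    short-end {N} {e} pN (inj₂ a) (inj₁ b) = refute (q ∷ N ∷ e ∷ p ∷ []) (X 0 ⊞ (K 2 ⊞ X 1 ⊞ X 2) ⊞ (K 1 ⊞ X 3)) (K 2 ⊞ X 2 ⊞ X 3 ⊞ X 0) (ge a ⊕ le b ⊕ p<q) refl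
    short-end {N} {e} pN (inj₁ a) (inj₂ b) = refute (e ∷ q ∷ p ∷ N ∷ []) (K 2 ⊞ X 0 ⊞ X 1 ⊞ (K 1 ⊞ X 2 ⊞ X 2) ⊞ (K 1 ⊞ X 3)) (X 2 ⊞ (K 2 ⊞ X 3 ⊞ X 0) ⊞ X 1 ⊞ X 2) (le a ⊕ ge b ⊕ ge qp ⊕ le pN) refl
    short-end {N} {e} pN (inj₂ a) (inj₂ b) = refute (q ∷ N ∷ e ∷ p ∷ []) (X 0 ⊞ (K 2 ⊞ X 1 ⊞ X 2) ⊞ K 3 ⊞ X 3) (K 2 ⊞ X 2 ⊞ X 0 ⊞ X 3 ⊞ (K 1 ⊞ X 1)) (ge a ⊕ le b ⊕ p≥3 ⊕ ge pN) refl

    module Long (N : ℕ) (qN : suc N ≡ q) where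
      end : ∀ {e} → Q (suc (suc (N + e))) → ⊥
      end {e} (inj₁ b) = refute (N ∷ e ∷ q ∷ p ∷ []) (K 2 ⊞ X 0 ⊞ X 1 ⊞ X 2 ⊞ (K 1 ⊞ X 3)) (X 3 ⊞ (K 1 ⊞ X 0) ⊞ X 2) (le b ⊕ ge qN ⊕ p<q) refl
      end {e} (inj₂ b) = refute (N ∷ e ∷ q ∷ []) (K 2 ⊞ X 0 ⊞ X 1 ⊞ X 2) (X 2 ⊞ (K 1 ⊞ X 0)) (le b ⊕ ge qN) refl

      -- Both parts would have p vertices and share one, which makes 2p - 1 in all, but the path has
      -- 2p + 1.
      inner : ∀ {f k} → f + k ≡ N → 0 < f → 0 < k → Q (suc f) → Q (suc k) → ⊥
      inner {f} {k} fk f0 k0 (inj₁ a) (inj₁ b) = refute (N ∷ q ∷ f ∷ k ∷ p ∷ []) (X 0 ⊞ X 1 ⊞ (K 1 ⊞ X 2) ⊞ (K 1 ⊞ X 3) ⊞ (K 1 ⊞ X 4 ⊞ X 4)) (X 2 ⊞ X 3 ⊞ (K 1 ⊞ X 0) ⊞ X 4 ⊞ X 4 ⊞ X 1) (ge fk ⊕ ge qN ⊕ le a ⊕ le b ⊕ ge qp) refl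
      inner {f} {k} fk f0 k0 (inj₁ a) (inj₂ b) = refute (f ∷ k ∷ N ∷ q ∷ []) (X 0 ⊞ X 1 ⊞ (K 1 ⊞ X 2) ⊞ X 3 ⊞ (K 1 ⊞ K 0)) (X 2 ⊞ X 3 ⊞ (K 1 ⊞ X 1) ⊞ X 0) (le fk ⊕ le qN ⊕ ge b ⊕ f0) refl
      inner {f} {k} fk f0 k0 (inj₂ a) _ = refute (f ∷ k ∷ N ∷ q ∷ []) (X 0 ⊞ X 1 ⊞ (K 1 ⊞ X 2) ⊞ X 3 ⊞ (K 1 ⊞ K 0)) (X 2 ⊞ X 3 ⊞ (K 1 ⊞ X 0) ⊞ X 1) (le fk ⊕ le qN ⊕ ge a ⊕ k0) refl

      -- The bones that end in z from either side force f + 2 = k + 2 = p, and then the path that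
      -- crosses at z has f + k + 3 = 2p - 1 vertices.
      wide : ∀ {f l k} → suc f < l → l + k ≡ N → Q (suc (suc f)) → Q (suc (suc k)) → Q (suc (suc (suc (f + k)))) → ⊥
      wide {f} {l} {k} fl lk (inj₂ a) _ _ = refute (l ∷ k ∷ N ∷ q ∷ f ∷ []) (X 0 ⊞ X 1 ⊞ (K 1 ⊞ X 2) ⊞ X 3 ⊞ (K 1 ⊞ (K 1 ⊞ X 4))) (X 2 ⊞ X 3 ⊞ (K 2 ⊞ X 4) ⊞ X 0) (le lk ⊕ le qN ⊕ ge a ⊕ fl) refl
      wide {f} {l} {k} fl lk (inj₁ a) (inj₂ b) _ = refute (l ∷ k ∷ N ∷ q ∷ f ∷ []) (X 0 ⊞ X 1 ⊞ (K 1 ⊞ X 2) ⊞ X 3 ⊞ (K 1 ⊞ (K 1 ⊞ X 4))) (X 2 ⊞ X 3 ⊞ (K 2 ⊞ X 1) ⊞ X 0) (le lk ⊕ le qN ⊕ ge b ⊕ fl) refl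
      wide {f} {l} {k} fl lk (inj₁ a) (inj₁ b) (inj₁ c) = refute (p ∷ f ∷ k ∷ []) (X 0 ⊞ (K 3 ⊞ X 1 ⊞ X 2)) (K 2 ⊞ X 1 ⊞ X 0) (ge a ⊕ le c) refl
      wide {f} {l} {k} fl lk (inj₁ a) (inj₁ b) (inj₂ c) = refute (f ∷ k ∷ q ∷ p ∷ []) (K 2 ⊞ X 0 ⊞ (K 2 ⊞ X 1) ⊞ X 2 ⊞ (K 1 ⊞ X 3 ⊞ X 3)) (X 3 ⊞ X 3 ⊞ (K 3 ⊞ X 0 ⊞ X 1) ⊞ X 2) (le a ⊕ le b ⊕ ge c ⊕ ge qp) refl

  module CaseB (qp : suc q ≡ p + p) where
    p<q : p < q
    p<q = ≮⇒≥ λ lt → refute (q ∷ p ∷ []) (K 1 ⊞ X 0 ⊞ (X 1 ⊞ X 1) ⊞ K 3) (K 1 ⊞ X 1 ⊞ (K 1 ⊞ X 0) ⊞ X 1) (lt ⊕ ge qp ⊕ p≥3) refl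

    short-end : ∀ {N e} → suc N ≡ p → Q (suc (suc e)) → Q (suc (suc (N + e))) → suc (suc e) ≡ p
    short-end {N} {e} pN (inj₁ a) _ = a
    short-end {N} {e} pN (inj₂ a) (inj₁ b) = ⊥-elim (refute (q ∷ N ∷ e ∷ p ∷ []) (X 0 ⊞ (K 2 ⊞ X 1 ⊞ X 2) ⊞ (K 1 ⊞ X 3)) (K 2 ⊞ X 2 ⊞ X 3 ⊞ X 0) (ge a ⊕ le b ⊕ p<q) refl)
    short-end {N} {e} pN (inj₂ a) (inj₂ b) = ⊥-elim (refute (q ∷ N ∷ e ∷ p ∷ []) (X 0 ⊞ (K 2 ⊞ X 1 ⊞ X 2) ⊞ K 3 ⊞ X 3) (K 2 ⊞ X 2 ⊞ X 0 ⊞ X 3 ⊞ (K 1 ⊞ X 1)) (ge a ⊕ le b ⊕ p≥3 ⊕ ge pN) refl)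

    module Long (N : ℕ) (qN : suc N ≡ q) where
      end : ∀ {e} → Q (suc (suc (N + e))) → ⊥
      end {e} (inj₁ b) = refute (N ∷ e ∷ q ∷ p ∷ []) (K 2 ⊞ X 0 ⊞ X 1 ⊞ X 2 ⊞ (K 1 ⊞ X 3)) (X 3 ⊞ (K 1 ⊞ X 0) ⊞ X 2) (le b ⊕ ge qN ⊕ p<q) refl
      end {e} (inj₂ b) = refute (N ∷ e ∷ q ∷ []) (K 2 ⊞ X 0 ⊞ X 1 ⊞ X 2) (X 2 ⊞ (K 1 ⊞ X 0)) (le b ⊕ ge qN) refl

      inner : ∀ {f k} → f + k ≡ N → 0 < k → Q (suc f) → suc f ≡ p
      inner {f} {k} fk k0 (inj₁ a) = a
      inner {f} {k} fk k0 (inj₂ a) = ⊥-elim (refute (f ∷ k ∷ N ∷ q ∷ []) (X 0 ⊞ X 1 ⊞ (K 1 ⊞ X 2) ⊞ X 3 ⊞ (K 1 ⊞ K 0)) (X 2 ⊞ X 3 ⊞ (K 1 ⊞ X 0) ⊞ X 1) (le fk ⊕ le qN ⊕ ge a ⊕ k0) refl)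

      -- From an end of the path through the centre to the new leafy vertex there are p + e + 1
      -- vertices, more than p. Hence there are 2p - 1 of them, and the centre and the tail form a
      -- leg on p vertices.
      centre-leg : ∀ {f e} → suc f ≡ p → Q (suc (suc (f + e))) → suc (suc e) ≡ p
      centre-leg {f} {e} a (inj₁ b) = ⊥-elim (refute (p ∷ f ∷ e ∷ []) (X 0 ⊞ (K 2 ⊞ X 1 ⊞ X 2)) (K 1 ⊞ X 1 ⊞ X 0) (ge a ⊕ le b) refl)
      centre-leg {f} {e} a (inj₂ b) = ≤-antisym (≮⇒≥ λ lt → refute (p ∷ f ∷ e ∷ q ∷ []) (X 0 ⊞ (K 2 ⊞ X 1 ⊞ X 2) ⊞ (K 1 ⊞ X 3) ⊞ (K 1 ⊞ X 0)) (K 1 ⊞ X 1 ⊞ X 3 ⊞ (X 0 ⊞ X 0) ⊞ (K 2 ⊞ X 2)) (ge a ⊕ le b ⊕ le qp ⊕ lt) refl)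
        (≮⇒≥ λ lt → refute (f ∷ q ∷ p ∷ e ∷ []) (K 1 ⊞ X 0 ⊞ X 1 ⊞ (X 2 ⊞ X 2) ⊞ (K 1 ⊞ (K 2 ⊞ X 3))) (X 2 ⊞ (K 2 ⊞ X 0 ⊞ X 3) ⊞ (K 1 ⊞ X 1) ⊞ X 2) (le a ⊕ ge b ⊕ ge qp ⊕ lt) refl)

      -- The centre has index p - 1, so f = p - 2 and l = p are its two neighbours on the path: z is
      -- placed like a second centre. Then p + e is p or q, so z is the leafy vertex itself or the
      -- tail is a full leg that starts at z.
      wide : ∀ {f l k e} → suc f < l → l + k ≡ N → Q (suc (suc f)) → Q (suc (suc k)) → Q (suc (suc (f + e))) →
        suc (suc f) ≡ p × l ≡ p × suc (suc k) ≡ p × (e ≡ 0 ⊎ suc e ≡ p)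
      wide {f} {l} {k} {e} fl lk (inj₂ a) _ _ = ⊥-elim (refute (l ∷ k ∷ N ∷ q ∷ f ∷ []) (X 0 ⊞ X 1 ⊞ (K 1 ⊞ X 2) ⊞ X 3 ⊞ (K 1 ⊞ (K 1 ⊞ X 4))) (X 2 ⊞ X 3 ⊞ (K 2 ⊞ X 4) ⊞ X 0) (le lk ⊕ le qN ⊕ ge a ⊕ fl) refl)
      wide {f} {l} {k} {e} fl lk (inj₁ a) (inj₂ b) _ = ⊥-elim (refute (l ∷ k ∷ N ∷ q ∷ f ∷ []) (X 0 ⊞ X 1 ⊞ (K 1 ⊞ X 2) ⊞ X 3 ⊞ (K 1 ⊞ (K 1 ⊞ X 4))) (X 2 ⊞ X 3 ⊞ (K 2 ⊞ X 1) ⊞ X 0) (le lk ⊕ le qN ⊕ ge b ⊕ fl) refl)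
      wide {f} {l} {k} {e} fl lk (inj₁ a) (inj₁ b) r = a ,
        ≤-antisym (≮⇒≥ λ lt → refute (l ∷ k ∷ N ∷ p ∷ q ∷ []) (X 0 ⊞ X 1 ⊞ (K 1 ⊞ X 2) ⊞ X 3 ⊞ (K 1 ⊞ X 4) ⊞ (K 1 ⊞ X 3)) (X 2 ⊞ X 4 ⊞ (K 2 ⊞ X 1) ⊞ (X 3 ⊞ X 3) ⊞ X 0) (le lk ⊕ le qN ⊕ ge b ⊕ le qp ⊕ lt) refl)
                  (≮⇒≥ λ lt → refute (N ∷ q ∷ k ∷ p ∷ l ∷ []) (X 0 ⊞ X 1 ⊞ (K 2 ⊞ X 2) ⊞ (X 3 ⊞ X 3) ⊞ (K 1 ⊞ X 4)) (X 4 ⊞ X 2 ⊞ (K 1 ⊞ X 0) ⊞ X 3 ⊞ (K 1 ⊞ X 1) ⊞ X 3) (ge lk ⊕ ge qN ⊕ le b ⊕ ge qp ⊕ lt) refl) , b , leg r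
        where
        leg : Q (suc (suc (f + e))) → e ≡ 0 ⊎ suc e ≡ p
        leg (inj₁ c) = inj₁ (n≤0⇒n≡0 (≮⇒≥ λ lt → refute (p ∷ f ∷ e ∷ []) (X 0 ⊞ (K 2 ⊞ X 1 ⊞ X 2) ⊞ (K 1 ⊞ K 0)) (K 2 ⊞ X 1 ⊞ X 0 ⊞ X 2) (ge a ⊕ le c ⊕ lt) refl))
        leg (inj₂ c) = inj₂ (≤-antisym (≮⇒≥ λ lt → refute (p ∷ f ∷ e ∷ q ∷ []) (X 0 ⊞ (K 2 ⊞ X 1 ⊞ X 2) ⊞ (K 1 ⊞ X 3) ⊞ (K 1 ⊞ X 0)) (K 2 ⊞ X 1 ⊞ X 3 ⊞ (X 0 ⊞ X 0) ⊞ (K 1 ⊞ X 2)) (ge a ⊕ le c ⊕ le qp ⊕ lt) refl)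
                  (≮⇒≥ λ lt → refute (f ∷ q ∷ p ∷ e ∷ []) (K 2 ⊞ X 0 ⊞ X 1 ⊞ (X 2 ⊞ X 2) ⊞ (K 1 ⊞ (K 1 ⊞ X 3))) (X 2 ⊞ (K 2 ⊞ X 0 ⊞ X 3) ⊞ (K 1 ⊞ X 1) ⊞ X 2) (le a ⊕ ge c ⊕ ge qp ⊕ lt) refl))

-- The graphs T and S

-- The graphs T and S have κ arms; arm c is a copy of D_k^p attached at the base vertex v c, numbered from b + c * width.
module Arms (b κ k p₂ : ℕ) (v : ℕ → ℕ) (v<b : ∀ c → c < κ → v c < b) (bs es : List (ℕ × ℕ)) where

  p₁ width : ℕ
  p₁ = suc p₂
  width = suc (p₂ + k)

  o : ℕ → ℕ
  o c = b + c * width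

  order' : ℕ
  order' = b + κ * width

  H : Graph
  H = fromEdges order' es

  arm# : ℕ → ℕ → ℕ
  arm# c j = chain (v c) (o c) j

  leaf# : ℕ → ℕ → ℕ
  leaf# c r = o c + p₁ + r

  o+< : ∀ {c y} → c < κ → y < width → o c + y < order'
  o+< {c} {y} cK ys = ≤-trans (≤-reflexive (sym (+-suc (b + c * width) y))) (≤-trans (≤-reflexive (+-assoc b (c * width) (suc y)))
    (+-monoʳ-≤ b (≤-trans (+-monoʳ-≤ (c * width) ys) (≤-trans (≤-reflexive (+-comm (c * width) width)) (*-monoˡ-≤ width cK)))))

  b< : ∀ {x} → x < b → x < order'
  b< lt = ≤-trans lt (m≤m+n b _)

  arm<width : ∀ {j} → j < p₁ → j < width
  arm<width lt = ≤-trans lt (s≤s (m≤m+n p₂ k))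

  leaf<width : ∀ {r} → r < k → p₁ + r < width
  leaf<width {r} lt = s≤s (≤-trans (≤-reflexive (sym (+-suc p₂ r))) (+-monoʳ-≤ p₂ lt))

  data View : ℕ → Set where
    base : ∀ {x} → x < b → View x
    arm : ∀ c j → c < κ → j < p₁ → View (arm# c (suc j))
    leaf : ∀ c r → c < κ → r < k → View (leaf# c r)

  view-offset : ∀ c y → c < κ → y < width → View (o c + y)
  view-offset c y cK ys with y <? p₁
  ... | yes lt = arm c y cK lt
  ... | no ge = subst View (trans (+-assoc (o c) p₁ (y ∸ p₁)) (cong (o c +_) (m+[n∸m]≡n (≮⇒≥ ge))))
        (leaf c (y ∸ p₁) cK (+-cancelˡ-< p₁ _ _ (≤-trans (s≤s (≤-reflexive (m+[n∸m]≡n (≮⇒≥ ge)))) ys)))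

  view-block : ∀ x → b ≤ x → o ((x ∸ b) / width) + (x ∸ b) % width ≡ x
  view-block x bx = trans (+-assoc b _ _) (trans (cong (b +_) (trans (+-comm (((x ∸ b) / width) * width) _)
    (sym (m≡m%n+[m/n]*n (x ∸ b) width)))) (m+[n∸m]≡n bx))

  view : ∀ x → x < order' → View x
  view x lt with x <? b
  ... | yes xb = base xb
  ... | no nb = subst View (view-block x (≮⇒≥ nb)) (view-offset _ _
      (m<n*o⇒m/o<n (+-cancelˡ-< b _ _ (≤-trans (s≤s (≤-reflexive (m+[n∸m]≡n (≮⇒≥ nb)))) lt))) (m%n<n (x ∸ b) width))

  module _ (es-out : ∀ {x y} → (x , y) ∈ es → (x , y) ∈ bs ⊎ (∃ λ c → c < κ × (x , y) ∈ attachD (v c) (o c) k (suc p₁)))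
           (es-base : ∀ {x y} → (x , y) ∈ bs → (x , y) ∈ es)
           (es-arm : ∀ {x y} c → c < κ → (x , y) ∈ attachD (v c) (o c) k (suc p₁) → (x , y) ∈ es) where

    chain-∈ : ∀ c j → c < κ → j < p₁ → (arm# c j , arm# c (suc j)) ∈ es
    chain-∈ c j cK lt = es-arm c cK (∈-++⁺ˡ (∈-map⁺ (λ j → (chain (v c) (o c) j , chain (v c) (o c) (suc j))) (∈-upTo⁺ lt)))

    leaf-∈ : ∀ c r → c < κ → r < k → (arm# c p₁ , leaf# c r) ∈ es
    leaf-∈ c r cK lt = es-arm c cK (∈-++⁺ʳ (map (λ j → (chain (v c) (o c) j , chain (v c) (o c) (suc j))) (upTo p₁))
      (∈-map⁺ (λ r → (chain (v c) (o c) p₁ , o c + p₁ + r)) (∈-upTo⁺ lt)))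

    data EdgeView : ℕ → ℕ → Set where
      base-edge : ∀ {x y} → (x , y) ∈ bs → EdgeView x y
      chain-edge : ∀ c j → c < κ → j < p₁ → EdgeView (arm# c j) (arm# c (suc j))
      leaf-edge : ∀ c r → c < κ → r < k → EdgeView (arm# c p₁) (leaf# c r)

    edge-view : ∀ {x y} → (x , y) ∈ es → EdgeView x y
    edge-view m with es-out m
    ... | inj₁ mb = base-edge mb
    ... | inj₂ (c , cK , ma) with ∈-++⁻ (map (λ j → (chain (v c) (o c) j , chain (v c) (o c) (suc j))) (upTo p₁)) ma
    ... | inj₁ mc with ∈-map⁻ (λ j → (chain (v c) (o c) j , chain (v c) (o c) (suc j))) mc
    ... | j , mj , refl = chain-edge c j cK (∈-upTo⁻ mj)
    edge-view m | inj₂ (c , cK , ma) | inj₂ ml with ∈-map⁻ (λ r → (chain (v c) (o c) p₁ , o c + p₁ + r)) ml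
    ... | r , mr , refl = leaf-edge c r cK (∈-upTo⁻ mr)

    module Cover (CB : List ℕ) (v∈ : ∀ c → c < κ → v c ∈ CB) (bs-cover : ∀ {x y} → (x , y) ∈ bs → x ∈ CB ⊎ y ∈ CB)
      (h : ℕ) (p-even : p₁ ≡ h + h) where

      -- Positions 2, 4, ..., p - 1 of an arm; position 0 is the base vertex, which `CB` contains.
      -- As p - 1 is even, the vertex that carries the pendants is among them.
      evens : ℕ → List ℕ
      evens c = map (λ i → o c + (i + i + 1)) (upTo h)

      arms-cover : ℕ → List ℕ
      arms-cover zero = []
      arms-cover (suc c) = evens c ++ arms-cover c

      cover : List ℕ
      cover = CB ++ arms-cover κ

      cover-length : length cover ≡ length CB + κ * h
      cover-length = trans (length-++ CB) (cong (length CB +_) (go κ))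
        where
        go : ∀ c → length (arms-cover c) ≡ c * h
        go zero = refl
        go (suc c) = trans (length-++ (evens c)) (cong₂ _+_ (trans (length-map _ (upTo h)) (length-upTo h)) (go c))

      arm-in : ∀ {x} n c → c < n → x ∈ evens c → x ∈ arms-cover n
      arm-in (suc n) c lt m with c ≟ n
      ... | yes refl = ∈-++⁺ˡ m
      ... | no ne = ∈-++⁺ʳ (evens n) (arm-in n c (≤∧≢⇒< (s≤s⁻¹ lt) ne) m)

      even-in : ∀ c i → c < κ → i ≤ h → arm# c (i + i) ∈ cover
      even-in c zero cK _ = ∈-++⁺ˡ (v∈ c cK)
      even-in c (suc i) cK lt = ∈-++⁺ʳ CB (arm-in κ c cK (subst (_∈ evens c) (cong (o c +_) (trans (+-comm (i + i) 1) (sym (+-suc i i))))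
        (∈-map⁺ (λ i → o c + (i + i + 1)) (∈-upTo⁺ lt))))

      half : ∀ j → ∃ λ i → j ≡ i + i ⊎ j ≡ suc (i + i)
      half zero = 0 , inj₁ refl
      half (suc j) with half j
      ... | i , inj₁ e = i , inj₂ (cong suc e)
      ... | i , inj₂ e = suc i , inj₁ (trans (cong suc e) (sym (cong suc (+-suc i i))))

      double≤ : ∀ {i} → i + i ≤ h + h → i ≤ h
      double≤ {i} le' = ≮⇒≥ λ lt → refute (h ∷ i ∷ []) (K 1 ⊞ X 0 ⊞ (K 1 ⊞ X 0) ⊞ (X 1 ⊞ X 1)) (X 1 ⊞ X 1 ⊞ (X 0 ⊞ X 0)) (lt ⊕ lt ⊕ le') refl

      covers-edges : ∀ {x y} → (x , y) ∈ es → x ∈ cover ⊎ y ∈ cover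
      covers-edges m with edge-view m
      ... | base-edge mb = [ inj₁ ∘ ∈-++⁺ˡ , inj₂ ∘ ∈-++⁺ˡ ]′ (bs-cover mb)
      ... | leaf-edge c r cK _ = inj₁ (subst (λ x → arm# c x ∈ cover) (sym p-even) (even-in c h cK ≤-refl))
      ... | chain-edge c j cK lt with half j
      ... | i , inj₁ refl = inj₁ (even-in c i cK (double≤ (≤-trans (<⇒≤ lt) (≤-reflexive p-even))))
      ... | i , inj₂ refl = inj₂ (subst (λ x → arm# c x ∈ cover) (cong suc (+-suc i i))
              (even-in c (suc i) cK (double≤ {suc i} (≤-trans (≤-reflexive (cong suc (+-suc i i))) (≤-trans lt (≤-reflexive p-even))))))

    ReachN : ℕ → ℕ → Set
    ReachN x y = ∀ (i j : Fin order') → toℕ i ≡ x → toℕ j ≡ y → Reachable H i j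

    edge-reach : ∀ {x y z} → y < order' → (x , y) ∈ es ⊎ (y , x) ∈ es → ReachN y z → ReachN x z
    edge-reach {x} {y} yN m r i j refl refl = step {v = fromℕ< yN} (∈-edge order' es i (fromℕ< yN)
      (subst (λ y → (toℕ i , y) ∈ es ⊎ (y , toℕ i) ∈ es) (sym (𝔽.toℕ-fromℕ< yN)) m)) (r (fromℕ< yN) j (𝔽.toℕ-fromℕ< yN) refl)

    refl-reach : ∀ {x} → ReachN x x
    refl-reach i j e e' with refl ← 𝔽.toℕ-injective (trans e (sym e')) = here

    arm#< : ∀ c j → c < κ → j ≤ p₁ → arm# c j < order'
    arm#< c zero cK _ = b< (v<b c cK)
    arm#< c (suc j) cK lt = o+< cK (arm<width lt)

    H-connected : (z : ℕ) → z < b → (∀ x → x < b → ReachN x z) → Connected H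
    H-connected z zb base-reach = ≤-trans (s≤s z≤n) (b< zb) , λ i j → reach-trans (to-z i) (from-z j)
      where
      arm-reach : ∀ c j → c < κ → j ≤ p₁ → ReachN (arm# c j) z
      arm-reach c zero cK _ = base-reach (v c) (v<b c cK)
      arm-reach c (suc j) cK lt = edge-reach (arm#< c j cK (<⇒≤ lt)) (inj₂ (chain-∈ c j cK lt)) (arm-reach c j cK (<⇒≤ lt))
      go : ∀ {x} → View x → ReachN x z
      go (base xb) = base-reach _ xb
      go (arm c j cK lt) = arm-reach c (suc j) cK lt
      go (leaf c r cK lt) = edge-reach (arm#< c p₁ cK ≤-refl) (inj₂ (leaf-∈ c r cK lt)) (arm-reach c p₁ cK ≤-refl)
      Z : Fin order'
      Z = fromℕ< (b< zb)
      to-z : ∀ i → Reachable H i Z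
      to-z i = go (view (toℕ i) (𝔽.toℕ<n i)) i Z refl (𝔽.toℕ-fromℕ< (b< zb))
      H-sym : ∀ {i j} → Adj H i j ≡ true → Adj H j i ≡ true
      H-sym {i} {j} e = ∈-edge order' es j i ([ inj₂ , inj₁ ]′ (edge-∈ order' es i j e))
      rev-reach : ∀ {i j} → Reachable H i j → Reachable H j i
      rev-reach here = here
      rev-reach (step {u} {w} e r) = reach-trans (rev-reach r) (step (H-sym {u} {w} e) here)
      from-z : ∀ j → Reachable H Z j
      from-z j = rev-reach (to-z j)

    module Embed {G : Graph} (sim : IsSimple G) (FB : ℕ → Fin (order G)) (armV leafV : ℕ → ℕ → Fin (order G)) where
      open Base sim

      block : ℕ → ℕ → V
      block c y = dec-elim (y <? p₁) (λ _ → armV c (suc y)) (λ _ → leafV c (y ∸ p₁))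

      F : ℕ → V
      F x = dec-elim (x <? b) (λ _ → FB x) (λ _ → block ((x ∸ b) / width) ((x ∸ b) % width))

      F-base : ∀ {x} → x < b → F x ≡ FB x
      F-base {x} lt with x <? b
      ... | yes _ = refl
      ... | no n' = ⊥-elim (n' lt)

      F-block : ∀ c y → y < width → F (o c + y) ≡ block c y
      F-block c y ys with (o c + y) <? b
      ... | yes lt = ⊥-elim (<-irrefl refl (≤-trans lt (≤-trans (m≤m+n b (c * width)) (m≤m+n _ y))))
      ... | no _ = cong₂ block (trans (cong (_/ width) e) (trans (+-distrib-/-∣ʳ y {c * width} {width} (n∣m*n c))
                     (cong₂ _+_ (m<n⇒m/n≡0 ys) (m*n/n≡m c width))))
                   (trans (cong (_% width) e) (trans ([m+kn]%n≡m%n y c width) (m<n⇒m%n≡m ys)))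
        where
        e : o c + y ∸ b ≡ y + c * width
        e = trans (cong (_∸ b) (+-assoc b (c * width) y)) (trans (m+n∸m≡n b (c * width + y)) (+-comm (c * width) y))

      module _ (arm-0 : ∀ c → c < κ → armV c 0 ≡ FB (v c)) where
        F-arm : ∀ c j → c < κ → j ≤ p₁ → F (arm# c j) ≡ armV c j
        F-arm c zero cK _ = trans (F-base (v<b c cK)) (sym (arm-0 c cK))
        F-arm c (suc j) cK lt = trans (F-block c j (arm<width lt)) (lem (j <? p₁))
          where
          lem : (d : Dec (j < p₁)) → dec-elim d (λ _ → armV c (suc j)) (λ _ → leafV c (j ∸ p₁)) ≡ armV c (suc j)
          lem (yes _) = refl
          lem (no n') = ⊥-elim (n' lt)

        F-leaf : ∀ c r → r < k → F (leaf# c r) ≡ leafV c r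
        F-leaf c r lt = trans (cong F (+-assoc (o c) p₁ r)) (trans (F-block c (p₁ + r) (leaf<width lt)) (lem ((p₁ + r) <? p₁)))
          where
          lem : (d : Dec (p₁ + r < p₁)) → dec-elim d (λ _ → armV c (suc (p₁ + r))) (λ _ → leafV c (p₁ + r ∸ p₁)) ≡ leafV c r
          lem (yes lt') = ⊥-elim (<-irrefl refl (≤-trans lt' (m≤m+n p₁ r)))
          lem (no _) = cong (leafV c) (m+n∸m≡n p₁ r)

        module _ (arm-ind : ∀ c → c < κ → Ind (armV c) p₁)
          (arm-cross : ∀ c c' → c < κ → c' < κ → c ≢ c' → ∀ j j' → 0 < j → j ≤ p₁ → 0 < j' → j' ≤ p₁ → Far (armV c j) (armV c' j'))
          (base-inj : ∀ x y → x < b → y < b → FB x ≡ FB y → x ≡ y)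
          (base-to : ∀ {x y} → (x , y) ∈ bs → x < b × y < b × E (FB x) (FB y))
          (base-from : ∀ x y → x < b → y < b → E (FB x) (FB y) → (x , y) ∈ bs ⊎ (y , x) ∈ bs)
          (base-arm : ∀ x c j → x < b → c < κ → 0 < j → j ≤ p₁ → x ≢ v c → Far (FB x) (armV c j))
          (leaf-edge-E : ∀ c r → c < κ → r < k → E (armV c p₁) (leafV c r))
          (leaf-only : ∀ c r → c < κ → r < k → ∀ u → E u (leafV c r) → u ≡ armV c p₁)
          (leaf-inj : ∀ c r r' → c < κ → r < k → r' < k → leafV c r ≡ leafV c r' → r ≡ r')
          (leaf-base : ∀ c r x → c < κ → r < k → x < b → leafV c r ≢ FB x)
          (leaf-arm : ∀ c r c' j → c < κ → r < k → c' < κ → j ≤ p₁ → leafV c r ≢ armV c' j) where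

          base-arm-far : ∀ {x c j} → x < b → c < κ → j < p₁ → E (FB x) (armV c (suc j)) → x ≡ v c × j ≡ 0
          base-arm-far {x} {c} {j} xb cK lt e with x ≟ v c
          ... | no ne = ⊥-elim (Far-E (base-arm x c (suc j) xb cK (s≤s z≤n) lt ne) e)
          ... | yes refl with ind-adj (arm-ind c cK) z≤n lt (subst (λ x → E x (armV c (suc j))) (sym (arm-0 c cK)) e)
          ... | inj₁ refl = refl , refl

          base-arm-≢ : ∀ {x c j} → x < b → c < κ → j < p₁ → FB x ≢ armV c (suc j)
          base-arm-≢ {x} {c} {j} xb cK lt with x ≟ v c
          ... | no ne = proj₂ (base-arm x c (suc j) xb cK (s≤s z≤n) lt ne)
          ... | yes refl = λ e → ind-≢ (arm-ind c cK) (s≤s z≤n) lt (trans (arm-0 c cK) e)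

          leaf-far-base : ∀ {x c r} → x < b → c < κ → r < k → ¬ E (FB x) (leafV c r)
          leaf-far-base {x} {c} {r} xb cK lt e = base-arm-≢ xb cK ≤-refl (leaf-only c r cK lt _ e)

          arm-same : ∀ {c c' j j'} → c < κ → c' < κ → 0 < j → j ≤ p₁ → 0 < j' → j' ≤ p₁ → armV c j ≡ armV c' j' → c ≡ c'
          arm-same {c} {c'} cK cK' j0 jp j0' jp' e with c ≟ c'
          ... | yes r = r
          ... | no ne = ⊥-elim (proj₂ (arm-cross c c' cK cK' ne _ _ j0 jp j0' jp') e)

          leaf-leaf : ∀ {c r c' r'} → c < κ → r < k → c' < κ → r' < k → ¬ E (leafV c r) (leafV c' r')
          leaf-leaf {c} {r} {c'} cK lt cK' lt' e = leaf-arm c r c' p₁ cK lt cK' ≤-refl (leaf-only _ _ cK' lt' _ e)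

          Finj : ∀ {x y} → View x → View y → F x ≡ F y → x ≡ y
          Finj (base a) (base a') e = base-inj _ _ a a' (trans (sym (F-base a)) (trans e (F-base a')))
          Finj (base a) (arm c j cK lt) e = ⊥-elim (base-arm-≢ a cK lt (trans (sym (F-base a)) (trans e (F-arm c (suc j) cK lt))))
          Finj (arm c j cK lt) (base a) e = ⊥-elim (base-arm-≢ a cK lt (trans (sym (F-base a)) (trans (sym e) (F-arm c (suc j) cK lt))))
          Finj (base a) (leaf c r cK lt) e = ⊥-elim (leaf-base c r _ cK lt a (trans (sym (F-leaf c r lt)) (trans (sym e) (F-base a))))
          Finj (leaf c r cK lt) (base a) e = ⊥-elim (leaf-base c r _ cK lt a (trans (sym (F-leaf c r lt)) (trans e (F-base a))))
          Finj (arm c j cK lt) (arm c' j' cK' lt') e with trans (sym (F-arm c (suc j) cK lt)) (trans e (F-arm c' (suc j') cK' lt'))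
          ... | e' with arm-same cK cK' (s≤s z≤n) lt (s≤s z≤n) lt' e'
          ... | refl = cong (arm# c) (ind-inj (arm-ind c cK) lt lt' e')
          Finj (arm c j cK lt) (leaf c' r cK' lt') e = ⊥-elim (leaf-arm c' r c (suc j) cK' lt' cK lt (trans (sym (F-leaf c' r lt')) (trans (sym e) (F-arm c (suc j) cK lt))))
          Finj (leaf c' r cK' lt') (arm c j cK lt) e = ⊥-elim (leaf-arm c' r c (suc j) cK' lt' cK lt (trans (sym (F-leaf c' r lt')) (trans e (F-arm c (suc j) cK lt))))
          Finj (leaf c r cK lt) (leaf c' r' cK' lt') e with trans (sym (F-leaf c r lt)) (trans e (F-leaf c' r' lt'))
          ... | e' with arm-same cK cK' (s≤s z≤n) ≤-refl (s≤s z≤n) ≤-refl (leaf-only c' r' cK' lt' _ (subst (E (armV c p₁)) e' (leaf-edge-E c r cK lt)))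
          ... | refl = cong (leaf# c) (leaf-inj c r r' cK lt lt' e')

          to : ∀ {x y} → EdgeView x y → E (F x) (F y)
          to (base-edge m) = let (xb , yb , e) = base-to m in subst₂ E (sym (F-base xb)) (sym (F-base yb)) e
          to (chain-edge c j cK lt) = subst₂ E (sym (F-arm c j cK (<⇒≤ lt))) (sym (F-arm c (suc j) cK lt)) (adj (arm-ind c cK) j lt)
          to (leaf-edge c r cK lt) = subst₂ E (sym (F-arm c p₁ cK ≤-refl)) (sym (F-leaf c r lt)) (leaf-edge-E c r cK lt)

          InEs : ℕ → ℕ → Set
          InEs x y = (x , y) ∈ es ⊎ (y , x) ∈ es

          swap : ∀ {x y} → InEs x y → InEs y x
          swap = [ inj₂ , inj₁ ]′

          base-arm-in : ∀ {x} c j → x < b → c < κ → j < p₁ → E (F x) (F (arm# c (suc j))) → InEs x (arm# c (suc j))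
          base-arm-in c j xb cK lt e with base-arm-far xb cK lt (subst₂ E (F-base xb) (F-arm c (suc j) cK lt) e)
          ... | refl , refl = inj₁ (chain-∈ c 0 cK (s≤s z≤n))

          arm-leaf-in : ∀ c j c' r → c < κ → j < p₁ → c' < κ → r < k → E (F (arm# c (suc j))) (F (leaf# c' r)) → InEs (arm# c (suc j)) (leaf# c' r)
          arm-leaf-in c j c' r cK lt cK' lt' e with leaf-only c' r cK' lt' _ (subst₂ E (F-arm c (suc j) cK lt) (F-leaf c' r lt') e)
          ... | e' with arm-same cK cK' (s≤s z≤n) lt (s≤s z≤n) ≤-refl e'
          ... | refl with ind-inj (arm-ind c cK) lt ≤-refl e'
          ... | refl = inj₁ (leaf-∈ c r cK lt')

          arm-arm-in : ∀ c j c' j' → c < κ → j < p₁ → c' < κ → j' < p₁ → E (F (arm# c (suc j))) (F (arm# c' (suc j'))) → InEs (arm# c (suc j)) (arm# c' (suc j'))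
          arm-arm-in c j c' j' cK lt cK' lt' e with subst₂ E (F-arm c (suc j) cK lt) (F-arm c' (suc j') cK' lt') e | c ≟ c'
          ... | e' | no ne = ⊥-elim (Far-E (arm-cross c c' cK cK' ne _ _ (s≤s z≤n) lt (s≤s z≤n) lt') e')
          ... | e' | yes refl with ind-adj (arm-ind c cK) lt lt' e'
          ... | inj₁ refl = inj₁ (chain-∈ c (suc j) cK lt')
          ... | inj₂ refl = inj₂ (chain-∈ c (suc j') cK lt)

          from : ∀ {x y} → View x → View y → E (F x) (F y) → InEs x y
          from (base a) (base a') e = [ inj₁ ∘ es-base , inj₂ ∘ es-base ]′ (base-from _ _ a a' (subst₂ E (F-base a) (F-base a') e))
          from (base a) (arm c j cK lt) e = base-arm-in c j a cK lt e
          from (arm c j cK lt) (base a) e = swap (base-arm-in c j a cK lt (E-sym e))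
          from (base a) (leaf c r cK lt) e = ⊥-elim (leaf-far-base a cK lt (subst₂ E (F-base a) (F-leaf c r lt) e))
          from (leaf c r cK lt) (base a) e = ⊥-elim (leaf-far-base a cK lt (E-sym (subst₂ E (F-leaf c r lt) (F-base a) e)))
          from (arm c j cK lt) (arm c' j' cK' lt') e = arm-arm-in c j c' j' cK lt cK' lt' e
          from (arm c j cK lt) (leaf c' r cK' lt') e = arm-leaf-in c j c' r cK lt cK' lt' e
          from (leaf c' r cK' lt') (arm c j cK lt) e = swap (arm-leaf-in c j c' r cK lt cK' lt' (E-sym e))
          from (leaf c r cK lt) (leaf c' r' cK' lt') e = ⊥-elim (leaf-leaf cK lt cK' lt' (subst₂ E (F-leaf c r lt) (F-leaf c' r' lt') e))

          embedding : InducedCopy H G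
          embedding = copy order' es (F ∘ toℕ) (λ {i} {j} e → 𝔽.toℕ-injective (Finj (view _ (𝔽.toℕ<n i)) (view _ (𝔽.toℕ<n j)) e))
            (λ i j m → to (edge-view m)) (λ i j → from (view _ (𝔽.toℕ<n i)) (view _ (𝔽.toℕ<n j)))

-- A proper copy would have smaller deficiency, but the vertex cover S bounds its deficiency from below by d.
module Recognise {G : Graph} (sim : IsSimple G) (N : ℕ) (es : List (ℕ × ℕ)) (S : List ℕ)
  (cov : ∀ {x y} → (x , y) ∈ es → x ∈ S ⊎ y ∈ S) where

  cov' : ∀ (i j : Fin N) → Adj (fromEdges N es) i j ≡ true → toℕ i ∈ S ⊎ toℕ j ∈ S
  cov' i j e = [ cov , (λ m → [ inj₂ , inj₁ ]′ (cov m)) ]′ (edge-∈ N es i j e)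

  iso-bound : ∀ {d} → Def G d → G ≅ fromEdges N es → N ≤ d + (length S + length S)
  iso-bound {d} (M , _ , refl) (f , fE) = ≤-trans (𝔽.injective⇒≤ {f = Inverse.from f} λ {i} {j} e →
      trans (sym (Inverse.strictlyInverseˡ f i)) (trans (cong (Inverse.to f) e) (Inverse.strictlyInverseˡ f j)))
    (cover-bound sim M S (toℕ ∘ Inverse.to f) (λ {u} {v} e → trans (sym (Inverse.strictlyInverseʳ f u))
        (trans (cong (Inverse.from f) (𝔽.toℕ-injective e)) (Inverse.strictlyInverseʳ f v)))
      (λ u v e → cov' _ _ (trans (sym (fE u v)) e)))

  copy-iso : ∀ {d} → DeficiencyCritical G → Def G d → InducedCopy (fromEdges N es) G → Connected (fromEdges N es) →
    d + (length S + length S) ≤ N → G ≅ fromEdges N es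
  copy-iso {d} crit D (f , inj , fE) Hcon dN = mk↔ₛ′ g f gf fg , λ u v → trans (cong₂ (Adj G) (sym (fg u)) (sym (fg v))) (sym (fE (g u) (g v)))
    where
    transport : ∀ {i j} → Reachable (fromEdges N es) i j → Reachable (induce G f) i j
    transport here = here
    transport (step e r) = step (trans (sym (fE _ _)) e) (transport r)
    full : ¬ (N < order G)
    full lt = critical-use sim crit D f inj lt (proj₁ Hcon , λ i j → transport (proj₂ Hcon i j)) λ { (M , md) →
      1+n≰n (≤-trans (+-monoˡ-≤ (length S + length S) md) (≤-trans dN
        (cover-bound (induce-simple sim f) M S toℕ 𝔽.toℕ-injective (λ u v e → cov' u v (trans (fE u v) e))))) }
    sur : ∀ v → ∃ λ i → f i ≡ v
    sur v with 𝔽.any? (λ i → f i 𝔽.≟ v)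
    ... | yes h = h
    ... | no none = ⊥-elim (full (≤-trans (s≤s (count-lower (λ u → not (v == u)) f inj
            (λ i → not-in λ e → none (i , sym (==⇒≡ e)))))
          (≤-trans (count-insert (λ u → not (v == u)) (λ _ → true) v (λ _ _ → refl)
            (¬true⇒false λ e → not-out e (==-refl v)) refl) (≤-reflexive (count-all _)))))
    g : Fin (order G) → Fin N
    g v = proj₁ (sur v)
    fg : ∀ v → f (g v) ≡ v
    fg v = proj₂ (sur v)
    gf : ∀ i → g (f i) ≡ i
    gf i = inj (fg (f i))

module TGraph (k p₂ : ℕ) where
  p₁ : ℕ
  p₁ = suc p₂

  bs es : List (ℕ × ℕ)
  bs = concatMap (λ m → (0 , 2 + m) ∷ (1 , 2 + m) ∷ []) (upTo k)
  es = bs ++ attachD 0 (2 + k) k (suc p₁) ++ attachD 1 (2 + k + sizeD k (suc p₁)) k (suc p₁)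

  v<b : ∀ c → c < 2 → c < 2 + k
  v<b c lt = ≤-trans lt (m≤m+n 2 k)

  module A = Arms (2 + k) 2 k p₂ id v<b bs es

  o₀ : A.o 0 ≡ 2 + k
  o₀ = +-identityʳ (2 + k)

  o₁ : A.o 1 ≡ 2 + k + sizeD k (suc p₁)
  o₁ = cong (2 + k +_) (+-identityʳ _)

  es-out : ∀ {x y} → (x , y) ∈ es → (x , y) ∈ bs ⊎ (∃ λ c → c < 2 × (x , y) ∈ attachD c (A.o c) k (suc p₁))
  es-out {x} {y} m = [ inj₁ , (λ m' → inj₂ ([ (λ a → 0 , s≤s z≤n , subst (λ o → (x , y) ∈ attachD 0 o k (suc p₁)) (sym o₀) a)
    , (λ a → 1 , s≤s (s≤s z≤n) , subst (λ o → (x , y) ∈ attachD 1 o k (suc p₁)) (sym o₁) a) ]′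
      (∈-++⁻ (attachD 0 (2 + k) k (suc p₁)) m'))) ]′ (∈-++⁻ bs m)

  es-base : ∀ {x y} → (x , y) ∈ bs → (x , y) ∈ es
  es-base = ∈-++⁺ˡ

  es-arm : ∀ {x y} c → c < 2 → (x , y) ∈ attachD c (A.o c) k (suc p₁) → (x , y) ∈ es
  es-arm {x} {y} 0 _ m = ∈-++⁺ʳ bs (∈-++⁺ˡ (subst (λ o → (x , y) ∈ attachD 0 o k (suc p₁)) o₀ m))
  es-arm {x} {y} 1 _ m = ∈-++⁺ʳ bs (∈-++⁺ʳ (attachD 0 (2 + k) k (suc p₁)) (subst (λ o → (x , y) ∈ attachD 1 o k (suc p₁)) o₁ m))
  es-arm (suc (suc c)) (s≤s (s≤s ()))

  bs-out : ∀ {x y} → (x , y) ∈ bs → ∃ λ m → m < k × y ≡ 2 + m × (x ≡ 0 ⊎ x ≡ 1)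
  bs-out e = go (upTo k) (λ x h → ∈-upTo⁻ h) e
    where
    go : ∀ {x y} (ms : List ℕ) → (∀ m → m ∈ ms → m < k) → (x , y) ∈ concatMap (λ m → (0 , 2 + m) ∷ (1 , 2 + m) ∷ []) ms →
      ∃ λ m → m < k × y ≡ 2 + m × (x ≡ 0 ⊎ x ≡ 1)
    go (m ∷ ms) h (here refl) = m , h m (here refl) , refl , inj₁ refl
    go (m ∷ ms) h (there (here refl)) = m , h m (here refl) , refl , inj₂ refl
    go (m ∷ ms) h (there (there e)) = go ms (λ m' i → h m' (there i)) e

  bs-in : ∀ {m} → m < k → ((0 , 2 + m) ∈ bs) × ((1 , 2 + m) ∈ bs)
  bs-in {m} lt = go (upTo k) (∈-upTo⁺ lt)
    where
    go : (ms : List ℕ) → m ∈ ms → ((0 , 2 + m) ∈ concatMap (λ m → (0 , 2 + m) ∷ (1 , 2 + m) ∷ []) ms)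
      × ((1 , 2 + m) ∈ concatMap (λ m → (0 , 2 + m) ∷ (1 , 2 + m) ∷ []) ms)
    go (m ∷ ms) (here refl) = here refl , there (here refl)
    go (m ∷ ms) (there i) = let (a , b) = go ms i in there (there a) , there (there b)

  module C (h : ℕ) (p-even : p₁ ≡ h + h) where
    CB : List ℕ
    CB = 0 ∷ 1 ∷ []

    roots-in : ∀ c → c < 2 → c ∈ CB
    roots-in 0 _ = here refl
    roots-in 1 _ = there (here refl)
    roots-in (suc (suc c)) (s≤s (s≤s ()))

    bs-cover : ∀ {x y} → (x , y) ∈ bs → x ∈ CB ⊎ y ∈ CB
    bs-cover m = inj₁ ([ here , there ∘ here ]′ (proj₂ (proj₂ (proj₂ (bs-out m)))))

    open A.Cover es-out es-base es-arm CB roots-in bs-cover h p-even public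

    -- The cover has 2 + 2h = p + 1 vertices, so the order exceeds twice its size by 3k - 2, which
    -- is 3n - 8 for k = n - 2.
    cover-size : ∀ d → d + 2 ≡ k + k + k → d + (length cover + length cover) ≡ 2 + k + 2 * sizeD k (suc p₁)
    cover-size d e = trans (cong₂ (λ a b → d + (a + b)) cover-length cover-length)
      (trans (s₁ d h) (trans (cong (λ x → x + 2 + 2 * (h + h)) e) (trans (s₂ k h) (cong (λ x → 2 + k + 2 * (x + k)) (sym p-even)))))
      where
      s₁ : ∀ d h → d + (2 + 2 * h + (2 + 2 * h)) ≡ d + 2 + 2 + 2 * (h + h)
      s₁ d h = solve (d ∷ h ∷ [])
      s₂ : ∀ k h → k + k + k + 2 + 2 * (h + h) ≡ 2 + k + 2 * (h + h + k)
      s₂ k h = solve (k ∷ h ∷ [])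

  T-connected : 0 < k → Connected (T k (suc p₁))
  T-connected k0 = A.H-connected es-out es-base es-arm 0 (s≤s z≤n) base-reach
    where
    base-reach : ∀ x → x < 2 + k → A.ReachN es-out es-base es-arm x 0
    base-reach 0 _ = A.refl-reach es-out es-base es-arm
    base-reach (suc (suc m)) (s≤s (s≤s lt)) = A.edge-reach es-out es-base es-arm (s≤s z≤n) (inj₂ (es-base (proj₁ (bs-in lt)))) (A.refl-reach es-out es-base es-arm)
    base-reach 1 _ = A.edge-reach es-out es-base es-arm (A.b< (s≤s (s≤s k0))) (inj₁ (es-base (proj₂ (bs-in k0)))) (base-reach 2 (s≤s (s≤s k0)))

  -- α and β start at the two vertices of degree k of K_{2,k} and run outwards, μ lists its other
  -- side, and λα, λβ list the pendants at the far ends.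
  module TEmbed {G : Graph} (sim : IsSimple G) (α β μ λα λβ : ℕ → Fin (order G)) where
    open Base sim
    FB : ℕ → V
    FB 0 = α 0
    FB 1 = β 0
    FB (suc (suc m)) = μ m

    armV leafV : ℕ → ℕ → V
    armV zero = α
    armV (suc _) = β
    leafV zero = λα
    leafV (suc _) = λβ

    module _ (Iα : Ind α p₁) (Iβ : Ind β p₁) (αβ : ∀ i j → i ≤ p₁ → j ≤ p₁ → Far (α i) (β j))
      (αμ : ∀ m → m < k → E (α 0) (μ m)) (βμ : ∀ m → m < k → E (β 0) (μ m))
      (αμ-far : ∀ m j → m < k → 0 < j → j ≤ p₁ → Far (μ m) (α j)) (βμ-far : ∀ m j → m < k → 0 < j → j ≤ p₁ → Far (μ m) (β j))
      (μμ : ∀ m m' → m < k → m' < k → Adj G (μ m) (μ m') ≡ false) (μ-inj : ∀ m m' → m < k → m' < k → μ m ≡ μ m' → m ≡ m')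
      (lα : ∀ r → r < k → E (α p₁) (λα r)) (lβ : ∀ r → r < k → E (β p₁) (λβ r))
      (lα-only : ∀ r → r < k → ∀ u → E u (λα r) → u ≡ α p₁) (lβ-only : ∀ r → r < k → ∀ u → E u (λβ r) → u ≡ β p₁)
      (lα-inj : ∀ r r' → r < k → r' < k → λα r ≡ λα r' → r ≡ r') (lβ-inj : ∀ r r' → r < k → r' < k → λβ r ≡ λβ r' → r ≡ r')
      (lα-α : ∀ r j → r < k → j ≤ p₁ → λα r ≢ α j) (lα-β : ∀ r j → r < k → j ≤ p₁ → λα r ≢ β j)
      (lβ-α : ∀ r j → r < k → j ≤ p₁ → λβ r ≢ α j) (lβ-β : ∀ r j → r < k → j ≤ p₁ → λβ r ≢ β j) where

      T-embedding : InducedCopy (T k (suc p₁)) G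
      T-embedding = A.Embed.embedding es-out es-base es-arm sim FB armV leafV
        (λ { 0 _ → refl ; 1 _ → refl ; (suc (suc c)) (s≤s (s≤s ())) })
        (λ { 0 _ → Iα ; (suc _) _ → Iβ })
        (λ { 0 0 _ _ ne → ⊥-elim (ne refl) ; 0 (suc _) _ _ _ j j' _ a _ b → αβ j j' a b ; (suc _) 0 _ _ _ j j' _ a _ b → Far-sym (αβ j' j b a)
           ; 1 1 _ _ ne → ⊥-elim (ne refl) ; (suc (suc c)) (suc _) (s≤s (s≤s ())) ; 1 (suc (suc c)) _ (s≤s (s≤s ())) })
        base-inj base-to base-from base-arm
        (λ { 0 r _ → lα r ; (suc _) r _ → lβ r }) (λ { 0 r _ → lα-only r ; (suc _) r _ → lβ-only r })
        (λ { 0 r r' _ → lα-inj r r' ; (suc _) r r' _ → lβ-inj r r' })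
        leaf-base
        (λ { 0 r 0 j _ a _ b → lα-α r j a b ; 0 r (suc _) j _ a _ b → lα-β r j a b ; (suc _) r 0 j _ a _ b → lβ-α r j a b ; (suc _) r (suc _) j _ a _ b → lβ-β r j a b })
        where
        base-inj : ∀ x y → x < 2 + k → y < 2 + k → FB x ≡ FB y → x ≡ y
        base-inj 0 0 _ _ _ = refl
        base-inj 1 1 _ _ _ = refl
        base-inj 0 1 _ _ e = ⊥-elim (proj₂ (αβ 0 0 z≤n z≤n) e)
        base-inj 1 0 _ _ e = ⊥-elim (proj₂ (αβ 0 0 z≤n z≤n) (sym e))
        base-inj 0 (suc (suc m)) _ (s≤s (s≤s lt)) e = ⊥-elim (E-≢ (αμ m lt) e)
        base-inj (suc (suc m)) 0 (s≤s (s≤s lt)) _ e = ⊥-elim (E-≢ (αμ m lt) (sym e))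
        base-inj 1 (suc (suc m)) _ (s≤s (s≤s lt)) e = ⊥-elim (E-≢ (βμ m lt) e)
        base-inj (suc (suc m)) 1 (s≤s (s≤s lt)) _ e = ⊥-elim (E-≢ (βμ m lt) (sym e))
        base-inj (suc (suc m)) (suc (suc m')) (s≤s (s≤s lt)) (s≤s (s≤s lt')) e = cong (λ x → suc (suc x)) (μ-inj m m' lt lt' e)
        base-to : ∀ {x y} → (x , y) ∈ bs → x < 2 + k × y < 2 + k × E (FB x) (FB y)
        base-to {x} {y} e with bs-out e
        ... | m , lt , refl , inj₁ refl = s≤s z≤n , s≤s (s≤s lt) , αμ m lt
        ... | m , lt , refl , inj₂ refl = s≤s (s≤s z≤n) , s≤s (s≤s lt) , βμ m lt
        base-from : ∀ x y → x < 2 + k → y < 2 + k → E (FB x) (FB y) → (x , y) ∈ bs ⊎ (y , x) ∈ bs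
        base-from 0 0 _ _ e = ⊥-elim (E-≢ e refl)
        base-from 1 1 _ _ e = ⊥-elim (E-≢ e refl)
        base-from 0 1 _ _ e = ⊥-elim (Far-E (αβ 0 0 z≤n z≤n) e)
        base-from 1 0 _ _ e = ⊥-elim (Far-E (αβ 0 0 z≤n z≤n) (E-sym e))
        base-from 0 (suc (suc m)) _ (s≤s (s≤s lt)) e = inj₁ (proj₁ (bs-in lt))
        base-from (suc (suc m)) 0 (s≤s (s≤s lt)) _ e = inj₂ (proj₁ (bs-in lt))
        base-from 1 (suc (suc m)) _ (s≤s (s≤s lt)) e = inj₁ (proj₂ (bs-in lt))
        base-from (suc (suc m)) 1 (s≤s (s≤s lt)) _ e = inj₂ (proj₂ (bs-in lt))
        base-from (suc (suc m)) (suc (suc m')) (s≤s (s≤s lt)) (s≤s (s≤s lt')) e = ⊥-elim (true≢false e (μμ m m' lt lt'))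
        base-arm : ∀ x c j → x < 2 + k → c < 2 → 0 < j → j ≤ p₁ → x ≢ c → Far (FB x) (armV c j)
        base-arm 0 0 j _ _ _ _ ne = ⊥-elim (ne refl)
        base-arm 1 1 j _ _ _ _ ne = ⊥-elim (ne refl)
        base-arm 0 (suc c) j _ _ _ b _ = αβ 0 j z≤n b
        base-arm 1 0 j _ _ _ b _ = Far-sym (αβ j 0 b z≤n)
        base-arm (suc (suc m)) 0 j (s≤s (s≤s lt)) _ a b _ = αμ-far m j lt a b
        base-arm (suc (suc m)) (suc _) j (s≤s (s≤s lt)) _ a b _ = βμ-far m j lt a b
        base-arm 1 (suc (suc c)) j _ (s≤s (s≤s ())) _ _ _
        leaf-base : ∀ c r x → c < 2 → r < k → x < 2 + k → leafV c r ≢ FB x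
        leaf-base 0 r 0 _ a _ = lα-α r 0 a z≤n
        leaf-base 0 r 1 _ a _ = lα-β r 0 a z≤n
        leaf-base (suc _) r 0 _ a _ = lβ-α r 0 a z≤n
        leaf-base (suc _) r 1 _ a _ = lβ-β r 0 a z≤n
        -- A middle vertex is adjacent to both α 0 and β 0, so it cannot have the single neighbour
        -- of a pendant.
        leaf-base 0 r (suc (suc m)) _ a (s≤s (s≤s lt)) e = proj₂ (αβ p₁ 0 ≤-refl z≤n)
          (sym (lα-only r a _ (subst (E (β 0)) (sym e) (βμ m lt))))
        leaf-base (suc _) r (suc (suc m)) _ a (s≤s (s≤s lt)) e = proj₂ (αβ 0 p₁ z≤n ≤-refl)
          (lβ-only r a _ (subst (E (α 0)) (sym e) (αμ m lt)))

module SGraph (k p₂ : ℕ) where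
  p₁ κ : ℕ
  p₁ = suc p₂
  κ = suc k

  es : List (ℕ × ℕ)
  es = concatMap (λ c → attachD 0 (1 + c * sizeD k (suc p₁)) k (suc p₁)) (upTo κ)

  module A = Arms 1 κ k p₂ (λ _ → 0) (λ _ _ → s≤s z≤n) [] es

  es-out : ∀ {x y} → (x , y) ∈ es → (x , y) ∈ [] ⊎ (∃ λ c → c < κ × (x , y) ∈ attachD 0 (A.o c) k (suc p₁))
  es-out m = inj₂ (go (upTo κ) (λ c i → ∈-upTo⁻ i) m)
    where
    go : ∀ {x y} (cs : List ℕ) → (∀ c → c ∈ cs → c < κ) → (x , y) ∈ concatMap (λ c → attachD 0 (A.o c) k (suc p₁)) cs →
      ∃ λ c → c < κ × (x , y) ∈ attachD 0 (A.o c) k (suc p₁)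
    go (c ∷ cs) lt m = [ (λ a → c , lt c (here refl) , a) , go cs (λ c' i → lt c' (there i)) ]′ (∈-++⁻ (attachD 0 (A.o c) k (suc p₁)) m)

  es-base : ∀ {x y} → (x , y) ∈ [] → (x , y) ∈ es
  es-base ()

  es-arm : ∀ {x y} c → c < κ → (x , y) ∈ attachD 0 (A.o c) k (suc p₁) → (x , y) ∈ es
  es-arm {x} {y} c cκ m = go (upTo κ) (∈-upTo⁺ cκ)
    where
    go : ∀ (cs : List ℕ) → c ∈ cs → (x , y) ∈ concatMap (λ c → attachD 0 (A.o c) k (suc p₁)) cs
    go (c' ∷ cs) (here refl) = ∈-++⁺ˡ m
    go (c' ∷ cs) (there i) = ∈-++⁺ʳ (attachD 0 (A.o c') k (suc p₁)) (go cs i)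

  module C (h : ℕ) (p-even : p₁ ≡ h + h) where
    open A.Cover es-out es-base es-arm (0 ∷ []) (λ _ _ → here refl) (λ ()) h p-even public

    -- The cover consists of the centre and h vertices on each leg, so the order exceeds twice its
    -- size by κ * k - 1, that is (n - 1)(n - 2) - 1.
    cover-size : ∀ d → d + 1 ≡ κ * k → d + (length cover + length cover) ≡ 1 + κ * sizeD k (suc p₁)
    cover-size d e = trans (cong (λ x → d + (x + x)) cover-length)
      (trans (s₁ d (κ * h)) (trans (cong (λ x → x + 1 + (κ * h + κ * h)) e) (trans (s₂ k h) (cong (λ x → 1 + κ * (x + k)) (sym p-even)))))
      where
      s₁ : ∀ d y → d + (1 + y + (1 + y)) ≡ d + 1 + 1 + (y + y)
      s₁ d y = solve (d ∷ y ∷ [])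
      s₂ : ∀ k h → suc k * k + 1 + (suc k * h + suc k * h) ≡ 1 + suc k * (h + h + k)
      s₂ k h = solve (k ∷ h ∷ [])

  S-connected : Connected (S κ (suc p₁))
  S-connected = A.H-connected es-out es-base es-arm 0 (s≤s z≤n) λ { zero _ → A.refl-reach es-out es-base es-arm ; (suc x) (s≤s ()) }

  module SEmbed {G : Graph} (sim : IsSimple G) (c : Fin (order G)) (r leafs : Fin κ → ℕ → Fin (order G)) where
    open Base sim

    -- The arms of S are numbered in ℕ, the legs of a spider by `Fin κ`; `zero` is only the value
    -- past the last arm.
    ix : ℕ → Fin κ
    ix x = dec-elim (x <? κ) (λ lt → fromℕ< lt) (λ _ → zero)

    ix-inj : ∀ x y → x < κ → y < κ → ix x ≡ ix y → x ≡ y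
    ix-inj x y xκ yκ e with x <? κ | y <? κ
    ... | yes a | yes b = trans (sym (𝔽.toℕ-fromℕ< a)) (trans (cong toℕ e) (𝔽.toℕ-fromℕ< b))
    ... | no n | _ = ⊥-elim (n xκ)
    ... | _ | no n = ⊥-elim (n yκ)

    module _ (r-0 : ∀ i → r i 0 ≡ c) (leg : ∀ i → Ind (r i) p₁)
      (cross : ∀ {a b} → a ≢ b → ∀ j j' → 0 < j → j ≤ p₁ → 0 < j' → j' ≤ p₁ → Far (r a j) (r b j'))
      (leaf-E : ∀ i x → x < k → E (r i p₁) (leafs i x)) (leaf-only : ∀ i x → x < k → ∀ u → E u (leafs i x) → u ≡ r i p₁)
      (leaf-off : ∀ i x → x < k → ∀ a j → j ≤ p₁ → leafs i x ≢ r a j)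
      (leaf-inj : ∀ i x y → x < k → y < k → leafs i x ≡ leafs i y → x ≡ y) where

      S-embedding : InducedCopy (S κ (suc p₁)) G
      S-embedding = A.Embed.embedding es-out es-base es-arm sim (λ _ → c) (λ a → r (ix a)) (λ a → leafs (ix a))
        (λ a _ → r-0 (ix a)) (λ a _ → leg (ix a))
        (λ a b aκ bκ ab → cross (λ e → ab (ix-inj a b aκ bκ e)))
        (λ { zero zero _ _ _ → refl ; (suc _) _ (s≤s ()) ; zero (suc _) _ (s≤s ()) })
        (λ ())
        (λ { x y _ _ e → ⊥-elim (E-≢ e refl) })
        (λ { zero a j _ _ _ _ ne → ⊥-elim (ne refl) ; (suc _) a j (s≤s ()) })
        (λ a x _ → leaf-E (ix a) x) (λ a x _ → leaf-only (ix a) x) (λ a x y _ → leaf-inj (ix a) x y)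
        (λ a x b aκ lt bb e → leaf-off (ix a) x lt (ix a) 0 z≤n (trans e (sym (r-0 (ix a)))))
        (λ a x b j _ lt _ jp → leaf-off (ix a) x lt (ix b) j jp)

-- Levels over a set, and what criticality forces outside it

module Main {G : Graph} (sim : IsSimple G) where
  open Base sim

  module Levels (S : V → Bool) (con : ∀ v → ∃ λ s → S s ≡ true × Reachable G s v) where
    ball : ℕ → V → Bool
    ball zero v = S v
    ball (suc k) v = ball k v ∨ anyF (λ u → ball k u ∧ Adj G u v)

    ball-step : ∀ {u v k} → ball k u ≡ true → E u v → ball (suc k) v ≡ true
    ball-step {u} {v} {k} h e = ∨-inr {ball k v} (anyF-in (λ u → ball k u ∧ Adj G u v) u (∧-in h e))

    reach-ball : ∀ {u v} k → ball k u ≡ true → Reachable G u v → ∃ λ j → ball j v ≡ true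
    reach-ball k h here = k , h
    reach-ball k h (step {u} {v} e r) = reach-ball (suc k) (ball-step {u} {v} {k} h e) r

    abstract
      lv-spec : ∀ v → ∃ λ j → ball j v ≡ true × (∀ i → i < j → ball i v ≡ false)
      lv-spec v with con v
      ... | s , ss , r with reach-ball 0 ss r
      ... | k , bk with least (λ j → ball j v) k bk
      ... | j , _ , bj , mn = j , bj , mn

    lv : V → ℕ
    lv v = proj₁ (lv-spec v)

    lv≤ : ∀ {v k} → ball k v ≡ true → lv v ≤ k
    lv≤ {v} {k} h = ≮⇒≥ λ lt → true≢false h (proj₂ (proj₂ (lv-spec v)) k lt)

    lv-ball : ∀ v → ball (lv v) v ≡ true
    lv-ball v = proj₁ (proj₂ (lv-spec v))

    lv-S : ∀ {v} → S v ≡ true → lv v ≡ 0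
    lv-S h = n≤0⇒n≡0 (lv≤ {k = 0} h)

    S-lv : ∀ {v} → lv v ≡ 0 → S v ≡ true
    S-lv {v} e = subst (λ k → ball k v ≡ true) e (lv-ball v)

    lip : ∀ {u v} → E u v → lv v ≤ suc (lv u)
    lip {u} {v} e = lv≤ (ball-step {u} {v} {lv u} (lv-ball u) e)

    parent : ∀ v m → lv v ≡ suc m → ∃ λ u → E u v × lv u ≡ m
    parent v m e with ∨-case {ball m v} (subst (λ k → ball k v ≡ true) e (lv-ball v))
    ... | inj₁ h = ⊥-elim (1+n≰n (≤-trans (≤-reflexive (sym e)) (lv≤ h)))
    ... | inj₂ h with anyF-out (λ u → ball m u ∧ Adj G u v) h
    ... | u , h' = u , uv , ≤-antisym (lv≤ (∧-l h')) (s≤s⁻¹ (≤-trans (≤-reflexive (sym e)) (lip uv)))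
      where
      uv : E u v
      uv = ∧-r {ball m u} h'

    record Geodesic (v : V) (L : ℕ) : Set where
      field
        ζ : ℕ → V
        end : ζ L ≡ v
        level : ∀ j → j ≤ L → lv (ζ j) ≡ j
        edge : ∀ j → j < L → E (ζ j) (ζ (suc j))
      -- Along an edge the level rises by at most one, so a path that gains one level at every step
      -- has no chords.
      ind : Ind ζ L
      ind = mkInd edge λ i j ij jL →
        let li = level i (<⇒≤ (≤-trans (<⇒≤ ij) jL)) ; lj = level j jL in
        ¬E⇒ (λ e → 1+n≰n (≤-trans ij (≤-trans (≤-reflexive (sym lj)) (≤-trans (lip e) (s≤s (≤-reflexive li)))))) ,
        λ e → <-irrefl (trans (sym li) (trans (cong lv e) lj)) (<⇒≤ ij)

    geodesic : ∀ L v → lv v ≡ L → Geodesic v L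
    geodesic zero v e = record { ζ = λ _ → v ; end = refl ; level = λ { zero _ → e } ; edge = λ j () }
    geodesic (suc L) v e with parent v L e
    ... | u , uv , lu with geodesic L u lu
    ... | g = record { ζ = z ; end = end' ; level = level' ; edge = edge' }
      where
      module g = Geodesic g
      z : ℕ → V
      z = glue g.ζ L (λ _ → v)
      end' : z (suc L) ≡ v
      end' = trans (cong (z ∘ suc) (sym (+-identityʳ L))) (glue-r {g.ζ} {L} {λ _ → v} 0)
      level' : ∀ j → j ≤ suc L → lv (z j) ≡ j
      level' j le with m≤n⇒m<n∨m≡n le
      ... | inj₁ lt = trans (cong lv (glue-l {g.ζ} {L} {λ _ → v} (s≤s⁻¹ lt))) (g.level j (s≤s⁻¹ lt))
      ... | inj₂ refl = trans (cong lv end') e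
      edge' : ∀ j → j < suc L → E (z j) (z (suc j))
      edge' j lt with m≤n⇒m<n∨m≡n (s≤s⁻¹ lt)
      ... | inj₁ lt' = subst₂ E (sym (glue-l {g.ζ} {L} {λ _ → v} (<⇒≤ lt'))) (sym (glue-l {g.ζ} {L} {λ _ → v} lt')) (g.edge j lt')
      ... | inj₂ refl = subst₂ E (sym (trans (glue-l {g.ζ} {L} {λ _ → v} ≤-refl) g.end)) (sym end') uv

  module Outer (S : V → Bool)
    (con : ∀ v → ∃ λ s → S s ≡ true × Reachable G s v)
    (s₀ : V) (ss₀ : S s₀ ≡ true)
    (Scon : ∀ v → S v ≡ true → RIn {G} (λ u → S u ≡ true) v s₀)
    {d : ℕ} (crit : DeficiencyCritical G) (D : Def G d) where
    open Levels S con

    -- Matching a with b extends every matching of the rest, so G - a - b cannot be connected.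
    no-removal : ∀ a b → E a b → S a ≡ false → S b ≡ false →
      (∀ w m → w ≢ a → w ≢ b → lv w ≡ suc m → ∃ λ u → u ≢ a × u ≢ b × E u w × lv u ≡ m) → ⊥
    no-removal a b ab a∉ b∉ par = not-critical crit D (enum-connected sim A s₀ (in-A ss₀) reach)
      where
      open Remove sim a b ab
      in-A : ∀ {v} → S v ≡ true → A v ≡ true
      in-A h = A-in (λ { refl → true≢false h a∉ }) (λ { refl → true≢false h b∉ })
      go : ∀ m v → A v ≡ true → lv v ≡ m → RIn {G} (λ u → A u ≡ true) v s₀
      go zero v av e = RIn-map {G} in-A (Scon v (S-lv e))
      go (suc m) v av e with par v m (A-a av) (A-b av) e
      ... | u , ua , ub , uv , lu = rstep av (E-sym uv) (go m u (A-in ua ub) lu)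
      reach : ∀ v → A v ≡ true → RIn {G} (λ u → A u ≡ true) v s₀
      reach v av = go (lv v) v av refl

    module _ (x : V) (mx : ∀ v → lv v ≤ lv x) where
      notS : ∀ {v m} → lv v ≡ suc m → S v ≡ false
      notS e = ¬true⇒false λ h → 1+n≢0 (trans (sym e) (lv-S h))

      -- Vertices of the deepest level are nobody's parents. If two of them were adjacent, both
      -- could be removed without disconnecting the rest.
      deep-indep : ∀ {a b l} → lv x ≡ suc l → lv a ≡ suc l → lv b ≡ suc l → E a b → ⊥
      deep-indep {a} {b} {l} ex ea eb ab = no-removal a b ab (notS ea) (notS eb) λ w m wa wb ew →
        let (u , uw , lu) = parent w m ew
            low : lv u ≢ suc l
            low h = 1+n≰n (≤-trans (≤-reflexive (trans (cong suc (trans (sym h) lu)) (sym ew))) (≤-trans (mx w) (≤-reflexive ex)))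
        in u , (λ { refl → low ea }) , (λ { refl → low eb }) , uw , lu

      module Deep {l} (ex : lv x ≡ suc (suc l)) (a : V) (ax : E a x) (la : lv a ≡ suc l) where
        -- The children of a that would be cut off by removing a: its pendant leaves on the deepest
        -- level.
        Priv : V → Set
        Priv w = E a w × lv w ≡ suc (suc l) × (∀ v → (¬ E v w) ⊎ (v ≡ a))
        Priv? : ∀ w → Dec (Priv w)
        Priv? w = E? a w ×-dec (lv w ≟ suc (suc l)) ×-dec 𝔽.all? (λ v → ¬? (E? v w) ⊎-dec (v 𝔽.≟ a))

        priv-only : ∀ {w} → Priv w → ∀ v → E v w → v ≡ a
        priv-only (_ , _ , o) v e = [ (λ h → ⊥-elim (h e)) , id ]′ (o v)

        -- If no child of a except possibly b is a leaf, each of the others has a second neighbour,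
        -- which lies one level up because the deepest level is independent. So a and b could be
        -- removed; therefore a has two leaves.
        finish : ∀ b → E a b → lv b ≡ suc (suc l) → (∀ w → w ≢ b → ¬ Priv w) → ⊥
        finish b ab lb np = no-removal a b ab (notS la) (notS lb) par
          where
          nb : ∀ {u w m} → lv w ≡ suc m → lv u ≡ m → u ≢ b
          nb ew lu refl = 1+n≰n (≤-trans (≤-reflexive (trans (cong suc (trans (sym lb) lu)) (sym ew))) (≤-trans (mx _) (≤-reflexive ex)))
          par : ∀ w m → w ≢ a → w ≢ b → lv w ≡ suc m → ∃ λ u → u ≢ a × u ≢ b × E u w × lv u ≡ m
          par w m wa wb ew with parent w m ew
          ... | u , uw , lu with u 𝔽.≟ a
          ... | no ua = u , ua , nb ew lu , uw , lu
          ... | yes refl with 𝔽.any? (λ v → E? v w ×-dec ¬? (v 𝔽.≟ a))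
          ... | yes (v , vw , va) = v , va , nb ew lv' , vw , lv'
            where
            lw : lv w ≡ suc (suc l)
            lw = trans ew (cong suc (trans (sym lu) la))
            lv' : lv v ≡ m
            lv' with m≤n⇒m<n∨m≡n (≤-trans (mx v) (≤-reflexive ex))
            ... | inj₂ e = ⊥-elim (deep-indep ex e lw vw)
            ... | inj₁ lt = trans (≤-antisym (s≤s⁻¹ lt) (s≤s⁻¹ (≤-trans (≤-reflexive (sym lw)) (lip vw)))) (trans (sym la) lu)
          ... | no none = ⊥-elim (np w wb (uw , trans ew (cong suc (trans (sym lu) la)) , only))
            where
            only : ∀ v → (¬ E v w) ⊎ (v ≡ a)
            only v with E? v w | v 𝔽.≟ a
            ... | no ne | _ = inj₁ ne
            ... | yes _ | yes e = inj₂ e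
            ... | yes e | no va = ⊥-elim (none (v , e , va))

        leafy : ¬ Leafy a → ⊥
        leafy nl with 𝔽.any? Priv?
        ... | no np = finish x ax ex (λ w _ p → np (w , p))
        ... | yes (b , pb@(ab , lb , _)) = finish b ab lb λ w wb pw →
              nl (mkLeafy wb (proj₁ pw) ab (priv-only pw) (priv-only pb))

    -- A deepest vertex on level 2 or more has its parent on level 1 or more. That parent lies
    -- outside S, so the removals behind `Deep` leave S intact.
    leafy-outside : (∃ λ v → 2 ≤ lv v) → ∃ λ u → Leafy u × S u ≡ false
    leafy-outside (v , h) with argmax (λ _ → true) lv
    ... | inj₁ none = ⊥-elim (true≢false refl (none v))
    ... | inj₂ (x , _ , mx) with lv x in ex | ≤-trans h (mx v refl)
    ... | suc (suc l) | _ with parent x (suc l) ex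
    ... | a , ax , la with Leafy? a
    ... | yes L = a , L , notS x mx' la
      where
      mx' : ∀ v → lv v ≤ lv x
      mx' v = mx v refl
    ... | no nl = ⊥-elim (Deep.leafy x (λ v → mx v refl) ex a ax la nl)
    leafy-outside (v , h) | inj₂ (x , _ , mx) | suc zero | s≤s ()

    module _ (lS : ∀ u → Leafy u → S u ≡ true) where
      shallow : ∀ v → lv v ≤ 1
      shallow v = s≤s⁻¹ (≰⇒> λ h → let (u , L , u∉) = leafy-outside (v , h) in true≢false (lS u L) u∉)

      abstract
        outer-indep : ∀ u v → S u ≡ false → S v ≡ false → Adj G u v ≡ false
        outer-indep u v u∉ v∉ = ¬E⇒ λ e → deep-indep u (λ w → ≤-trans (shallow w) (≤-reflexive (sym (one u∉)))) (one u∉) (one u∉) (one v∉) e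
          where
          one : ∀ {v} → S v ≡ false → lv v ≡ 1
          one {v} h with lv v in e | shallow v
          ... | zero | _ = ⊥-elim (true≢false (S-lv e) h)
          ... | suc zero | _ = refl
          ... | suc (suc _) | s≤s ()

        outer-nbr : ∀ v → S v ≡ false → ∃ λ s → S s ≡ true × E s v
        outer-nbr v h with lv v in e | shallow v
        ... | zero | _ = ⊥-elim (true≢false (S-lv e) h)
        ... | suc zero | _ = let (u , uv , lu) = parent v 0 e in u , S-lv lu , uv
        ... | suc (suc _) | s≤s ()

  -- A shortest path from a set S to a vertex t outside S, without its first vertex.
  record Tail (S : V → Bool) (t : V) : Set where
    field
      ζ : ℕ → V
      e : ℕ
      ind : Ind ζ e
      end : ζ e ≡ t
      off : ∀ j → j ≤ e → S (ζ j) ≡ false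
      far-S : ∀ s j → S s ≡ true → 0 < j → j ≤ e → Far s (ζ j)
      touch : ∃ λ s → S s ≡ true × E s (ζ 0)

  tail : (S : V → Bool) → (∀ v → ∃ λ s → S s ≡ true × Reachable G s v) →
    ∀ t → S t ≡ false → Tail S t
  tail S con t t∉ = build (lv t) refl
    where
    open Levels S con
    build : ∀ L → lv t ≡ L → Tail S t
    build zero e = ⊥-elim (true≢false (S-lv e) t∉)
    build (suc L) e = record
      { ζ = λ j → g.ζ (suc j) ; e = L ; ind = ind-shift g.ind 1 L ≤-refl ; end = g.end
      ; off = λ j jL → ¬true⇒false λ h → 1+n≢0 (trans (sym (g.level (suc j) (s≤s jL))) (lv-S h))
      ; far-S = λ s j ss j0 jL → ¬E⇒ (λ h → 1+n≰n (≤-trans (s≤s j0) (≤-trans (≤-reflexive (sym (g.level (suc j) (s≤s jL))))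
           (≤-trans (lip h) (s≤s (≤-reflexive (lv-S ss)))))))
           , λ { refl → 1+n≢0 (trans (sym (g.level (suc j) (s≤s jL))) (lv-S ss)) }
      ; touch = g.ζ 0 , S-lv (g.level 0 z≤n) , g.edge 0 (s≤s z≤n) }
      where
      module g = Geodesic (geodesic (suc L) t e)

  -- Spiders, heights over a spider, and numbers of children

  record Spider (k m : ℕ) : Set where
    constructor mkSpider
    field
      c : V
      r : Fin k → ℕ → V
      r-0 : ∀ i → r i 0 ≡ c
      leg : ∀ i → Ind (r i) m
      cross : ∀ {a b} → a ≢ b → ∀ j j' → 0 < j → j ≤ m → 0 < j' → j' ≤ m → Far (r a j) (r b j')

    On : V → Set
    On v = ∃ λ i → ∃ λ (j : Fin (suc m)) → r i (toℕ j) ≡ v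

    On? : ∀ v → Dec (On v)
    On? v = 𝔽.any? (λ i → 𝔽.any? (λ j → r i (toℕ j) 𝔽.≟ v))

    abstract
      on : V → Bool
      on v = does (On? v)

      on-in : ∀ {v} → On v → on v ≡ true
      on-in {v} = dec-true (On? v)

      on-On : ∀ {v} → on v ≡ true → On v
      on-On {v} = does⇒ (On? v)

    on-or-off : ∀ v → on v ≡ true ⊎ on v ≡ false
    on-or-off v with on v
    ... | true = inj₁ refl
    ... | false = inj₂ refl

    on-r : ∀ i j → j ≤ m → on (r i j) ≡ true
    on-r i j jm = on-in (i , fromℕ< (s≤s jm) , cong (r i) (𝔽.toℕ-fromℕ< (s≤s jm)))

    on-out : ∀ {v} → on v ≡ true → ∃ λ i → ∃ λ j → j ≤ m × r i j ≡ v
    on-out {v} h = let (i , j , e) = on-On h in i , toℕ j , s≤s⁻¹ (𝔽.toℕ<n j) , e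

    off-≢ : ∀ {v} → on v ≡ false → ∀ i j → j ≤ m → r i j ≢ v
    off-≢ h i j jm refl = true≢false (on-r i j jm) h

    height-unique : ∀ {a b i j} → i ≤ m → j ≤ m → r a i ≡ r b j → i ≡ j
    height-unique {a} {b} {i} {j} im jm e with a 𝔽.≟ b
    ... | yes refl = ind-inj (leg a) im jm e
    ... | no ab with zero-or i | zero-or j
    ... | inj₁ refl | _ = ind-inj (leg b) im jm (trans (r-0 b) (trans (sym (r-0 a)) e))
    ... | inj₂ i0 | inj₁ refl = ind-inj (leg a) im jm (trans e (trans (r-0 b) (sym (r-0 a))))
    ... | inj₂ i0 | inj₂ j0 = ⊥-elim (proj₂ (cross ab i j i0 im j0 jm) e)

    on-connected : ∀ v → on v ≡ true → RIn {G} (λ u → on u ≡ true) v c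
    on-connected v h with on-out h
    ... | i , j , jm , refl = go j jm
      where
      go : ∀ j → j ≤ m → RIn {G} (λ u → on u ≡ true) (r i j) c
      go zero jm = subst (RIn {G} _ _) (r-0 i) (rhere (on-r i 0 jm))
      go (suc j) jm = rstep (on-r i (suc j) jm) (E-sym (adj (leg i) j jm)) (go j (<⇒≤ jm))

  module Heights {k m : ℕ} (sp : Spider k m)
    (nbr : ∀ v → Spider.on sp v ≡ false → ∃ λ s → Spider.on sp s ≡ true × E s v) where
    open Spider sp public

    touches : V → ℕ → Bool
    touches v j = anyF (λ i → Adj G (r i j) v)

    -- A vertex off the spider is put one level above its lowest neighbour.
    HSpec : V → ℕ → Set
    HSpec v l = (∃ λ i → l ≤ m × r i l ≡ v) ⊎
      (on v ≡ false × ∃ λ i → ∃ λ j → l ≡ suc j × j ≤ m × E (r i j) v × (∀ a j' → j' < j → ¬ E (r a j') v))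

    abstract
      height : ∀ v → ∃ (HSpec v)
      height v with on-or-off v
      ... | inj₁ e = let (i , j , jm , e') = on-out e in j , inj₁ (i , jm , e')
      ... | inj₂ e with nbr v e
      ... | s , os , sv with on-out os
      ... | i , j , jm , refl with least (touches v) j (anyF-in (λ i → Adj G (r i j) v) i sv)
      ... | j' , jj , t , mn with anyF-out (λ i → Adj G (r i j') v) t
      ... | i' , e' = suc j' , inj₂ (e , i' , j' , refl , ≤-trans jj jm , e' , λ a j'' lt h →
              true≢false (anyF-in (λ i → Adj G (r i j'') v) a h) (mn j'' lt))

    h : V → ℕ
    h v = proj₁ (height v)

    h-r : ∀ i j → j ≤ m → h (r i j) ≡ j
    h-r i j jm with proj₂ (height (r i j))
    ... | inj₁ (i' , jm' , e) = height-unique jm' jm e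
    ... | inj₂ (f , _) = ⊥-elim (true≢false (on-r i j jm) f)

    on-height : ∀ {v l} → on v ≡ true → h v ≡ l → ∃ λ i → l ≤ m × r i l ≡ v
    on-height {v} {l} o e = let (i , j , jm , e') = on-out o
                                jl = trans (sym (h-r i j jm)) (trans (cong h e') e)
                            in i , ≤-trans (≤-reflexive (sym jl)) jm , trans (cong (r i) (sym jl)) e'

    off-min : ∀ {v l} → on v ≡ false → h v ≡ suc l → ∀ a j → j < l → ¬ E (r a j) v
    off-min {v} o e a j lt with proj₂ (height v)
    ... | inj₁ (i , jm , e') = ⊥-elim (true≢false (subst (λ x → on x ≡ true) e' (on-r i _ jm)) o)
    ... | inj₂ (_ , i , j' , e' , _ , _ , mn) = mn a j (subst (j <_) (cong (_∸ 1) (trans (sym e) e')) lt)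

    root : ∀ v → h v ≡ 0 → v ≡ c
    root v e with proj₂ (height v)
    ... | inj₁ (i , jm , e') = trans (sym e') (trans (cong (r i) e) (r-0 i))
    ... | inj₂ (_ , i , j , e' , _) with () ← trans (sym e) e'

    parent : ∀ v l → h v ≡ suc l → ∃ λ u → E u v × h u ≡ l
    parent v l e with proj₂ (height v)
    ... | inj₁ (i , jm , e') = r i l , subst (E (r i l)) (trans (cong (r i) (sym e)) e') (adj (leg i) l lm) , h-r i l (<⇒≤ lm)
      where
      lm : l < m
      lm = ≤-trans (≤-reflexive (sym e)) jm
    ... | inj₂ (_ , i , j , e' , jm , ev , _) with refl ← cong (_∸ 1) (trans (sym e) e') = r i l , ev , h-r i l jm

  -- `two-legs` keeps the heights tree-like: a vertex off the spider that sees two legs also sees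
  -- the centre, so it has height 1 and is not a child of a leg vertex.
  module Skeleton {k m : ℕ} (sp : Spider k m)
    (nbr : ∀ v → Spider.on sp v ≡ false → ∃ λ s → Spider.on sp s ≡ true × E s v)
    (indep : ∀ u v → Spider.on sp u ≡ false → Spider.on sp v ≡ false → Adj G u v ≡ false)
    (two-legs : ∀ v → Spider.on sp v ≡ false → ∀ a b → a ≢ b → ∀ j j' → 0 < j → j ≤ m → 0 < j' → j' ≤ m →
       E (Spider.r sp a j) v → E (Spider.r sp b j') v → E (Spider.c sp) v × j ≤ 1)
    where
    open Heights sp nbr public

    Child : V → V → Set
    Child u w = E u w × h w ≡ suc (h u)

    childB : V → V → Bool
    childB u w = Adj G u w ∧ does (h w ≟ suc (h u))

    childB-in : ∀ {u w} → Child u w → childB u w ≡ true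
    childB-in {u} {w} (e , x) = ∧-in e (dec-true (h w ≟ suc (h u)) x)

    childB-out : ∀ {u} w → childB u w ≡ true → Child u w
    childB-out {u} w e = ∧-l e , does⇒ (h w ≟ suc (h u)) (∧-r {Adj G u w} e)

    -- For a child off the spider, its height excludes neighbours below j, and a neighbour on
    -- another leg would by `two-legs` bring in the centre. So a path on the spider that reaches r i
    -- j from below or from another leg can be completed by a claw of children.
    child-far : ∀ {i j w} → 0 < j → j ≤ m → E (r i j) w → h w ≡ suc j →
      ∀ a j' → j' ≤ m → a ≢ i ⊎ j' < j → Far (r a j') w
    child-far {i} {j} {w} j0 jm e hw a j' jm' o with on-or-off w
    child-far {i} {j} {w} j0 jm e hw a j' jm' o | inj₁ ow with on-height ow hw
    ... | i' , Jm , refl with i' 𝔽.≟ i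
    ... | no ne = ⊥-elim (Far-E (cross (ne ∘ sym) j (suc j) j0 jm (s≤s z≤n) Jm) e)
    ... | yes refl with a 𝔽.≟ i
    ... | yes refl = far (leg i) j' (suc j) (s≤s ([ (λ ne → ⊥-elim (ne refl)) , id ]′ o)) Jm
    ... | no ne with zero-or j'
    ... | inj₂ j'0 = cross ne j' (suc j) j'0 jm' (s≤s z≤n) Jm
    ... | inj₁ refl = subst (λ x → Far x (r i (suc j))) (trans (r-0 i) (sym (r-0 a))) (far (leg i) 0 (suc j) (s≤s j0) Jm)
    child-far {i} {j} {w} j0 jm e hw a j' jm' o | inj₂ ow = ¬E⇒ no-edge , off-≢ ow a j' jm'
      where
      no-edge : ¬ E (r a j') w
      no-edge e' with j' <? j
      ... | yes lt = off-min ow hw a j' lt e'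
      ... | no ge = off-min ow hw i 0 j0 (subst (λ x → E x w) (sym (r-0 i))
              (proj₁ (two-legs w ow a i ([ id , (λ lt → ⊥-elim (ge lt)) ]′ o) j' j (≤-trans j0 (≮⇒≥ ge)) jm' j0 jm e' e)))

    off-child : ∀ {u} → on u ≡ false → ∀ {w w'} → Child u w → Child u w' → w ≡ w'
    off-child {u} ou {w} {w'} (e , hw) (e' , hw') with on-or-off w | on-or-off w'
    ... | inj₂ ow | _ = ⊥-elim (true≢false e (indep u w ou ow))
    ... | inj₁ _ | inj₂ ow' = ⊥-elim (true≢false e' (indep u w' ou ow'))
    ... | inj₁ ow | inj₁ ow' with on-height ow hw | on-height ow' hw'
    ... | a , Jm , refl | b , Jm' , refl with a 𝔽.≟ b
    ... | yes refl = refl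
    ... | no ne = ⊥-elim (1+n≰n (≤-trans (≤-trans (s≤s (hu≥1)) (proj₂ (two-legs u ou a b ne _ _ (s≤s z≤n) Jm (s≤s z≤n) Jm' (E-sym e) (E-sym e')))) ≤-refl))
      where
      hu≥1 : 1 ≤ h u
      hu≥1 with h u in eq
      ... | suc _ = s≤s z≤n
      ... | zero = ⊥-elim (true≢false (subst (λ x → on x ≡ true) (trans (r-0 a) (sym (root u eq))) (on-r a 0 z≤n)) ou)

    -- A vertex off the spider has at most one child, and the centre has fewer than n independent
    -- ones; only the leg vertices are left to the hypothesis.
    skeleton-bound : ∀ {n d} → LocalIndepBelow G n → Def G d → (cost : V → ℕ) → 1 ≤ cost c → n ≤ suc (suc (cost c)) →
      (∀ i j → 0 < j → j ≤ m → ∀ W → (∀ w → W w ≡ true → Child (r i j) w) →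
         (∀ w w' → W w ≡ true → W w' ≡ true → Adj G w w' ≡ false) → count W ≤ suc (cost (r i j))) →
      d ≤ sumF cost
    skeleton-bound {n} loc D cost c1 cn inner = Process.process-bound sim h c root parent cost c1 ch D
      where
      ch : ∀ u (W : V → Bool) → (∀ w → W w ≡ true → Child u w) →
        (∀ w w' → W w ≡ true → W w' ≡ true → Adj G w w' ≡ false) → count W ≤ suc (cost u)
      ch u W Wc Wi with on-or-off u
      ... | inj₂ ou = ≤-trans (count≤1 W (λ w w' a b → off-child ou (Wc w a) (Wc w' b))) (s≤s z≤n)
      ... | inj₁ ou with on-out ou
      ... | i , j , jm , refl with zero-or j
      ... | inj₂ j0 = inner i j j0 jm W Wc Wi
      ... | inj₁ refl = s≤s⁻¹ (≤-trans (indep-count loc (r i 0) W (λ w a → proj₁ (Wc w a)) Wi)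
              (≤-trans cn (≤-reflexive (cong (λ x → suc (suc (cost x))) (sym (r-0 i))))))

    -- The preceding vertex on the leg is independent of the children and takes one of the n - 1
    -- places in a star around r i j. This is why a leg vertex costs one less than the root.
    child-count : ∀ {n} → LocalIndepBelow G n → ∀ i j → 0 < j → j ≤ m → ∀ W → (∀ w → W w ≡ true → Child (r i j) w) →
      (∀ w w' → W w ≡ true → W w' ≡ true → Adj G w w' ≡ false) → suc (suc (count W)) ≤ n
    child-count {n} loc i (suc j) j0 jm W Wc Wi = ≤-trans (s≤s (count-insert W P x (λ w h → ∨-inl h) xW (∨-inr {W x} (==-refl x))))
      (indep-count loc (r i (suc j)) P edge ind')
      where
      x : V
      x = r i j
      P : V → Bool
      P w = W w ∨ (x == w)
      x-far : ∀ w → W w ≡ true → Far x w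
      x-far w h = child-far j0 jm (proj₁ (Wc w h)) (trans (proj₂ (Wc w h)) (cong suc (h-r i (suc j) jm))) i j (<⇒≤ jm) (inj₂ ≤-refl)
      xW : W x ≡ false
      xW = ¬true⇒false λ h → proj₂ (x-far x h) refl
      edge : ∀ w → P w ≡ true → E (r i (suc j)) w
      edge w h with ∨-case {W w} h
      ... | inj₁ a = proj₁ (Wc w a)
      ... | inj₂ e with refl ← ==⇒≡ {u = x} e = E-sym (adj (leg i) j jm)
      ind' : ∀ w w' → P w ≡ true → P w' ≡ true → Adj G w w' ≡ false
      ind' w w' a b with ∨-case {W w} a | ∨-case {W w'} b
      ... | inj₁ a' | inj₁ b' = Wi w w' a' b'
      ... | inj₁ a' | inj₂ e with refl ← ==⇒≡ {u = x} e = proj₁ (Far-sym (x-far w a'))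
      ... | inj₂ e | inj₁ b' with refl ← ==⇒≡ {u = x} e = proj₁ (x-far w' b')
      ... | inj₂ e | inj₂ e' with refl ← ==⇒≡ {u = x} e | refl ← ==⇒≡ {u = x} e' = irreflexive x

    top-off : ∀ {i w} → Child (r i m) w → on w ≡ false
    top-off {i} {w} (e , hw) = ¬true⇒false λ o →
      let (_ , jm , _) = on-height o hw in 1+n≰n (≤-trans (≤-reflexive (cong suc (sym (h-r i m ≤-refl)))) jm)

  module Extend (C : V → Set) (B : V → Bool) (x' : V)
    (B-child : ∀ w → B w ≡ true → C w) (x'-child : C x') (B-indep : ∀ w w' → B w ≡ true → B w' ≡ true → Adj G w w' ≡ false)
    (xB : B x' ≡ false) (child-split : ∀ {w} → C w → B w ≡ true ⊎ x' ≡ w) where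
    Indep : (V → Bool) → Set
    Indep W = ∀ w w' → W w ≡ true → W w' ≡ true → Adj G w w' ≡ false

    Max : Set
    Max = ∃ λ J → (∀ w → J w ≡ true → C w) × Indep J × (∀ W → (∀ w → W w ≡ true → C w) → Indep W → count W ≤ count J)

    -- If x' sees some w₀ in B, an independent set containing x' omits w₀, and trading x' for w₀
    -- yields an equally large subset of B. Otherwise x' can be added to B.
    pick : Dec (∃ λ w → B w ≡ true × E x' w) → Max
    pick (no none) = J , Jc , Ji , λ W Wc Wi → count-mono {P = W} {Q = J} λ w a →
        [ ∨-inl , (λ e → ∨-inr {B w} (subst (λ v → (x' == v) ≡ true) e (==-refl x'))) ]′ (child-split (Wc w a))
      where
      J : V → Bool
      J w = B w ∨ (x' == w)
      J-split : ∀ {w} → J w ≡ true → B w ≡ true ⊎ x' ≡ w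
      J-split {w} a = [ inj₁ , (λ e → inj₂ (==⇒≡ e)) ]′ (∨-case {B w} a)
      Jc : (∀ w → J w ≡ true → C w)
      Jc w a with J-split {w} a
      ... | inj₁ b = B-child w b
      ... | inj₂ refl = x'-child
      Ji : Indep J
      Ji w w' a b with J-split {w} a | J-split {w'} b
      ... | inj₁ c | inj₁ c' = B-indep w w' c c'
      ... | inj₁ c | inj₂ refl = ¬E⇒ λ e → none (w , c , E-sym e)
      ... | inj₂ refl | inj₁ c' = ¬E⇒ λ e → none (w' , c' , e)
      ... | inj₂ refl | inj₂ refl = irreflexive x'
    pick (yes (w₀ , b₀ , e₀)) = B , B-child , B-indep , bound
      where
      bound : ∀ W → (∀ w → W w ≡ true → C w) → Indep W → count W ≤ count B
      bound W Wc Wi with W x' 𝔹.≟ true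
      ... | no nx = count-mono {P = W} {Q = B} λ w a → [ id , (λ { refl → ⊥-elim (nx a) }) ]′ (child-split (Wc w a))
      ... | yes wx = ≤-trans (count-mono {P = W} {Q = λ w → W' w ∨ (x' == w)} sub)
            (≤-trans (count-∨ W' (x' ==_)) (≤-trans (≤-reflexive (trans (cong (count W' +_) (count-single x')) (+-comm _ 1)))
              (count-insert W' B w₀ W'B (¬true⇒false λ e → true≢false e₀ (Wi x' w₀ wx (∧-l e))) b₀)))
        where
        W' : V → Bool
        W' w = W w ∧ not (x' == w)
        sub : ∀ w → W w ≡ true → W' w ∨ (x' == w) ≡ true
        sub w a with x' 𝔽.≟ w
        ... | yes _ = ∨-inr {W w ∧ false} refl
        ... | no _ = ∨-inl (∧-in a refl)
        W'B : ∀ w → W' w ≡ true → B w ≡ true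
        W'B w a = [ id , (λ { refl → ⊥-elim (not-out (∧-r {W x'} a) (==-refl x')) }) ]′ (child-split (Wc w (∧-l a)))

    max-indep : Max
    max-indep = pick (𝔽.any? (λ w → (B w 𝔹.≟ true) ×-dec E? x' w))

  -- Bones formed by an induced path and a vertex attached to it

  module Setting (ν p₀ q : ℕ) (bones : ∀ i → 2 ≤ i → InducedCopy (bone i) G → (i ≡ suc (suc (suc p₀))) ⊎ (i ≡ q))
    (loc : LocalIndepBelow G (suc (suc (suc (suc ν))))) (con : Connected G) where

    -- The parameters `ν` = n - 4 and `p₀` = p - 3 absorb 3 < n and 3 ≤ p. Below, `p₁` = p - 1 is
    -- the last index of a path on p vertices.
    n p : ℕ
    n = suc (suc (suc (suc ν)))
    p = suc (suc (suc p₀))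

    p≥3 : 3 ≤ p
    p≥3 = s≤s (s≤s (s≤s z≤n))

    p₁ p₂ : ℕ
    p₁ = suc (suc p₀)
    p₂ = suc p₀

    Q : ℕ → Set
    Q i = (i ≡ p) ⊎ (i ≡ q)

    claw-path : ∀ {g m} → Ind g (suc m) → Leafy (g 0) → ∀ {b₁ b₂} → E (g (suc m)) b₁ → E (g (suc m)) b₂ → Far b₁ b₂ →
      (∀ j → j ≤ m → Far (g j) b₁) → (∀ j → j ≤ m → Far (g j) b₂) → Q (suc (suc m))
    claw-path I L e₁ e₂ b f₁ f₂ = bones _ (s≤s (s≤s z≤n)) (bone₁ I L e₁ e₂ b f₁ f₂)

    leafy-path : ∀ {g m} → Ind g (suc m) → Leafy (g 0) → Leafy (g (suc m)) → Q (suc (suc m))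
    leafy-path I L R = bones _ (s≤s (s≤s z≤n)) (bone₂ I L R)

    ind-const : ∀ z → Ind (λ _ → z) 0
    ind-const z = mkInd (λ j ()) λ { i j () z≤n }

    module _ {g : ℕ → V} {f : ℕ} (I : Ind g f) (L : Leafy (g 0)) where

      glue-0 : ∀ {h} → glue g f h 0 ≡ g 0
      glue-0 {h} = glue-l {g} {f} {h} z≤n

      -- There are three ways to complete a bone from a leafy start: `join` runs straight into a
      -- second path with a leafy end, `claw-at` stops in z with a claw, and `via` crosses z into a
      -- second path.
      join : ∀ {h e} → Ind h e → E (g f) (h 0) → (∀ i j → i ≤ f → j ≤ e → i < f ⊎ 0 < j → Far (g i) (h j)) →
        Leafy (h e) → Q (suc (suc (f + e)))
      join {h} {e} Ih lk cr R = leafy-path (ind-glue I Ih lk cr)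
        (subst Leafy (sym (glue-0 {h})) L) (subst Leafy (sym (glue-r {g} {f} {h} e)) R)

      module _ {z : V} (gz : E (g f) z) (gfar : ∀ i → i < f → Far (g i) z) where
        ext : Ind (glue g f (λ _ → z)) (suc f)
        ext = subst (Ind _) (cong suc (+-identityʳ f)) (ind-glue I (ind-const z) gz
          λ { i .0 i≤ z≤n (inj₁ lt) → gfar i lt ; i j i≤ z≤n (inj₂ ()) })

        ext-end : glue g f (λ _ → z) (suc f) ≡ z
        ext-end = trans (cong (glue g f (λ _ → z)) (cong suc (sym (+-identityʳ f)))) (glue-r {g} {f} {λ _ → z} 0)

        claw-at : ∀ {b₁ b₂} → E z b₁ → E z b₂ → Far b₁ b₂ → (∀ i → i ≤ f → Far (g i) b₁) → (∀ i → i ≤ f → Far (g i) b₂) →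
          Q (suc (suc f))
        claw-at {b₁} {b₂} e₁ e₂ bb f₁ f₂ = claw-path ext (subst Leafy (sym (glue-0 {λ _ → z})) L)
          (subst (λ x → E x b₁) (sym ext-end) e₁) (subst (λ x → E x b₂) (sym ext-end) e₂) bb
          (λ j jf → subst (λ x → Far x b₁) (sym (glue-l {g} {f} {λ _ → z} jf)) (f₁ j jf))
          (λ j jf → subst (λ x → Far x b₂) (sym (glue-l {g} {f} {λ _ → z} jf)) (f₂ j jf))

      via : ∀ {z h e} → E (g f) z → (∀ i → i < f → Far (g i) z) → Ind h e → E z (h 0) →
        (∀ j → 0 < j → j ≤ e → Far z (h j)) → (∀ i j → i ≤ f → j ≤ e → Far (g i) (h j)) → Leafy (h e) →
        Q (suc (suc (suc (f + e))))
      via {z} {h} {e} gz gfar Ih zh zfar cr R = leafy-path (ind-glue (ext gz gfar) Ih (subst (λ x → E x (h 0)) (sym (ext-end gz gfar)) zh) cr')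
        (subst Leafy (sym (trans (glue-l {glue g f (λ _ → z)} {suc f} {h} z≤n) (glue-0 {λ _ → z}))) L)
        (subst Leafy (sym (glue-r {glue g f (λ _ → z)} {suc f} {h} e)) R)
        where
        cr' : ∀ i j → i ≤ suc f → j ≤ e → i < suc f ⊎ 0 < j → Far (glue g f (λ _ → z) i) (h j)
        cr' i j i≤ je o with m≤n⇒m<n∨m≡n i≤
        ... | inj₁ lt = subst (λ x → Far x (h j)) (sym (glue-l {g} {f} {λ _ → z} (s≤s⁻¹ lt))) (cr i j (s≤s⁻¹ lt) je)
        ... | inj₂ refl = subst (λ x → Far x (h j)) (sym (ext-end gz gfar))
                (zfar j ([ (λ lt → ⊥-elim (<-irrefl refl lt)) , id ]′ o) je)

    -- The last neighbour of z on the path is l = N - k, so that k plays the part of f on the reversed path.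
    record Span (g : ℕ → V) (N : ℕ) (z : V) : Set where
      constructor mkSpan
      field
        f l k : ℕ
        f≤l : f ≤ l
        l+k : l + k ≡ N
        ef : E (g f) z
        el : E (g l) z
        lo : ∀ i → i < f → ¬ E (g i) z
        hi : ∀ i → l < i → i ≤ N → ¬ E (g i) z
      l≤N : l ≤ N
      l≤N = ≤-trans (m≤m+n l k) (≤-reflexive l+k)
      f≤N : f ≤ N
      f≤N = ≤-trans f≤l l≤N

    span : ∀ g N z i → i ≤ N → E (g i) z → Span g N z
    span g N z i iN e with least (λ j → Adj G (g j) z) i e
      | least (λ j → Adj G (g (N ∸ j)) z) (N ∸ i) (subst (λ x → E (g x) z) (sym (m∸[m∸n]≡n iN)) e)
    ... | f , fi , ef , lo | k , ki , ek , hi = mkSpan f (N ∸ k) k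
      (≤-trans fi (≤-trans (≤-reflexive (sym (m∸[m∸n]≡n iN))) (∸-monoʳ-≤ N ki)))
      (m∸n+n≡m (≤-trans ki (m∸n≤m N i))) ef ek (λ j lt h → true≢false h (lo j lt))
      (λ j lt jN h → true≢false (subst (λ x → E (g x) z) (sym (m∸[m∸n]≡n jN)) h)
        (hi (N ∸ j) (≤-trans (∸-monoʳ-< lt jN) (≤-reflexive (m∸[m∸n]≡n (≤-trans ki (m∸n≤m N i)))))))

    module Touch {g : ℕ → V} {N : ℕ} (I : Ind g N) (L₀ : Leafy (g 0)) (L₁ : Leafy (g N))
      {z : V} (out : ∀ i → i ≤ N → g i ≢ z) (S : Span g N z) where
      open Span S public

      far-lo : ∀ i → i < f → Far (g i) z
      far-lo i lt = ¬E⇒ (lo i lt) , out i (≤-trans (<⇒≤ lt) f≤N)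

      far-hi : ∀ i → l < i → i ≤ N → Far (g i) z
      far-hi i lt iN = ¬E⇒ (hi i lt iN) , out i iN

      far-next : ∀ {i j} → suc i < j → j ≤ N → Far (g i) (g j)
      far-next = far I _ _

      N∸k : N ∸ k ≡ l
      N∸k = trans (cong (_∸ k) (sym l+k)) (m+n∸n≡m l k)

      -- The first neighbour g f of z is the centre of a claw with ends g (f - 1), g (f + 1) and z;
      -- the path up to g f completes the bone.
      claw-lo : 0 < f → f < N → ¬ E (g (suc f)) z → Q (suc f)
      claw-lo (s≤s {n = f'} z≤n) fN ne = claw-path (ind-prefix I f≤N) L₀ ef (adj I f fN)
        (Far-sym (¬E⇒ ne , out (suc f) fN)) (λ j jf → far-lo j (s≤s jf)) (λ j jf → far-next (s≤s (s≤s jf)) fN)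

      rev : ℕ → V
      rev j = g (N ∸ j)

      I-rev : Ind rev N
      I-rev = ind-rev I

      leafy-rev₀ : Leafy (rev 0)
      leafy-rev₀ = L₁

      k≤N : k ≤ N
      k≤N = ≤-trans (m≤n+m k l) (≤-reflexive l+k)

      out-rev : ∀ i → i ≤ N → rev i ≢ z
      out-rev i _ = out (N ∸ i) (m∸n≤m N i)

      rev-span : Span rev N z
      rev-span = mkSpan k (N ∸ f) f (≤-trans (≤-reflexive (trans (sym (m+n∸m≡n l k)) (cong (_∸ l) l+k))) (∸-monoʳ-≤ N f≤l)) (m∸n+n≡m f≤N)
        (subst (λ x → E (g x) z) (sym N∸k) el) (subst (λ x → E (g x) z) (sym (m∸[m∸n]≡n f≤N)) ef)
        (λ i lt → hi (N ∸ i) (≤-trans (s≤s (≤-reflexive (sym N∸k))) (∸-monoʳ-< lt k≤N)) (m∸n≤m N i))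
        (λ i lt iN → lo (N ∸ i) (≤-trans (∸-monoʳ-< lt iN) (≤-reflexive (m∸[m∸n]≡n f≤N))))

      jump : suc f < l → Q (suc (suc (suc (f + k))))
      jump fl = via (ind-prefix I f≤N) L₀ ef far-lo (ind-shift I l k (≤-reflexive l+k))
        (subst (λ x → E z (g x)) (sym (+-identityʳ l)) (E-sym el))
        (λ j j0 jk → Far-sym (far-hi (l + j) (m<m+n l j0) (bound jk)))
        (λ i j if jk → far-next (≤-trans (s≤s (s≤s if)) (≤-trans fl (m≤m+n l j))) (bound jk))
        (subst (Leafy ∘ g) (sym l+k) L₁)
        where
        bound : ∀ {j} → j ≤ k → l + j ≤ N
        bound jk = ≤-trans (+-monoʳ-≤ l jk) (≤-reflexive l+k)

    module Touch² {g : ℕ → V} {N : ℕ} (I : Ind g N) (L₀ : Leafy (g 0)) (L₁ : Leafy (g N))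
      {z : V} (out : ∀ i → i ≤ N → g i ≢ z) (S : Span g N z) where
      open Touch I L₀ L₁ out S public
      leafy-rev₁ : Leafy (rev N)
      leafy-rev₁ = subst (λ x → Leafy (g x)) (sym (n∸n≡0 N)) L₀
      module TR = Touch I-rev leafy-rev₀ leafy-rev₁ out-rev rev-span

      claw-hi : f ≡ l → 0 < f → 0 < k → Q (suc k)
      claw-hi refl f0 k0 = TR.claw-lo k0 k<N (lo (N ∸ suc k) (≤-trans (∸-monoʳ-< ≤-refl k<N) (≤-reflexive N∸k)))
        where
        k<N : k < N
        k<N = ≤-trans (m<n+m k f0) (≤-reflexive l+k)

      claw-lo' : f ≡ l → 0 < f → 0 < k → Q (suc f)
      claw-lo' refl f0 k0 = claw-lo f0 (≤-trans (m<m+n f k0) (≤-reflexive l+k))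
        (hi (suc f) ≤-refl (≤-trans (m<m+n f k0) (≤-reflexive l+k)))

    module Attach₁ {g : ℕ → V} {N : ℕ} (I : Ind g N) (L₀ : Leafy (g 0)) (L₁ : Leafy (g N))
      {ζ : ℕ → V} {e : ℕ} (Iζ : Ind ζ e) (Lζ : Leafy (ζ e))
      (out : ∀ i → i ≤ N → g i ≢ ζ 0) (cross : ∀ i j → i ≤ N → 0 < j → j ≤ e → Far (g i) (ζ j))
      (S : Span g N (ζ 0)) where
      open Touch² I L₀ L₁ out S public

      reach-lo : Q (suc (suc (f + e)))
      reach-lo = join (ind-prefix I f≤N) L₀ Iζ ef (λ i j if je → λ
        { (inj₁ lt) → [ (λ { refl → far-lo i lt }) , (λ j0 → cross i j (≤-trans if f≤N) j0 je) ]′ (zero-or j)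
        ; (inj₂ j0) → cross i j (≤-trans if f≤N) j0 je }) Lζ

      -- The bone ends in z. For e = 0 the vertex z is leafy itself; otherwise ζ 1 and the distant
      -- path neighbour g l form its claw.
      wide-lo : suc f < l → Q (suc (suc f))
      wide-lo fl = [ (λ e0 → subst (λ x → Q (suc (suc x))) (trans (cong (f +_) e0) (+-identityʳ f)) reach-lo)
        , (λ pos → claw-at (ind-prefix I f≤N) L₀ ef far-lo (E-sym el) (adj Iζ 0 pos)
          (cross l 1 l≤N (s≤s z≤n) pos) (λ i if → far-next (≤-trans (s≤s (s≤s if)) fl) l≤N)
          (λ i if → cross i 1 (≤-trans if f≤N) (s≤s z≤n) pos)) ]′ (zero-or e)

    module Attach {g : ℕ → V} {N : ℕ} (I : Ind g N) (L₀ : Leafy (g 0)) (L₁ : Leafy (g N))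
      {ζ : ℕ → V} {e : ℕ} (Iζ : Ind ζ e) (Lζ : Leafy (ζ e))
      (out : ∀ i → i ≤ N → g i ≢ ζ 0) (cross : ∀ i j → i ≤ N → 0 < j → j ≤ e → Far (g i) (ζ j))
      (S : Span g N (ζ 0)) where
      module F = Attach₁ I L₀ L₁ Iζ Lζ out cross S
      open F public
      module R = Attach₁ I-rev leafy-rev₀ leafy-rev₁ Iζ Lζ out-rev
        (λ i j iN → cross (N ∸ i) j (m∸n≤m N i)) rev-span

      reach-hi : Q (suc (suc (k + e)))
      reach-hi = R.reach-lo

      wide-hi : suc f < l → Q (suc (suc k))
      wide-hi fl = R.wide-lo (m+n≤o⇒m≤o∸n (suc (suc k)) (≤-trans (≤-reflexive (cong (λ x → suc (suc x)) (+-comm k f)))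
        (≤-trans (+-monoˡ-≤ k fl) (≤-reflexive l+k))))
    module Ar = Arith p q p≥3

    -- Every vertex other than r is on level 1, so only r has children: at most n - 1 independent
    -- ones, of which one is matched with r.
    near-bound : ∀ {d} → Def G d → (r : V) → (∀ v → Levels.lv (r ==_) (λ v → r , ==-refl r , proj₂ con r v) v ≤ 1) → d ≤ suc (suc ν)
    near-bound D r near = ≤-trans (Process.process-bound sim lv r (λ v e → sym (==⇒≡ (S-lv e))) parent (point r (suc (suc ν)))
        (≤-trans (s≤s z≤n) (≤-reflexive (sym (point-self r _)))) ch D) (≤-reflexive (sumF-point r _))
      where
      open Levels (r ==_) (λ v → r , ==-refl r , proj₂ con r v)
      ch : ∀ u (W : V → Bool) → (∀ w → W w ≡ true → Adj G u w ≡ true × lv w ≡ suc (lv u)) →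
        (∀ w w' → W w ≡ true → W w' ≡ true → Adj G w w' ≡ false) → count W ≤ suc (point r (suc (suc ν)) u)
      ch u W Wc Wi with r 𝔽.≟ u
      ... | yes refl = s≤s⁻¹ (indep-count loc r W (λ w h → proj₁ (Wc w h)) Wi)
      ... | no ne = count≤1 W λ w w' h _ → ⊥-elim (ne (==⇒≡ (S-lv (n≤0⇒n≡0
              (s≤s⁻¹ (≤-trans (≤-reflexive (sym (proj₂ (Wc w h)))) (near w)))))))

    -- All leafy vertices on one induced path

    module PathCase {d : ℕ} (crit : DeficiencyCritical G) (D : Def G d) {g : ℕ → V} {N : ℕ} (I : Ind g N)
      (L₀ : Leafy (g 0)) (N<q : suc N ≤ q) (all : ∀ u → Leafy u → ∃ λ j → j ≤ N × g j ≡ u) where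

      -- A path is a spider with one leg, rooted at its first vertex, which makes `two-legs`
      -- vacuous.
      sp : Spider 1 N
      sp = mkSpider (g 0) (λ _ → g) (λ _ → refl) (λ _ → I) (λ { {zero} {zero} ne → ⊥-elim (ne refl) })

      module Sp = Spider sp

      open Outer Sp.on (λ v → g 0 , Sp.on-r zero 0 z≤n , proj₂ con (g 0) v) (g 0) (Sp.on-r zero 0 z≤n) Sp.on-connected crit D

      abstract
        all-on : ∀ u → Leafy u → Sp.on u ≡ true
        all-on u L = let (j , jN , e) = all u L in subst (λ x → Sp.on x ≡ true) e (Sp.on-r zero j jN)

      one-leg : ∀ v → Sp.on v ≡ false → ∀ (a b : Fin 1) → a ≢ b → ∀ j j' → 0 < j → j ≤ N → 0 < j' → j' ≤ N →
        E (g j) v → E (g j') v → E (g 0) v × j ≤ 1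
      one-leg v _ zero zero ne = ⊥-elim (ne refl)

      open Skeleton sp (outer-nbr all-on) (outer-indep all-on) one-leg public

      Indep : (V → Bool) → Set
      Indep W = ∀ w w' → W w ≡ true → W w' ≡ true → Adj G w w' ≡ false

      Children : V → (V → Bool) → Set
      Children u W = ∀ w → W w ≡ true → Child u w

      far-child : ∀ {j w} → 0 < j → j ≤ N → Child (g j) w → ∀ i → i < j → Far (g i) w
      far-child {j} j0 jN (e , hw) i lt = child-far {zero} j0 jN e (trans hw (cong suc (h-r zero j jN))) zero i (≤-trans (<⇒≤ lt) jN) (inj₂ lt)

      branch : ∀ {j w w'} → j < N → Child (g (suc j)) w → Child (g (suc j)) w' → Far w w' → Q (suc (suc j))
      branch {j} jN c c' f = claw-path (ind-prefix I jN) L₀ (proj₁ c) (proj₁ c') f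
        (λ i ij → far-child (s≤s z≤n) jN c i (s≤s ij)) (λ i ij → far-child (s≤s z≤n) jN c' i (s≤s ij))

      -- By `branch`, two far children occur only at the indices p - 1 and q - 1, and the latter can
      -- only be the end of the path. The costs w₁, w₂ stay free: n - 3 gives the upper bound, and
      -- the actual numbers of children show what equality forces.
      path-bound : ∀ w₁ w₂ →
        (suc (suc p₀) < N → ∀ W → Children (g (suc (suc p₀))) W → Indep W → count W ≤ suc w₁) →
        (∀ W → Children (g N) W → Indep W → count W ≤ suc w₂) → d ≤ suc (suc ν) + w₁ + w₂
      path-bound w₁ w₂ h₁ h₂ = ≤-trans (skeleton-bound loc D cost (≤-trans (s≤s z≤n) root-cost) (s≤s (s≤s root-cost)) inner) (≤-reflexive total)
        where
        cost : V → ℕ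
        cost = points₃ (g 0) (g (suc (suc p₀))) (g N) (suc (suc ν)) w₁ w₂
        total : sumF cost ≡ suc (suc ν) + w₁ + w₂
        total = sumF-points₃ (g 0) (g (suc (suc p₀))) (g N) (suc (suc ν)) w₁ w₂
        root-cost : suc (suc ν) ≤ cost (g 0)
        root-cost = points₃-1 (g 0) (g (suc (suc p₀))) (g N) (suc (suc ν)) w₁ w₂
        inner : ∀ i j → 0 < j → j ≤ N → ∀ W → Children (g j) W → Indep W → count W ≤ suc (cost (g j))
        inner i (suc j) j0 jN W Wc Wi = dec-elim (suc j ≟ N)
          (λ e → ≤-trans (h₂ W (subst (λ x → Children (g x) W) e Wc) Wi)
            (s≤s (subst (λ x → w₂ ≤ cost (g x)) (sym e) (points₃-3 (g 0) (g (suc (suc p₀))) (g N) (suc (suc ν)) w₁ w₂))))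
          λ ne → dec-elim (j ≟ suc p₀)
            (λ e → ≤-trans (h₁ (subst (λ x → suc x < N) e (≤∧≢⇒< jN ne)) W (subst (λ x → Children (g (suc x)) W) e Wc) Wi)
              (s≤s (subst (λ x → w₁ ≤ cost (g (suc x))) (sym e) (points₃-2 (g 0) (g (suc (suc p₀))) (g N) (suc (suc ν)) w₁ w₂))))
            λ ne' → ≤-trans (count≤1 W (λ w w' a b → dec-elim (w 𝔽.≟ w') id λ ww' → ⊥-elim
                ([ (λ e → ne' (suc-injective (suc-injective e))) , (λ e → ne (≤-antisym jN (s≤s⁻¹ (≤-trans N<q (≤-reflexive (sym e)))))) ]′
                  (branch jN (Wc w a) (Wc w' b) (Wi w w' a b , ww'))))) (s≤s z≤n)

      child-≤ : ∀ j → 0 < j → j ≤ N → ∀ W → Children (g j) W → Indep W → count W ≤ suc (suc ν)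
      child-≤ j j0 jN W Wc Wi = s≤s⁻¹ (s≤s⁻¹ (child-count loc zero j j0 jN W Wc Wi))

      path-bound' : 0 < N → d ≤ suc (suc ν) + suc ν + suc ν
      path-bound' N0 = path-bound (suc ν) (suc ν) (λ lt → child-≤ _ (s≤s z≤n) (<⇒≤ lt)) (child-≤ N N0 ≤-refl)

      top-leaf : 0 < N → ∀ {w} → childB (g N) w ≡ true → ∀ v → E v w → v ≡ g N
      top-leaf N0 {w} c v e with on-or-off v
      ... | inj₂ o = ⊥-elim (true≢false e (outer-indep all-on v w o (top-off {zero} (childB-out w c))))
      ... | inj₁ o with on-out o
      ... | zero , j , jN , refl with m≤n⇒m<n∨m≡n jN
      ... | inj₁ lt = ⊥-elim (Far-E (far-child N0 ≤-refl (childB-out w c) j lt) e)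
      ... | inj₂ refl = refl

      -- The children off the path are independent, but the next path vertex may be adjacent to some
      -- of them. The middle vertices of T have to be independent, so a largest independent set of
      -- children is taken.
      max-children : ∀ j → suc j ≤ N → ∃ λ J → Children (g j) J × Indep J × (∀ W → Children (g j) W → Indep W → count W ≤ count J)
      max-children j jN = Extend.max-indep (Child (g j)) B x'
          (λ w e → childB-out w (∧-r {not (on w)} e)) x'-child (λ w w' a b → outer-indep all-on w w' (B-off {w} a) (B-off {w'} b))
          (¬true⇒false λ e → true≢false (on-r zero (suc j) jN) (B-off {x'} e))
          (λ {w} c → [ (λ o → inj₂ (trans (cong g (cong suc (sym (h-r zero j (<⇒≤ jN))))) (proj₂ (proj₂ (on-height o (proj₂ c))))))
                     , (λ o → inj₁ (∧-in (not-in (λ t → true≢false t o)) (childB-in c))) ]′ (on-or-off w))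
        where
        x' : V
        x' = g (suc j)
        B : V → Bool
        B w = not (on w) ∧ childB (g j) w
        B-off : ∀ {w} → B w ≡ true → on w ≡ false
        B-off e = ¬true⇒false (not-out (∧-l e))
        x'-child : Child (g j) x'
        x'-child = adj I j jN , trans (h-r zero (suc j) jN) (cong suc (sym (h-r zero j (<⇒≤ jN))))

      module _ (N0 : 0 < N) (tight : d ≡ suc (suc ν) + suc ν + suc ν) where
        -- With the actual number of children in the place of one n - 3, the bound still has to
        -- reach d; so that number is at least n - 2.
        top-large : suc (suc ν) ≤ count (childB (g N))
        top-large = pred-large (+-cancelˡ-≤ (suc (suc ν) + suc ν) _ _ (≤-trans (≤-reflexive (sym tight))
            (path-bound (suc ν) (count (childB (g N)) ∸ 1) (λ lt → child-≤ _ (s≤s z≤n) (<⇒≤ lt))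
              (λ W Wc _ → ≤-trans (count-mono {P = W} {Q = childB (g N)} (λ w a → childB-in (Wc w a))) (≤-suc-pred _)))))

        mid-large : (lt : suc (suc p₀) < N) → suc (suc ν) ≤ count (proj₁ (max-children (suc (suc p₀)) lt))
        mid-large lt = pred-large (+-cancelˡ-≤ (suc (suc ν)) _ _ (+-cancelʳ-≤ (suc ν) _ _ (≤-trans (≤-reflexive (sym tight))
            (path-bound (count (proj₁ M) ∸ 1) (suc ν) (λ _ W Wc Wi → ≤-trans (proj₂ (proj₂ (proj₂ M)) W Wc Wi) (≤-suc-pred _))
              (child-≤ N N0 ≤-refl)))))
          where
          M = max-children (suc (suc p₀)) lt

      mid-on : ∀ {j} → suc j ≤ N → ∀ {w} → Child (g j) w → w ≡ g (suc j) ⊎ (∀ i → i ≤ N → g i ≢ w)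
      mid-on {j} jN {w} c = [ (λ o → inj₁ (sym (trans (cong g (cong suc (sym (h-r zero j (<⇒≤ jN))))) (proj₂ (proj₂ (on-height o (proj₂ c)))))))
        , (λ o → inj₂ (off-≢ o zero)) ]′ (on-or-off w)

      Listed : (V → Set) → Set
      Listed P = ∃ λ (e : ℕ → V) → (∀ i → i < suc (suc ν) → P (e i)) × (∀ i j → i < suc (suc ν) → j < suc (suc ν) → e i ≡ e j → i ≡ j)

      tip-leaves : 0 < N → d ≡ suc (suc ν) + suc ν + suc ν →
        Listed (λ w → E (g N) w × (∀ v → E v w → v ≡ g N) × (∀ j → j ≤ N → w ≢ g j))
      tip-leaves N0 tight = let (e , P , inj) = pickℕ (childB (g N)) (suc (suc ν)) (top-large N0 tight) (g 0) in
        e , (λ i lt → proj₁ (childB-out _ (P i lt)) , top-leaf N0 (P i lt) , λ j jN eq → off-≢ (top-off {zero} (childB-out _ (P i lt))) zero j jN (sym eq)) , inj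

      mid-list : suc (suc p₀) < N → d ≡ suc (suc ν) + suc ν + suc ν → ∃ λ (e : ℕ → V) →
        (∀ i → i < suc (suc ν) → E (g (suc (suc p₀))) (e i) × (∀ j → j < suc (suc p₀) → Far (g j) (e i)) ×
           (e i ≡ g p ⊎ (∀ j → j ≤ N → g j ≢ e i))) ×
        (∀ i j → i < suc (suc ν) → j < suc (suc ν) → Adj G (e i) (e j) ≡ false) ×
        (∀ i j → i < suc (suc ν) → j < suc (suc ν) → e i ≡ e j → i ≡ j)
      mid-list lt tight = let (e , P , inj) = pickℕ (proj₁ M) (suc (suc ν)) (mid-large (≤-trans (s≤s z≤n) lt) tight lt) (g 0) in
        e , (λ i il → let c = proj₁ (proj₂ M) _ (P i il) in proj₁ c , far-child (s≤s z≤n) (<⇒≤ lt) c , mid-on lt c)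
          , (λ i j il jl → proj₁ (proj₂ (proj₂ M)) _ _ (P i il) (P j jl)) , inj
        where
        M = max-children (suc (suc p₀)) lt

    -- If a child of g (p - 1) missed g (p + 1), a second child would complete a bone on p + 1 or p + 2 vertices.
    module Mids {g : ℕ → V} {N : ℕ} (I : Ind g N) (L₀ : Leafy (g 0)) (L₁ : Leafy (g N))
      (pN : p + p ≡ N) (qp : q ≡ suc (p + p)) where

      record MidSpan (w : V) : Set where
        field
          l : ℕ
          l-cases : l ≡ p ⊎ l ≡ suc p
          el : E (g l) w
          hi : ∀ i → l < i → i ≤ N → Far (g i) w

      -- The first neighbour of w on the path is g (p - 1). If it is the only one, a claw from the
      -- far end gives p + 2 path vertices; if the last neighbour is beyond g p, crossing at w gives
      -- a path on 2p + 1 vertices only for l = p + 1.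
      mid-span : ∀ w → E (g p₁) w → (∀ i → i < p₁ → Far (g i) w) → (∀ i → i ≤ N → g i ≢ w) → MidSpan w
      mid-span w ew lo-far out = record { l = l ; l-cases = cases ; el = el ; hi = far-hi }
        where
        p₁N : p₁ ≤ N
        p₁N = ≤-trans (n≤1+n p₁) (≤-trans (m≤m+n p p) (≤-reflexive pN))
        Sw : Span g N w
        Sw = span g N w p₁ p₁N ew
        open Touch² I L₀ L₁ out Sw
        f≡ : suc f ≡ p
        f≡ = cong suc (≤-antisym (≮⇒≥ λ lt → lo p₁ lt ew) (≮⇒≥ λ lt → Far-E (lo-far f lt) ef))
        cases : l ≡ p ⊎ l ≡ suc p
        cases with m≤n⇒m<n∨m≡n f≤l
        ... | inj₂ e = ⊥-elim (bad (claw-hi e (s≤s⁻¹ (≤-trans (s≤s (s≤s z≤n)) (ge f≡))) k0))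
          where
          fl : f ≡ l
          fl = e
          k0 : 0 < k
          k0 = ≮⇒≥ λ lt → refute (k ∷ l ∷ f ∷ N ∷ p ∷ []) (K 1 ⊞ X 0 ⊞ X 1 ⊞ (K 1 ⊞ X 2) ⊞ X 3 ⊞ (X 4 ⊞ X 4)) (K 1 ⊞ X 2 ⊞ X 4 ⊞ (X 1 ⊞ X 0) ⊞ X 3) (lt ⊕ ge fl ⊕ le f≡ ⊕ ge l+k ⊕ le pN) refl
          bad : Q (suc k) → ⊥
          bad (inj₁ a) = refute (k ∷ l ∷ f ∷ N ∷ p ∷ []) (K 1 ⊞ X 0 ⊞ X 1 ⊞ (K 1 ⊞ X 2) ⊞ X 3 ⊞ (X 4 ⊞ X 4)) (X 4 ⊞ X 2 ⊞ X 4 ⊞ (X 1 ⊞ X 0) ⊞ X 3) (le a ⊕ ge fl ⊕ le f≡ ⊕ ge l+k ⊕ le pN) refl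
          bad (inj₂ a) = refute (q ∷ p ∷ f ∷ l ∷ k ∷ N ∷ []) (X 0 ⊞ (K 1 ⊞ (X 1 ⊞ X 1)) ⊞ X 2 ⊞ X 1 ⊞ (X 3 ⊞ X 4) ⊞ X 5 ⊞ K 3) (K 1 ⊞ X 4 ⊞ X 0 ⊞ X 3 ⊞ (K 1 ⊞ X 2) ⊞ X 5 ⊞ (X 1 ⊞ X 1) ⊞ X 1) (ge a ⊕ ge qp ⊕ le fl ⊕ ge f≡ ⊕ le l+k ⊕ ge pN ⊕ p≥3) refl
        ... | inj₁ lt with m≤n⇒m<n∨m≡n lt
        ... | inj₂ e = inj₁ (trans (sym e) f≡)
        ... | inj₁ fl = inj₂ (fin (jump fl))
          where
          fin : Q (suc (suc (suc (f + k)))) → l ≡ suc p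
          fin (inj₁ a) = ⊥-elim (refute (f ∷ k ∷ p ∷ []) (K 3 ⊞ (X 0 ⊞ X 1) ⊞ X 2) (X 2 ⊞ (K 1 ⊞ X 0)) (le a ⊕ ge f≡) refl)
          fin (inj₂ a) = ≤-antisym (≮⇒≥ λ lt → refute (p ∷ q ∷ f ∷ l ∷ k ∷ N ∷ []) (K 1 ⊞ (K 1 ⊞ X 0) ⊞ X 1 ⊞ (K 1 ⊞ (X 0 ⊞ X 0)) ⊞ (K 1 ⊞ X 2) ⊞ (X 3 ⊞ X 4) ⊞ X 5) (X 3 ⊞ (K 3 ⊞ (X 2 ⊞ X 4)) ⊞ X 1 ⊞ X 0 ⊞ X 5 ⊞ (X 0 ⊞ X 0)) (lt ⊕ ge a ⊕ ge qp ⊕ le f≡ ⊕ le l+k ⊕ ge pN) refl)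
                                   (≮⇒≥ λ lt → refute (l ∷ f ∷ k ∷ q ∷ p ∷ N ∷ []) (K 1 ⊞ X 0 ⊞ (K 3 ⊞ (X 1 ⊞ X 2)) ⊞ X 3 ⊞ X 4 ⊞ X 5 ⊞ (X 4 ⊞ X 4)) (K 1 ⊞ X 4 ⊞ X 3 ⊞ (K 1 ⊞ (X 4 ⊞ X 4)) ⊞ (K 1 ⊞ X 1) ⊞ (X 0 ⊞ X 2) ⊞ X 5) (lt ⊕ le a ⊕ le qp ⊕ ge f≡ ⊕ ge l+k ⊕ le pN) refl)

      module Rev where
        rg : ℕ → V
        rg j = g (N ∸ j)
        rg-Ind : Ind rg N
        rg-Ind = ind-rev I
        rg-index : ∀ {a b} → a + b ≡ N → rg a ≡ g b
        rg-index {a} {b} e = cong g (trans (cong (_∸ a) (sym e)) (m+n∸m≡n a b))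
      open Rev

      p≤N : p ≤ N
      p≤N = ≤-trans (m≤m+n p p) (≤-reflexive pN)

      below-p : ∀ {i} → i < p → suc p ≤ N ∸ i
      below-p {i} ip = m+n≤o⇒m≤o∸n (suc p) (≤-trans (≤-reflexive (sym (+-suc p i))) (≤-trans (+-monoʳ-≤ p ip) (≤-reflexive pN)))

      module Pair (w w' : V) (ew : E (g p₁) w) (lw : ∀ i → i < p₁ → Far (g i) w) (ow : ∀ i → i ≤ N → g i ≢ w)
        (ew' : E (g p₁) w') (lw' : ∀ i → i < p₁ → Far (g i) w') (ow' : w' ≡ g p ⊎ (∀ i → i ≤ N → g i ≢ w'))
        (ww : Far w w') where
        private
          Sm = mid-span w ew lw ow
          module Sm = MidSpan Sm

        rg-p : rg p ≡ g p
        rg-p = rg-index {p} {p} pN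

        not-p : Sm.l ≡ p → ⊥
        not-p lp = [ (λ { refl → Far-E ww (E-sym ewp) }) , other ]′ ow'
          where
          ewp : E (g p) w
          ewp = subst (λ x → E (g x) w) lp Sm.el
          w-hi : ∀ i → p < i → i ≤ N → Far (g i) w
          w-hi i lt = Sm.hi i (≤-trans (≤-reflexive (cong suc lp)) lt)
          other : (∀ i → i ≤ N → g i ≢ w') → ⊥
          other out = [ same , further ]′ S'.l-cases
            where
            module S' = MidSpan (mid-span w' ew' lw' out)
            same : S'.l ≡ p → ⊥
            same lp' = [ (λ a → refute (p ∷ []) (K 1 ⊞ X 0) (X 0) (le a) refl) , (λ a → refute (q ∷ p ∷ []) (X 0 ⊞ (K 1 ⊞ (X 1 ⊞ X 1)) ⊞ K 3) (K 1 ⊞ X 1 ⊞ X 0 ⊞ X 1) (ge a ⊕ ge qp ⊕ p≥3) refl) ]′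
              (claw-path (ind-prefix rg-Ind p≤N) L₁ (subst (λ x → E x w) (sym rg-p) ewp)
                (subst (λ x → E x w') (sym rg-p) (subst (λ x → E (g x) w') lp' S'.el)) ww
                (λ j jp → w-hi (N ∸ j) (below-p (s≤s jp)) (m∸n≤m N j))
                (λ j jp → S'.hi (N ∸ j) (≤-trans (≤-reflexive (cong suc lp')) (below-p (s≤s jp))) (m∸n≤m N j)))
            -- The path comes down from the far end to g (p + 1), crosses w' to g (p - 1), and forks
            -- there into w and g (p - 2).
            further : S'.l ≡ suc p → ⊥
            further lp' = [ (λ a → refute (p ∷ []) (K 2 ⊞ X 0) (X 0) (le a) refl) , (λ a → refute (q ∷ p ∷ []) (X 0 ⊞ (K 1 ⊞ (X 1 ⊞ X 1)) ⊞ K 3) (K 2 ⊞ X 1 ⊞ X 0 ⊞ X 1) (ge a ⊕ ge qp ⊕ p≥3) refl) ]′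
              (claw-at Ipath Lpath (subst (λ x → E x (g p₁)) (sym path-end) (E-sym ew')) path-far
                ew (E-sym (adj I (suc p₀) p₁≤N)) (Far-sym (lw (suc p₀) ≤-refl))
                (path-all (λ i ip → w-hi (N ∸ i) (below-p ip) (m∸n≤m N i)) (Far-sym ww))
                (path-all (λ i ip → Far-sym (far I (suc p₀) (N ∸ i) (≤-trans (n≤1+n _) (below-p ip)) (m∸n≤m N i))) (Far-sym (lw' (suc p₀) ≤-refl))))
              where
              p₁≤N : p₁ ≤ N
              p₁≤N = ≤-trans (n≤1+n p₁) p≤N
              rg-p₁ : rg p₁ ≡ g (suc p)
              rg-p₁ = rg-index {p₁} {suc p} (trans (+-suc p₁ p) pN)
              e₁ : E (rg p₁) w'
              e₁ = subst (λ x → E x w') (sym rg-p₁) (subst (λ x → E (g x) w') lp' S'.el)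
              f₁ : ∀ i → i < p₁ → Far (rg i) w'
              f₁ i lt = S'.hi (N ∸ i) (≤-trans (≤-reflexive (cong suc lp')) (m+n≤o⇒m≤o∸n (suc (suc p))
                  (≤-trans (≤-reflexive (cong suc (sym (+-suc p i)))) (≤-trans (≤-reflexive (sym (+-suc p (suc i)))) (≤-trans (+-monoʳ-≤ p (s≤s lt)) (≤-reflexive pN)))))) (m∸n≤m N i)
              path : ℕ → V
              path = glue rg p₁ (λ _ → w')
              Ipath : Ind path p
              Ipath = ext (ind-prefix rg-Ind p₁≤N) L₁ e₁ f₁
              path-end : path p ≡ w'
              path-end = ext-end (ind-prefix rg-Ind p₁≤N) L₁ e₁ f₁
              Lpath : Leafy (path 0)
              Lpath = subst Leafy (sym (glue-l {rg} {p₁} {λ _ → w'} z≤n)) L₁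
              path-far : ∀ i → i < p → Far (path i) (g p₁)
              path-far i lt = subst (λ x → Far x (g p₁)) (sym (glue-l {rg} {p₁} {λ _ → w'} (s≤s⁻¹ lt)))
                (Far-sym (far I p₁ (N ∸ i) (below-p lt) (m∸n≤m N i)))
              path-all : ∀ {b} → (∀ i → i < p → Far (rg i) b) → Far w' b → ∀ i → i ≤ p → Far (path i) b
              path-all {b} h hw i ip = [ (λ lt → subst (λ x → Far x b) (sym (glue-l {rg} {p₁} {λ _ → w'} (s≤s⁻¹ lt))) (h i lt))
                , (λ { refl → subst (λ x → Far x b) (sym path-end) hw }) ]′ (m≤n⇒m<n∨m≡n ip)

        both-sides : E (g (suc p)) w × (∀ i → i ≤ N → suc p < i → Far (g i) w)
        both-sides = [ (λ e → ⊥-elim (not-p e)) , (λ e → subst (λ x → E (g x) w) e Sm.el , λ i iN lt → Sm.hi i (subst (_< i) (sym e) lt) iN) ]′ Sm.l-cases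

    module TightPath {d : ℕ} (crit : DeficiencyCritical G) (D : Def G d)
      {g : ℕ → V} {N : ℕ} (I : Ind g N) (L₀ : Leafy (g 0)) (L₁ : Leafy (g N))
      (N<q : suc N ≤ q) (all : ∀ u → Leafy u → ∃ λ j → j ≤ N × g j ≡ u)
      (pN : p + p ≡ N) (qp : q ≡ suc (p + p)) (tight : d ≡ suc (suc ν) + suc ν + suc ν) where
      private
        k : ℕ
        k = suc (suc ν)

      open Mids.Rev I L₀ L₁ pN qp

      N0 : 0 < N
      N0 = ≤-trans (s≤s z≤n) (≤-reflexive pN)

      p≤N : p ≤ N
      p≤N = ≤-trans (m≤m+n p p) (≤-reflexive pN)

      p₁<N : p₁ < N
      p₁<N = p≤N

      all-rev : ∀ u → Leafy u → ∃ λ j → j ≤ N × rg j ≡ u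
      all-rev u L = let (j , jN , e) = all u L in N ∸ j , m∸n≤m N j , trans (cong g (m∸[m∸n]≡n jN)) e

      Tip : (ℕ → V) → Set
      Tip γ = ∃ λ (e : ℕ → V) → (∀ i → i < k → E (γ N) (e i) × (∀ v → E v (e i) → v ≡ γ N) × (∀ j → j ≤ N → e i ≢ γ j)) ×
        (∀ i j → i < k → j < k → e i ≡ e j → i ≡ j)

      Mid : V → Set
      Mid w = E (g p₁) w × (∀ j → j < p₁ → Far (g j) w) × (w ≡ g p ⊎ (∀ j → j ≤ N → g j ≢ w))

      abstract
        tip₁ : Tip g
        tip₁ = PathCase.tip-leaves crit D I L₀ N<q all N0 tight

        tip₀ : Tip rg
        tip₀ = PathCase.tip-leaves crit D rg-Ind L₁ N<q all-rev N0 tight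

        mids : ∃ λ (e : ℕ → V) → (∀ i → i < k → Mid (e i)) × (∀ i j → i < k → j < k → Adj G (e i) (e j) ≡ false) ×
          (∀ i j → i < k → j < k → e i ≡ e j → i ≡ j)
        mids = PathCase.mid-list crit D I L₀ N<q all p₁<N tight

      -- The path has 2p + 1 vertices. Its vertices g (p - 1) and g (p + 1) become the two vertices
      -- of degree k, and g p may be one of the μ. The pendants λα come from the reversed path.
      μ λα λβ α β : ℕ → V
      μ = proj₁ mids
      λα = proj₁ tip₀
      λβ = proj₁ tip₁
      α j = g (p₁ ∸ j)
      β j = g (suc p + j)

      rgN : rg N ≡ g 0
      rgN = cong g (n∸n≡0 N)

      other : ∀ i → i < k → ∃ λ i' → i' < k × i ≢ i'
      other zero _ = 1 , s≤s (s≤s z≤n) , λ ()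
      other (suc i) _ = 0 , s≤s z≤n , λ ()

      -- A middle vertex is pinned down only in company of a second one; `other` supplies it, since
      -- k = n - 2 is at least 2.
      both : ∀ {w w'} → Mid w → Mid w' → Far w w' → E (g (suc p)) w × (∀ j → j ≤ N → suc p < j → Far (g j) w)
      both (e , lo , inj₁ refl) _ _ = E-sym (adj I p (≤-trans (s≤s (m≤m+n p _)) (≤-trans (≤-reflexive (sym (+-suc p p₁))) (≤-reflexive pN)))) ,
          λ j jN lt → Far-sym (far I p j lt jN)
      both {w} {w'} (e , lo , inj₂ off) (e' , lo' , o') ww =
        Mids.Pair.both-sides I L₀ L₁ pN qp w w' e lo off e' lo' o' ww

      μ-both : ∀ i → i < k → E (g (suc p)) (μ i) × (∀ j → j ≤ N → suc p < j → Far (g j) (μ i))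
      μ-both i il = let (i' , il' , ne) = other i il in both (proj₁ (proj₂ mids) i il) (proj₁ (proj₂ mids) i' il')
        (proj₁ (proj₂ (proj₂ mids)) i i' il il' , λ eq → ne (proj₂ (proj₂ (proj₂ mids)) i i' il il' eq))

      bN : ∀ {j} → j ≤ p₁ → suc p + j ≤ N
      bN {j} jp = ≤-trans (≤-reflexive (sym (+-suc p j))) (≤-trans (+-monoʳ-≤ p (s≤s jp)) (≤-reflexive pN))

      aN : ∀ j → p₁ ∸ j ≤ N
      aN j = ≤-trans (m∸n≤m p₁ j) (<⇒≤ p₁<N)

      βend : β p₁ ≡ g N
      βend = cong g (trans (sym (+-suc p p₁)) pN)

      αend : α p₁ ≡ rg N
      αend = trans (cong g (n∸n≡0 p₁)) (sym rgN)

      embedded : InducedCopy (T k p) G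
      embedded = TGraph.TEmbed.T-embedding k (suc p₀) sim α β μ λα λβ
        (ind-rev (ind-prefix I (<⇒≤ p₁<N))) (ind-shift I (suc p) p₁ (bN ≤-refl))
        (λ i j ip jp → far I (p₁ ∸ i) (suc p + j) (s≤s (≤-trans (s≤s (m∸n≤m p₁ i)) (m≤m+n p j))) (bN jp))
        (λ m lt → proj₁ (proj₁ (proj₂ mids) m lt))
        (λ m lt → subst (λ x → E (g (suc x)) (μ m)) (sym (+-identityʳ p)) (proj₁ (μ-both m lt)))
        (λ m j lt j0 jp → Far-sym (proj₁ (proj₂ (proj₁ (proj₂ mids) m lt)) (p₁ ∸ j) (∸-monoʳ-< {p₁} j0 jp)))
        (λ m j lt j0 jp → Far-sym (proj₂ (μ-both m lt) (suc p + j) (bN jp) (m<m+n (suc p) j0)))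
        (proj₁ (proj₂ (proj₂ mids))) (proj₂ (proj₂ (proj₂ mids)))
        (λ r lt → subst (λ x → E x (λα r)) (sym αend) (proj₁ (proj₁ (proj₂ tip₀) r lt)))
        (λ r lt → subst (λ x → E x (λβ r)) (sym βend) (proj₁ (proj₁ (proj₂ tip₁) r lt)))
        (λ r lt u e → trans (proj₁ (proj₂ (proj₁ (proj₂ tip₀) r lt)) u e) (sym αend))
        (λ r lt u e → trans (proj₁ (proj₂ (proj₁ (proj₂ tip₁) r lt)) u e) (sym βend))
        (proj₂ (proj₂ tip₀)) (proj₂ (proj₂ tip₁))
        (λ r j lt _ → off₀ r lt (p₁ ∸ j) (aN j)) (λ r j lt jp → off₀ r lt (suc p + j) (bN jp))
        (λ r j lt _ → proj₂ (proj₂ (proj₁ (proj₂ tip₁) r lt)) (p₁ ∸ j) (aN j))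
        (λ r j lt jp → proj₂ (proj₂ (proj₁ (proj₂ tip₁) r lt)) (suc p + j) (bN jp))
        where
        off₀ : ∀ r → r < k → ∀ j → j ≤ N → λα r ≢ g j
        off₀ r lt j jN e = proj₂ (proj₂ (proj₁ (proj₂ tip₀) r lt)) (N ∸ j) (m∸n≤m N j) (trans e (cong g (sym (m∸[m∸n]≡n jN))))

      iso : ∀ h → p₁ ≡ h + h → G ≅ T k p
      iso h pe = Recognise.copy-iso sim _ (TGraph.es k (suc p₀)) C.cover C.covers-edges crit D embedded
          (TGraph.T-connected k (suc p₀) (s≤s z≤n)) (≤-reflexive (C.cover-size d (trans (cong (_+ 2) tight) (lem ν))))
        where
        module C = TGraph.C k (suc p₀) h pe
        lem : ∀ ν → suc (suc ν) + suc ν + suc ν + 2 ≡ suc (suc ν) + suc (suc ν) + suc (suc ν)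
        lem ν = solve (ν ∷ [])

    module Start {d : ℕ} (crit : DeficiencyCritical G) (D : Def G d) where

      around : ∀ r → (d ≤ suc (suc ν)) ⊎ (∃ λ u → Leafy u × (r == u) ≡ false)
      around r = dec-elim (𝔽.all? (λ v → lv v ≤? 1)) (λ near → inj₁ (near-bound D r near))
          (λ far' → inj₂ (leafy-outside (dec-elim (𝔽.any? (λ v → 2 ≤? lv v)) id
            λ none → ⊥-elim (far' λ v → s≤s⁻¹ (≰⇒> λ h → none (v , h))))))
        where
        reach : ∀ v → ∃ λ s → (r == s) ≡ true × Reachable G s v
        reach v = r , ==-refl r , proj₂ con r v
        open Levels (r ==_) reach
        open Outer (r ==_) reach r (==-refl r) (λ v e → subst (RIn {G} _ v) (sym (==⇒≡ e)) (rhere e)) crit D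

      record Line : Set where
        field
          g : ℕ → V
          N : ℕ
          N0 : 0 < N
          I : Ind g N
          L₀ : Leafy (g 0)
          L₁ : Leafy (g N)
          qN : Q (suc N)

      line-between : ∀ {s t} → Leafy s → Leafy t → (s == t) ≡ false → Line
      line-between {s} {t} Ls Lt st = build (lv t) refl
        where
        open Levels (s ==_) (λ v → s , ==-refl s , proj₂ con s v)
        build : ∀ n' → lv t ≡ n' → Line
        build zero e = ⊥-elim (true≢false (S-lv e) st)
        build (suc n') e = record { g = γ.ζ ; N = suc n' ; N0 = s≤s z≤n ; I = γ.ind ; L₀ = L₀ ; L₁ = L₁ ; qN = leafy-path γ.ind L₀ L₁ }
          where
          module γ = Geodesic (geodesic (suc n') t e)
          L₀ : Leafy (γ.ζ 0)
          L₀ = subst Leafy (==⇒≡ (S-lv (γ.level 0 z≤n))) Ls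
          L₁ : Leafy (γ.ζ (suc n'))
          L₁ = subst Leafy (sym γ.end) Lt

      -- `around` an arbitrary vertex finds a leafy s, and `around s` finds a second leafy vertex.
      -- If either call fails, the whole graph is within distance 1 of one vertex and d ≤ n - 2.
      start : (d ≤ suc (suc ν)) ⊎ Line
      start = [ inj₁ , (λ { (s , Ls , _) → [ inj₁ , (λ { (t , Lt , st) → inj₂ (line-between Ls Lt st) }) ]′ (around s) }) ]′
        (around (fromℕ< (proj₁ con)))

    -- A leafy vertex off a given path, for odd p and q

    module Parity (σ σ' : ℕ) (p-odd : p ≡ suc (2 * σ)) (q-odd : q ≡ suc (2 * σ')) where
      open Ar.Odds σ p-odd σ' q-odd

      module Lines {g : ℕ → V} {N : ℕ} (I : Ind g N) (L₀ : Leafy (g 0)) (L₁ : Leafy (g N)) where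
        line : Spider 1 N
        line = mkSpider (g 0) (λ _ → g) (λ _ → refl) (λ _ → I) (λ { {zero} {zero} ne → ⊥-elim (ne refl) })

        module At {t : V} (Lt : Leafy t) (t∉ : Spider.on line t ≡ false) where
          tl : Tail (Spider.on line) t
          tl = tail (Spider.on line) (λ v → g 0 , Spider.on-r line zero 0 z≤n , proj₂ con (g 0) v) t t∉
          open Tail tl public

          touch-at : ∃ λ i → i ≤ N × E (g i) (ζ 0)
          touch-at = let (s , os , sz) = touch ; (_ , j , jN , rs) = Spider.on-out line os in j , jN , subst (λ x → E x (ζ 0)) (sym rs) sz

          open Attach I L₀ L₁ ind (subst Leafy (sym end) Lt) (λ i iN → Spider.off-≢ line (off 0 z≤n) zero i iN)
            (λ i j iN → far-S (g i) j (Spider.on-r line zero i iN)) (span g N (ζ 0) (proj₁ touch-at) (proj₁ (proj₂ touch-at)) (proj₂ (proj₂ touch-at))) public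

          -- The tail touches the path in a single vertex at either end, in a single inner vertex,
          -- or in vertices at distance at least 2. First and last neighbours that are consecutive
          -- fall to parity.
          attach-cases : Q (suc N) → (f ≡ l → f ≡ 0 → ⊥) → (f ≡ l → k ≡ 0 → ⊥) → (f ≡ l → 0 < f → 0 < k → ⊥) → (suc f < l → ⊥) → ⊥
          attach-cases qN c₁ c₂ c₃ c₄ = go (m≤n⇒m<n∨m≡n f≤l)
            where
            single : f ≡ l → f ≡ 0 ⊎ 0 < f → k ≡ 0 ⊎ 0 < k → ⊥
            single fl (inj₁ f0) _ = c₁ fl f0
            single fl (inj₂ _) (inj₁ k0) = c₂ fl k0
            single fl (inj₂ f0) (inj₂ k0) = c₃ fl f0 k0
            go : f < l ⊎ f ≡ l → ⊥
            go (inj₂ fl) = single fl (zero-or f) (zero-or k)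
            go (inj₁ lt) = [ c₄ , (λ sf → adjacent-odd {f} {k} {e} qN (trans (cong (_+ k) sf) l+k) reach-lo reach-hi) ]′ (m≤n⇒m<n∨m≡n lt)

          f0-k : f ≡ l → f ≡ 0 → k ≡ N
          f0-k fl f0 = trans (cong (_+ k) (sym (trans (sym fl) f0))) l+k

          k0-f : f ≡ l → k ≡ 0 → f ≡ N
          k0-f fl k0 = trans fl (trans (sym (+-identityʳ l)) (trans (cong (l +_) (sym k0)) l+k))

          no-third : q ≡ suc (p + p) → suc N ≡ p ⊎ suc N ≡ q → ⊥
          no-third qp (inj₁ pN) = attach-cases (inj₁ pN)
            (λ fl f0 → short-end pN (subst (λ x → Q (suc (suc (x + e)))) f0 reach-lo) (subst (λ x → Q (suc (suc (x + e)))) (f0-k fl f0) reach-hi))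
            (λ fl k0 → short-end pN (subst (λ x → Q (suc (suc (x + e)))) k0 reach-hi) (subst (λ x → Q (suc (suc (x + e)))) (k0-f fl k0) reach-lo))
            (λ fl f0 k0 → inner (trans (cong (_+ k) fl) l+k) k0 (claw-lo' fl f0 k0))
            (λ fl → wide fl l+k (wide-lo fl))
            where
            open Ar.CaseA qp
            open Ar.Short N pN p<q
          no-third qp (inj₂ qN) = attach-cases (inj₂ qN)
            (λ fl f0 → Lg.end (subst (λ x → Q (suc (suc (x + e)))) (f0-k fl f0) reach-hi))
            (λ fl k0 → Lg.end (subst (λ x → Q (suc (suc (x + e)))) (k0-f fl k0) reach-lo))
            (λ fl f0 k0 → Lg.inner (trans (cong (_+ k) fl) l+k) f0 k0 (claw-lo' fl f0 k0) (claw-hi fl f0 k0))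
            (λ fl → Lg.wide fl l+k (wide-lo fl) (wide-hi fl) (jump fl))
            where
            module Lg = Ar.CaseA.Long qp N qN

      module Critical {d : ℕ} (crit : DeficiencyCritical G) (D : Def G d) where
        open Start crit D

        half : suc (suc p₀) ≡ σ + σ
        half = trans (suc-injective p-odd) (cong (σ +_) (+-identityʳ σ))

        -- With n = ν + 4 these are 3n - 8 and n^2 - 3n + 1, split into the cost n - 2 of the root
        -- and the costs n - 3 of the other branching vertices.
        path-value tree-value : ℕ
        path-value = suc (suc ν) + suc ν + suc ν
        tree-value = suc (suc ν) + suc (suc (suc ν)) * suc ν

        small<path : suc (suc ν) < path-value
        small<path = s≤s (s≤s (m≤n+m (suc ν) (ν + suc ν)))

        path<tree : path-value < tree-value
        path<tree = ≤-trans (m≤m+n _ (ν + (ν + ν * ν))) (≤-reflexive (lem ν))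
          where
          lem : ∀ ν → suc (suc (suc ν) + suc ν + suc ν) + (ν + (ν + ν * ν)) ≡ suc (suc ν) + suc (suc (suc ν)) * suc ν
          lem ν = solve (ν ∷ [])

        not-tight : ∀ {a} {B : Set} → d < a → d ≡ a → B
        not-tight lt refl = ⊥-elim (<-irrefl refl lt)

        N<q : p < q → ∀ {N} → Q (suc N) → suc N ≤ q
        N<q pq (inj₁ e) = ≤-trans (≤-reflexive e) (<⇒≤ pq)
        N<q pq (inj₂ e) = ≤-reflexive e

        module OnLine (ℓ : Line) where
          open Line ℓ
          line : Spider 1 N
          line = Lines.line I L₀ L₁

          Covered : Set
          Covered = ∀ u → Leafy u → ∃ λ j → j ≤ N × g j ≡ u

          covered? : Covered ⊎ (∃ λ u → Leafy u × Spider.on line u ≡ false)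
          covered? = dec-elim (𝔽.any? (λ u → Leafy? u ×-dec (Spider.on line u 𝔹.≟ false))) inj₂
            λ none → inj₁ λ u Lu → [ (λ o → let (_ , j , jN , e) = Spider.on-out line o in j , jN , e)
                                  , (λ o → ⊥-elim (none (u , Lu , o))) ]′ (Spider.on-or-off line u)

          line-bound : p < q → Covered → d ≤ path-value
          line-bound pq all = PathCase.path-bound' crit D I L₀ (N<q pq qN) all N0

          -- On a path with p vertices the index p - 1 is the end, so the two branching places
          -- beyond the root coincide and 3n - 8 is not reached.
          short-bound : p < q → Covered → suc N ≡ p → d < path-value
          short-bound pq all pN = ≤-trans (s≤s (PathCase.path-bound crit D I L₀ (N<q pq qN) all 0 (suc ν)
              (λ lt → ⊥-elim (<-irrefl (sym (suc-injective pN)) lt)) (PathCase.child-≤ crit D I L₀ (N<q pq qN) all N N0 ≤-refl)))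
              (≤-trans (m≤m+n _ ν) (≤-reflexive (lem ν)))
            where
            lem : ∀ ν → suc (suc (suc ν) + 0 + suc ν) + ν ≡ suc (suc ν) + suc ν + suc ν
            lem ν = solve (ν ∷ [])

        module PathResult (qp : q ≡ suc (p + p)) where
          result : d ≤ path-value × (d ≡ path-value → G ≅ T (suc (suc ν)) p)
          result = [ (λ s → <⇒≤ (≤-trans (s≤s s) small<path) , not-tight (≤-trans (s≤s s) small<path)) , on-line ]′ start
            where
            on-line : Line → d ≤ path-value × (d ≡ path-value → G ≅ T (suc (suc ν)) p)
            on-line ℓ = [ (λ all → line-bound (Ar.CaseA.p<q qp) all , [ (λ pN → not-tight (short-bound (Ar.CaseA.p<q qp) all pN))
                  , (λ eN tight → TightPath.iso crit D I L₀ L₁ (≤-reflexive eN) all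
                       (sym (suc-injective (trans eN qp))) qp tight σ half) ]′ qN)
                , (λ { (u , Lu , u∉) → ⊥-elim (Lines.At.no-third I L₀ L₁ Lu u∉ qp qN) }) ]′ covered?
              where
              open Line ℓ
              open OnLine ℓ

      -- The case q = 2p - 1: spiders with leafy ends

      module Tree (qp : suc q ≡ p + p) where
        module BA = Ar.CaseB qp

        -- This is q - 1, in the form in which `ind-glue` gives the last index of two joined legs.
        Nq : ℕ
        Nq = suc (p₁ + p₂)

        Nq≡ : suc Nq ≡ q
        Nq≡ = suc-injective (trans (lem p₀) (sym qp))
          where
          lem : ∀ p₀ → suc (suc (suc (suc (suc p₀) + suc p₀))) ≡ suc (suc (suc p₀)) + suc (suc (suc p₀))
          lem p₀ = solve (p₀ ∷ [])

        module Long = BA.Long Nq Nq≡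

        record LeafySpider (k : ℕ) : Set where
          constructor mkLS
          field
            sp : Spider k p₁
            ends : ∀ i → Leafy (Spider.r sp i p₁)

        infixr 5 _◂_
        _◂_ : V → (ℕ → V) → ℕ → V
        (x ◂ ζ) zero = x
        (x ◂ ζ) (suc j) = ζ j

        ind-◂ : ∀ {x ζ e} → Ind ζ e → E x (ζ 0) → (∀ j → 0 < j → j ≤ e → Far x (ζ j)) → Ind (x ◂ ζ) (suc e)
        ind-◂ {x} {ζ} {e} I xz xf = mkInd (λ { zero _ → xz ; (suc j) lt → adj I j (s≤s⁻¹ lt) })
          (λ { zero (suc j) lt je → xf j (s≤s⁻¹ lt) (s≤s⁻¹ je) ; (suc i) (suc j) lt je → far I i j (s≤s⁻¹ lt) (s≤s⁻¹ je) })

        module Pairs {k : ℕ} (LS : LeafySpider k) where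
          open LeafySpider LS public
          open Spider sp public

          module _ (a b : Fin k) (ab : a ≢ b) where
            -- Two legs form an induced path on q vertices with leafy ends and the centre at index p
            -- - 1, so the results on paths apply to every pair of legs.
            arc : ℕ → V
            arc = glue (λ j → r a (p₁ ∸ j)) p₁ (λ j → r b (suc j))

            arc-l : ∀ j → j ≤ p₁ → arc (p₁ ∸ j) ≡ r a j
            arc-l j jp = trans (glue-l {λ j → r a (p₁ ∸ j)} {p₁} {λ j → r b (suc j)} (m∸n≤m p₁ j)) (cong (r a) (m∸[m∸n]≡n jp))

            arc-r : ∀ j → arc (suc (p₁ + j)) ≡ r b (suc j)
            arc-r j = glue-r {λ j → r a (p₁ ∸ j)} {p₁} {λ j → r b (suc j)} j

            arc-Ind : Ind arc Nq
            arc-Ind = ind-glue (ind-rev (leg a)) (ind-shift (leg b) 1 p₂ ≤-refl)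
              (subst (λ x → E x (r b 1)) (sym (trans (cong (r a) (n∸n≡0 p₁)) (trans (r-0 a) (sym (r-0 b))))) (adj (leg b) 0 (s≤s z≤n)))
              λ i j ip jp o → cr i j ip jp o (zero-or (p₁ ∸ i))
              where
              cr : ∀ i j → i ≤ p₁ → j ≤ p₂ → i < p₁ ⊎ 0 < j → p₁ ∸ i ≡ 0 ⊎ 0 < p₁ ∸ i → Far (r a (p₁ ∸ i)) (r b (suc j))
              cr i j ip jp o (inj₂ pos) = cross ab (p₁ ∸ i) (suc j) pos (m∸n≤m p₁ i) (s≤s z≤n) (s≤s jp)
              cr i j ip jp (inj₁ lt) (inj₁ z) = ⊥-elim (<-irrefl (sym z) (m<n⇒0<n∸m lt))
              cr i j ip jp (inj₂ j0) (inj₁ z) = subst (λ x → Far x (r b (suc j))) (trans (r-0 b) (trans (sym (r-0 a)) (cong (r a) (sym z))))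
                (far (leg b) 0 (suc j) (s≤s j0) (s≤s jp))

            arc-start : Leafy (arc 0)
            arc-start = subst Leafy (sym (glue-l {λ j → r a (p₁ ∸ j)} {p₁} {λ j → r b (suc j)} z≤n)) (ends a)

            arc-end : Leafy (arc Nq)
            arc-end = subst Leafy (sym (arc-r p₂)) (ends b)

            arc-on : ∀ i → i ≤ Nq → on (arc i) ≡ true
            arc-on i iN with split p₁ i
            ... | left le = subst (λ x → on x ≡ true) (sym (glue-l {λ j → r a (p₁ ∸ j)} {p₁} {λ j → r b (suc j)} le)) (on-r a (p₁ ∸ i) (m∸n≤m p₁ i))
            ... | right j = subst (λ x → on x ≡ true) (sym (arc-r j)) (on-r b (suc j) (s≤s (+-cancelˡ-≤ p₁ _ _ (s≤s⁻¹ iN))))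

            leg-a-free : ∀ {z f} → f ≤ p₁ → (∀ i → i < f → ¬ E (arc i) z) → ∀ j → j ≤ p₁ → p₁ ∸ j < f → ¬ E (r a j) z
            leg-a-free {z} fp lo j jp lt e = lo (p₁ ∸ j) lt (subst (λ x → E x z) (sym (arc-l j jp)) e)

            leg-b-free : ∀ {z l} → (∀ i → l < i → i ≤ Nq → ¬ E (arc i) z) → ∀ j → j ≤ p₂ → l < suc (p₁ + j) → ¬ E (r b (suc j)) z
            leg-b-free {z} hi j jp lt e = hi (suc (p₁ + j)) lt (s≤s (+-monoʳ-≤ p₁ jp)) (subst (λ x → E x z) (sym (arc-r j)) e)

          -- Otherwise z and c are pendants of a bone on p - 1 vertices.
          touch-centre : ∀ a {z} → (∀ i j → j ≤ p₁ → r i j ≢ z) → E (r a 1) z → (∀ j → 1 < j → j ≤ p₁ → ¬ E (r a j) z) → E c z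
          touch-centre a {z} out e₁ free = dec-elim (E? c z) id λ ne → ⊥-elim ([ (λ x → refute (p ∷ p₁ ∷ []) (X 0 ⊞ (K 1 ⊞ X 1)) (X 1 ⊞ X 0) (ge x ⊕ ge pp) refl) , (λ x → refute (q ∷ p ∷ p₁ ∷ []) (X 0 ⊞ (X 1 ⊞ X 1) ⊞ (K 1 ⊞ X 2) ⊞ (K 1 ⊞ X 2)) (X 2 ⊞ (K 1 ⊞ X 0) ⊞ X 1 ⊞ X 1) (ge x ⊕ ge qp ⊕ ge pp ⊕ ge pp) refl) ]′
            (claw-path (ind-prefix (ind-rev (leg a)) (n≤1+n p₂)) (ends a)
              (subst (λ x → E x z) (sym (cong (r a) one)) e₁)
              (subst₂ E (sym (cong (r a) one)) (r-0 a) (E-sym (adj (leg a) 0 (s≤s z≤n))))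
              (Far-sym (subst (λ x → Far x z) (r-0 a) (z-far z≤n (λ h → ne (subst (λ x → E x z) (r-0 a) h)))))
              (λ j jp → z-far (m∸n≤m p₁ j) (free (p₁ ∸ j) (m+n≤o⇒m≤o∸n 2 (s≤s (s≤s jp))) (m∸n≤m p₁ j)))
              (λ j jp → subst (Far (r a (p₁ ∸ j))) (r-0 a) (Far-sym (far (leg a) 0 (p₁ ∸ j) (m+n≤o⇒m≤o∸n 2 (s≤s (s≤s jp))) (m∸n≤m p₁ j))))))
            where
            pp : p ≡ suc p₁
            pp = refl
            one : p₁ ∸ p₂ ≡ 1
            one = m+n∸n≡m 1 p₂
            z-far : ∀ {j} → j ≤ p₁ → ¬ E (r a j) z → Far (r a j) z
            z-far {j} jp ne = ¬E⇒ ne , out a j jp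

          module Tailed {t : V} (Lt : Leafy t) (tl : Tail on t) where
            open Tail tl hiding (off)

            z : V
            z = ζ 0

            z-off : ∀ i j → j ≤ p₁ → r i j ≢ z
            z-off = off-≢ (Tail.off tl 0 z≤n)

            far-tail : ∀ i j j' → j ≤ p₁ → 0 < j' → j' ≤ e → Far (r i j) (ζ j')
            far-tail i j j' jp = far-S (r i j) j' (on-r i j jp)

            data PairResult (a b : Fin k) : Set where
              centre : suc (suc e) ≡ p → E c z → (∀ j → 0 < j → j ≤ p₁ → ¬ E (r a j) z) → (∀ j → 0 < j → j ≤ p₁ → ¬ E (r b j) z) → PairResult a b
              wide : e ≡ 0 ⊎ suc e ≡ p → E (r a 1) z → E (r b 1) z → (∀ j → 1 < j → j ≤ p₁ → ¬ E (r a j) z) → (∀ j → 1 < j → j ≤ p₁ → ¬ E (r b j) z) → PairResult a b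

            -- `Attach` applies to the arc. The arithmetic of `Long` and parity leave two
            -- possibilities: z sees only the centre, or its first and last neighbours on the arc
            -- are the two neighbours of the centre.
            pair : ∀ a b (ab : a ≢ b) i → i ≤ Nq → E (arc a b ab i) z → PairResult a b
            pair a b ab i iN ei = go (m≤n⇒m<n∨m≡n f≤l)
              where
              open Attach (arc-Ind a b ab) (arc-start a b ab) (arc-end a b ab) ind (subst Leafy (sym end) Lt)
                (λ i iN eq → true≢false (arc-on a b ab i iN) (subst (λ x → on x ≡ false) (sym eq) (Tail.off tl 0 z≤n)))
                (λ i j iN j0 je → far-S (arc a b ab i) j (arc-on a b ab i iN) j0 je) (span (arc a b ab) Nq z i iN ei)
                renaming (k to kk)
              at-centre : suc f ≡ p → f ≡ l → PairResult a b
              at-centre fp fl = centre (Long.centre-leg fp reach-lo)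
                (subst (λ x → E x z) (trans (cong (arc a b ab) fp₁) (trans (arc-l a b ab 0 z≤n) (r-0 a))) ef)
                (λ j j0 jp → leg-a-free a b ab (≤-reflexive fp₁) lo j jp (≤-trans (∸-monoʳ-< {p₁} j0 jp) (≤-reflexive (sym fp₁))))
                (λ { (suc j) _ jp → leg-b-free a b ab hi j (s≤s⁻¹ jp) (s≤s (≤-trans (≤-reflexive (trans (sym fl) fp₁)) (m≤m+n p₁ j))) })
                where
                fp₁ : f ≡ p₁
                fp₁ = suc-injective fp
              at-wide : suc (suc f) ≡ p × l ≡ p × suc (suc kk) ≡ p × (e ≡ 0 ⊎ suc e ≡ p) → PairResult a b
              at-wide (fp , lp , _ , ee) = wide ee
                (subst (λ x → E x z) (trans (cong (arc a b ab) fp₂) (arc-l a b ab 1 (s≤s z≤n))) ef)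
                (subst (λ x → E x z) (trans (cong (arc a b ab) (trans lp (cong suc (sym (+-identityʳ p₁))))) (arc-r a b ab 0)) el)
                (λ j j1 jp → leg-a-free a b ab f≤p₁ lo j jp (≤-trans (∸-monoʳ-< {p₁} j1 jp) (≤-reflexive (sym fp₂))))
                (λ { (suc j) j1 jp → leg-b-free a b ab hi j (s≤s⁻¹ jp) (≤-trans (≤-reflexive (cong suc lp)) (s≤s (≤-trans (≤-reflexive (+-comm 1 p₁)) (+-monoʳ-≤ p₁ (s≤s⁻¹ j1))))) })
                where
                fp₂ : f ≡ p₂
                fp₂ = suc-injective (suc-injective fp)
                f≤p₁ : f ≤ p₁
                f≤p₁ = ≤-trans (≤-reflexive fp₂) (n≤1+n p₂)
              at-single : f ≡ l → f ≡ 0 ⊎ 0 < f → kk ≡ 0 ⊎ 0 < kk → PairResult a b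
              at-single fl (inj₁ f0) _ = ⊥-elim (Long.end (subst (λ x → Q (suc (suc (x + e))))
                (trans (cong (_+ kk) (sym (trans (sym fl) f0))) l+k) reach-hi))
              at-single fl (inj₂ _) (inj₁ k0) = ⊥-elim (Long.end (subst (λ x → Q (suc (suc (x + e))))
                (trans fl (trans (sym (+-identityʳ l)) (trans (cong (l +_) (sym k0)) l+k))) reach-lo))
              at-single fl (inj₂ f0) (inj₂ k0) = at-centre (Long.inner (trans (cong (_+ kk) fl) l+k) k0 (claw-lo' fl f0 k0)) fl
              at-adjacent : suc f ≡ l → PairResult a b
              at-adjacent sf = ⊥-elim (adjacent-odd {f} {kk} {e} (inj₂ Nq≡) (trans (cong (_+ kk) sf) l+k) reach-lo reach-hi)
              go : f < l ⊎ f ≡ l → PairResult a b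
              go (inj₂ fl) = at-single fl (zero-or f) (zero-or kk)
              go (inj₁ lt) = [ (λ fl → at-wide (Long.wide fl l+k (wide-lo fl) (wide-hi fl) reach-lo)) , at-adjacent ]′ (m≤n⇒m<n∨m≡n lt)

            pair-at : ∀ a b → a ≢ b → ∀ j → j ≤ p₁ → E (r a j) z → PairResult a b
            pair-at a b ab j jp ez = pair a b ab (p₁ ∸ j) (≤-trans (m∸n≤m p₁ j) (≤-trans (m≤m+n p₁ p₂) (n≤1+n _)))
              (subst (λ x → E x z) (sym (arc-l a b ab j jp)) ez)

            -- The tail of a new leafy vertex meets the spider in the centre only, or in all vertices next to the centre;
            -- in the second case z becomes the centre.
            data Global : Set where
              at-c : suc (suc e) ≡ p → E c z → (∀ a j → 0 < j → j ≤ p₁ → ¬ E (r a j) z) → Global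
              around-c : e ≡ 0 ⊎ suc e ≡ p → (∀ a → E (r a 1) z) → (∀ a j → 1 < j → j ≤ p₁ → ¬ E (r a j) z) → Global

            -- A first pair i, b decides what z sees on leg i. Pairing i with any other leg must
            -- agree on the vertex r i 1, so all legs behave alike.
            global : (∀ i → ∃ λ b → i ≢ b) → Global
            global other = let (s , os , sz) = touch ; (i , j , jp , rs) = on-out os ; (b , ib) = other i in
                from i (pair-at i b ib j jp (subst (λ x → E x z) (sym rs) sz))
              where
              from : ∀ i {b} → PairResult i b → Global
              from i (centre ee cz fi _) = at-c ee cz λ a → dec-elim (i 𝔽.≟ a) (λ { refl → fi })
                λ ne → second (pair-at i a ne 0 z≤n (subst (λ x → E x z) (sym (r-0 i)) cz))
                where
                second : ∀ {a} → PairResult i a → ∀ j → 0 < j → j ≤ p₁ → ¬ E (r a j) z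
                second (centre _ _ _ fa) = fa
                second (wide _ e₁ _ _ _) = ⊥-elim (fi 1 (s≤s z≤n) (s≤s z≤n) e₁)
              from i (wide ee e₁ _ fi _) = around-c ee (λ a → dec-elim (i 𝔽.≟ a) (λ { refl → e₁ }) (λ ne → proj₁ (second (pair-at i a ne 1 (s≤s z≤n) e₁))))
                λ a → dec-elim (i 𝔽.≟ a) (λ { refl → fi }) (λ ne → proj₂ (second (pair-at i a ne 1 (s≤s z≤n) e₁)))
                where
                second : ∀ {a} → PairResult i a → E (r a 1) z × (∀ j → 1 < j → j ≤ p₁ → ¬ E (r a j) z)
                second (centre _ _ f₁ _) = ⊥-elim (f₁ 1 (s≤s z≤n) (s≤s z≤n) e₁)
                second (wide _ _ e₂ _ fa) = e₂ , fa

            z-far : ∀ {a j} → j ≤ p₁ → ¬ E (r a j) z → Far (r a j) z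
            z-far {a} {j} jp ne = ¬E⇒ ne , z-off a j jp

            extend-leg : suc (suc e) ≡ p → E c z → (∀ a j → 0 < j → j ≤ p₁ → ¬ E (r a j) z) → Fin k → LeafySpider (suc k)
            extend-leg ee cz free i₀ = mkLS (mkSpider c legs (λ { zero → refl ; (suc i) → r-0 i }) (λ { zero → leg₀ ; (suc i) → leg i }) crosses)
                (λ { zero → subst Leafy (trans (sym end) (cong ζ e≡)) Lt ; (suc i) → ends i })
              where
              e≡ : e ≡ p₂
              e≡ = suc-injective (suc-injective ee)
              c-far : ∀ j → 0 < j → j ≤ e → Far c (ζ j)
              c-far j j0 je = subst (λ x → Far x (ζ j)) (r-0 i₀) (far-tail i₀ 0 j z≤n j0 je)
              legs : Fin (suc k) → ℕ → V
              legs zero = c ◂ ζ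
              legs (suc i) = r i
              leg₀ : Ind (c ◂ ζ) p₁
              leg₀ = subst (λ x → Ind (c ◂ ζ) (suc x)) e≡ (ind-◂ ind cz c-far)
              new-far : ∀ j b j' → 0 < j → j ≤ p₁ → 0 < j' → j' ≤ p₁ → Far (r b j') ((c ◂ ζ) j)
              new-far (suc zero) b j' _ _ j0' jp' = z-far jp' (free b j' j0' jp')
              new-far (suc (suc j)) b j' _ jp j0' jp' = far-tail b j' (suc j) jp' (s≤s z≤n) (≤-trans (s≤s⁻¹ jp) (≤-reflexive (sym e≡)))
              crosses : ∀ {a b} → a ≢ b → ∀ j j' → 0 < j → j ≤ p₁ → 0 < j' → j' ≤ p₁ → Far (legs a j) (legs b j')
              crosses {zero} {zero} ne = ⊥-elim (ne refl)
              crosses {zero} {suc b} _ j j' a₁ a₂ b₁ b₂ = Far-sym (new-far j b j' a₁ a₂ b₁ b₂)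
              crosses {suc a} {zero} _ j j' a₁ a₂ b₁ b₂ = new-far j' a j b₁ b₂ a₁ a₂
              crosses {suc a} {suc b} ne = cross (ne ∘ cong suc)

            moved : Fin k → ℕ → V
            moved a = z ◂ (λ j → r a (suc j))

            module _ (touch₁ : ∀ a → E (r a 1) z) (free : ∀ a j → 1 < j → j ≤ p₁ → ¬ E (r a j) z) where
              moved-leg : ∀ a → Ind (moved a) p₁
              moved-leg a = ind-◂ (ind-shift (leg a) 1 p₂ ≤-refl) (E-sym (touch₁ a))
                λ j j0 jp → Far-sym (z-far (s≤s jp) (free a (suc j) (s≤s j0) (s≤s jp)))

              moved-cross : ∀ {a b} → a ≢ b → ∀ j j' → 0 < j → j ≤ p₁ → 0 < j' → j' ≤ p₁ → Far (moved a j) (moved b j')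
              moved-cross ab (suc j) (suc j') a₁ a₂ b₁ b₂ = cross ab (suc j) (suc j') a₁ a₂ b₁ b₂

              moved-spider : Spider k p₁
              moved-spider = mkSpider z moved (λ _ → refl) moved-leg moved-cross

              recentred : LeafySpider k
              recentred = mkLS moved-spider ends

              widened : suc e ≡ p → LeafySpider (suc k)
              widened ee = mkLS (mkSpider z legs (λ { zero → refl ; (suc i) → refl }) (λ { zero → subst (Ind ζ) e≡ ind ; (suc i) → moved-leg i }) crosses)
                  (λ { zero → subst Leafy (trans (sym end) (cong ζ e≡)) Lt ; (suc i) → ends i })
                where
                e≡ : e ≡ p₁
                e≡ = suc-injective ee
                legs : Fin (suc k) → ℕ → V
                legs zero = ζ
                legs (suc i) = moved i
                new-far : ∀ j b j' → 0 < j → j ≤ p₁ → 0 < j' → j' ≤ p₁ → Far (moved b j') (ζ j)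
                new-far j b (suc j') j0 jp _ jp' = far-tail b (suc j') j jp' j0 (≤-trans jp (≤-reflexive (sym e≡)))
                crosses : ∀ {a b} → a ≢ b → ∀ j j' → 0 < j → j ≤ p₁ → 0 < j' → j' ≤ p₁ → Far (legs a j) (legs b j')
                crosses {zero} {zero} ne = ⊥-elim (ne refl)
                crosses {zero} {suc b} _ j j' a₁ a₂ b₁ b₂ = Far-sym (new-far j b j' a₁ a₂ b₁ b₂)
                crosses {suc a} {zero} _ j j' a₁ a₂ b₁ b₂ = new-far j' a j b₁ b₂ a₁ a₂
                crosses {suc a} {suc b} ne = moved-cross (ne ∘ cong suc)

              centre-touch : Fin k → E c z
              centre-touch a = touch-centre a z-off (touch₁ a) (free a)

              -- The path from c through the tail has e + 2 vertices, that is 2 or p + 1, and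
              -- neither is p or q. So the centre never moves away from a leafy vertex.
              centre-not-leafy : e ≡ 0 ⊎ suc e ≡ p → Fin k → ¬ Leafy c
              centre-not-leafy ee i₀ Lc = bad ee (join (ind-const c) Lc ind (centre-touch i₀)
                  (λ { i j z≤n je (inj₁ ()) ; i j z≤n je (inj₂ j0) → subst (λ x → Far x (ζ j)) (r-0 i₀) (far-tail i₀ 0 j z≤n j0 je) })
                  (subst Leafy (sym end) Lt))
                where
                bad : e ≡ 0 ⊎ suc e ≡ p → Q (suc (suc e)) → ⊥
                bad (inj₁ e0) (inj₁ x) = refute (e ∷ p ∷ []) (X 0 ⊞ X 1 ⊞ K 3) (K 0 ⊞ (K 2 ⊞ X 0) ⊞ X 1) (le e0 ⊕ ge x ⊕ p≥3) refl
                bad (inj₁ e0) (inj₂ x) = refute (e ∷ q ∷ p ∷ []) (X 0 ⊞ X 1 ⊞ (X 2 ⊞ X 2) ⊞ K 3 ⊞ K 3) (K 0 ⊞ (K 2 ⊞ X 0) ⊞ (K 1 ⊞ X 1) ⊞ X 2 ⊞ X 2) (le e0 ⊕ ge x ⊕ ge qp ⊕ p≥3 ⊕ p≥3) refl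
                bad (inj₂ ee) (inj₁ x) = refute (p ∷ e ∷ []) (X 0 ⊞ (K 2 ⊞ X 1)) (K 1 ⊞ X 1 ⊞ X 0) (ge ee ⊕ le x) refl
                bad (inj₂ ee) (inj₂ x) = refute (e ∷ q ∷ p ∷ []) (K 1 ⊞ X 0 ⊞ X 1 ⊞ (X 2 ⊞ X 2) ⊞ K 3) (X 2 ⊞ (K 2 ⊞ X 0) ⊞ (K 1 ⊞ X 1) ⊞ X 2) (le ee ⊕ ge x ⊕ ge qp ⊕ p≥3) refl

            Grown : Set
            Grown = LeafySpider (suc k) ⊎ ((∃ λ (L : LeafySpider k) → Leafy (Spider.c (LeafySpider.sp L))) × ¬ Leafy c)

            grow : (∀ i → ∃ λ b → i ≢ b) → Fin k → Grown
            grow other i₀ with global other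
            ... | at-c ee cz free = inj₁ (extend-leg ee cz free i₀)
            ... | around-c (inj₂ ee) t₁ free = inj₁ (widened t₁ free ee)
            ... | around-c (inj₁ e0) t₁ free = inj₂ ((recentred t₁ free , subst Leafy (trans (sym end) (cong ζ e0)) Lt) , centre-not-leafy t₁ free (inj₁ e0) i₀)

        two-legged : ∀ {α β} → α 0 ≡ β 0 → Ind α p₁ → Ind β p₁ → (∀ j j' → 0 < j → j ≤ p₁ → 0 < j' → j' ≤ p₁ → Far (α j) (β j')) →
          Leafy (α p₁) → Leafy (β p₁) → LeafySpider 2
        two-legged {α} {β} ab Iα Iβ cr Lα Lβ = mkLS (mkSpider (α 0) legs (λ { zero → refl ; (suc zero) → sym ab })
            (λ { zero → Iα ; (suc zero) → Iβ })
            (λ { {zero} {zero} ne → ⊥-elim (ne refl) ; {zero} {suc zero} _ → cr ; {suc zero} {zero} _ j j' a b c d → Far-sym (cr j' j c d a b)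
               ; {suc zero} {suc zero} ne → ⊥-elim (ne refl) })) (λ { zero → Lα ; (suc zero) → Lβ })
          where
          legs : Fin 2 → ℕ → V
          legs zero = α
          legs (suc _) = β

        module _ {g : ℕ → V} {N : ℕ} (I : Ind g N) (L₀ : Leafy (g 0)) (L₁ : Leafy (g N)) where

          from-long : suc N ≡ q → LeafySpider 2
          from-long qN = two-legged {λ j → g (p₁ ∸ j)} {λ j → g (p₁ + j)} (cong g (sym (+-identityʳ p₁)))
              (ind-rev (ind-prefix I (≤-trans (m≤m+n p₁ p₁) (≤-reflexive NN)))) (ind-shift I p₁ p₁ (≤-reflexive NN))
              (λ j j' j0 jp j0' jp' → far I (p₁ ∸ j) (p₁ + j') (≤-trans (s≤s (∸-monoʳ-< {p₁} j0 jp)) (≤-trans (≤-reflexive (+-comm 1 p₁)) (+-monoʳ-≤ p₁ j0')))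
                  (≤-trans (+-monoʳ-≤ p₁ jp') (≤-reflexive NN)))
              (subst (Leafy ∘ g) (sym (n∸n≡0 p₁)) L₀) (subst (Leafy ∘ g) (sym NN) L₁)
            where
            pp : p ≡ suc p₁
            pp = refl
            NN : p₁ + p₁ ≡ N
            NN = ≤-antisym (≮⇒≥ λ lt → refute (N ∷ q ∷ p ∷ p₁ ∷ []) (K 1 ⊞ X 0 ⊞ X 1 ⊞ (X 2 ⊞ X 2) ⊞ (K 1 ⊞ X 3) ⊞ (K 1 ⊞ X 3)) (X 3 ⊞ X 3 ⊞ (K 1 ⊞ X 0) ⊞ (K 1 ⊞ X 1) ⊞ X 2 ⊞ X 2) (lt ⊕ ge qN ⊕ ge qp ⊕ ge pp ⊕ ge pp) refl)
                           (≮⇒≥ λ lt → refute (p₁ ∷ N ∷ q ∷ p ∷ []) (K 1 ⊞ (X 0 ⊞ X 0) ⊞ (K 1 ⊞ X 1) ⊞ (K 1 ⊞ X 2) ⊞ X 3 ⊞ X 3) (X 1 ⊞ X 2 ⊞ (X 3 ⊞ X 3) ⊞ (K 1 ⊞ X 0) ⊞ (K 1 ⊞ X 0)) (lt ⊕ le qN ⊕ le qp ⊕ le pp ⊕ le pp) refl)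

          from-start : N ≡ p₁ → ∀ {ζ e t} → Ind ζ e → ζ e ≡ t → Leafy t → suc (suc e) ≡ p → E (g 0) (ζ 0) →
            (∀ i → 0 < i → i ≤ N → Far (g i) (ζ 0)) → (∀ i j → i ≤ N → 0 < j → j ≤ e → Far (g i) (ζ j)) → LeafySpider 2
          from-start Np {ζ} {e} Iζ end Lt ep ez z-far ζ-far = two-legged {g} {g 0 ◂ ζ} refl (subst (Ind g) Np I)
              (subst (λ x → Ind (g 0 ◂ ζ) (suc x)) e≡ (ind-◂ Iζ ez (λ j → ζ-far 0 j z≤n)))
              (λ { j (suc zero) j0 jp _ _ → z-far j j0 (≤-trans jp (≤-reflexive (sym Np)))
                 ; j (suc (suc j')) j0 jp _ jp' → ζ-far j (suc j') (≤-trans jp (≤-reflexive (sym Np))) (s≤s z≤n) (≤-trans (s≤s⁻¹ jp') (≤-reflexive (sym e≡))) })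
              (subst (Leafy ∘ g) Np L₁) (subst Leafy (trans (sym end) (cong ζ e≡)) Lt)
            where
            e≡ : e ≡ p₂
            e≡ = suc-injective (suc-injective ep)

        module _ {g : ℕ → V} {N : ℕ} (I : Ind g N) (L₀ : Leafy (g 0)) (L₁ : Leafy (g N)) {t : V} (Lt : Leafy t)
          (t∉ : Spider.on (Lines.line I L₀ L₁) t ≡ false) where

          -- A further leafy vertex can only hang from an end of a path on p vertices, and that end
          -- becomes the centre of two legs.
          from-short : suc N ≡ p → LeafySpider 2
          from-short pN = go (m≤n⇒m<n∨m≡n A.f≤l)
            where
            module A = Lines.At I L₀ L₁ Lt t∉
            open Ar.CaseB qp
            open Ar.Short N pN p<q
            line-far : ∀ i j → i ≤ N → 0 < j → j ≤ A.e → Far (g i) (A.ζ j)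
            line-far i j iN = A.far-S (g i) j (Spider.on-r (Lines.line I L₀ L₁) zero i iN)
            single : A.f ≡ A.l → A.f ≡ 0 ⊎ 0 < A.f → A.k ≡ 0 ⊎ 0 < A.k → LeafySpider 2
            single fl (inj₁ f0) _ = from-start I L₀ L₁ (suc-injective pN) A.ind A.end Lt
              (short-end pN (subst (λ x → Q (suc (suc (x + A.e)))) f0 A.reach-lo) (subst (λ x → Q (suc (suc (x + A.e)))) (A.f0-k fl f0) A.reach-hi))
              (subst (λ x → E (g x) (A.ζ 0)) f0 A.ef) (λ i i0 iN → A.far-hi i (≤-trans (s≤s (≤-reflexive (trans (sym fl) f0))) i0) iN) line-far
            single fl (inj₂ _) (inj₁ k0) = from-start (ind-rev I) L₁ (subst (Leafy ∘ g) (sym (n∸n≡0 N)) L₀) (suc-injective pN) A.ind A.end Lt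
              (short-end pN (subst (λ x → Q (suc (suc (x + A.e)))) k0 A.reach-hi) (subst (λ x → Q (suc (suc (x + A.e)))) (A.k0-f fl k0) A.reach-lo))
              (subst (λ x → E (g x) (A.ζ 0)) (A.k0-f fl k0) A.ef)
              (λ i i0 iN → A.far-lo (N ∸ i) (≤-trans (∸-monoʳ-< {N} i0 iN) (≤-reflexive (sym (A.k0-f fl k0)))))
              (λ i j iN → line-far (N ∸ i) j (m∸n≤m N i))
            single fl (inj₂ f0) (inj₂ k0) = ⊥-elim (inner (trans (cong (_+ A.k) fl) A.l+k) k0 (A.claw-lo' fl f0 k0))
            go : A.f < A.l ⊎ A.f ≡ A.l → LeafySpider 2
            go (inj₂ fl) = single fl (zero-or A.f) (zero-or A.k)
            go (inj₁ lt) = ⊥-elim ([ (λ fl → wide fl A.l+k (A.wide-lo fl))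
              , (λ sf → adjacent-odd {A.f} {A.k} {A.e} (inj₁ pN) (trans (cong (_+ A.k) sf) A.l+k) A.reach-lo A.reach-hi) ]′ (m≤n⇒m<n∨m≡n lt))

        Covering : Set
        Covering = ∃ λ k → 2 ≤ k × ∃ λ (L : LeafySpider k) → ∀ u → Leafy u → Spider.on (LeafySpider.sp L) u ≡ true

        legs<n : ∀ {k} → LeafySpider k → k < n
        legs<n L = star-bound loc c (λ i → r i 1) inj (λ i → subst (λ x → E x (r i 1)) (r-0 i) (adj (leg i) 0 (s≤s z≤n)))
            λ i j → dec-elim (i 𝔽.≟ j) (λ { refl → irreflexive (r i 1) }) (λ ne → proj₁ (cross ne 1 1 (s≤s z≤n) (s≤s z≤n) (s≤s z≤n) (s≤s z≤n)))
          where
          open Pairs L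
          inj : ∀ {i j} → r i 1 ≡ r j 1 → i ≡ j
          inj {i} {j} eq = dec-elim (i 𝔽.≟ j) id λ ne → ⊥-elim (proj₂ (cross ne 1 1 (s≤s z≤n) (s≤s z≤n) (s≤s z≤n) (s≤s z≤n)) eq)

        first-leg : ∀ {k} → 2 ≤ k → Fin k
        first-leg (s≤s _) = zero

        -- Each step adds a leg or moves a non-leafy centre to a leafy one. `flag` records that the
        -- centre is leafy, so the second kind never occurs twice in a row and 2k + flag grows with
        -- every step; as k < n, it stays below 2n.
        grow-all : ∀ fuel k (L : LeafySpider k) (flag : Bool) → 2 ≤ k → (flag ≡ true → Leafy (Spider.c (LeafySpider.sp L))) →
          n + n ≤ k + k + b2n flag + fuel → Covering
        grow-all fuel k L flag k2 Lc room = dec-elim (𝔽.any? (λ u → Leafy? u ×-dec (on u 𝔹.≟ false)))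
            (λ { (u , Lu , u∉) → more u Lu u∉ fuel room })
            (λ none → k , k2 , L , λ u Lu → [ id , (λ u∉ → ⊥-elim (none (u , Lu , u∉))) ]′ (on-or-off u))
          where
          open Pairs L
          b≤1 : ∀ b → b2n b ≤ 1
          b≤1 true = ≤-refl
          b≤1 false = z≤n
          more : ∀ u → Leafy u → on u ≡ false → ∀ fuel → n + n ≤ k + k + b2n flag + fuel → Covering
          more u Lu u∉ zero room = ⊥-elim (bad (b2n flag) (b≤1 flag) room (legs<n L))
            where
            bad : ∀ b → b ≤ 1 → n + n ≤ k + k + b + 0 → k < n → ⊥
            bad b b1 room kn = refute (b ∷ n ∷ k ∷ []) (X 0 ⊞ (X 1 ⊞ X 1) ⊞ (K 1 ⊞ X 2) ⊞ (K 1 ⊞ X 2)) (K 1 ⊞ (X 2 ⊞ X 2 ⊞ X 0 ⊞ K 0) ⊞ X 1 ⊞ X 1) (b1 ⊕ room ⊕ kn ⊕ kn) refl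
          more u Lu u∉ (suc fuel) room = [ bigger , (λ { ((L' , Lc') , nl) → moved L' Lc' nl flag Lc room }) ]′
              (Tailed.grow Lu (tail on (λ v → c , subst (λ x → on x ≡ true) (r-0 (first-leg k2)) (on-r (first-leg k2) 0 z≤n) , proj₂ con c v) u u∉)
                (fin-other k2) (first-leg k2))
            where
            bigger : LeafySpider (suc k) → Covering
            bigger L' = grow-all fuel (suc k) L' false (≤-trans k2 (n≤1+n k)) (λ ()) (≤-trans room (room' (b2n flag) (b≤1 flag)))
              where
              room' : ∀ b → b ≤ 1 → k + k + b + suc fuel ≤ suc k + suc k + 0 + fuel
              room' b b1 = ≮⇒≥ λ lt → refute (k ∷ fuel ∷ b ∷ []) (K 1 ⊞ (K 1 ⊞ X 0 ⊞ (K 1 ⊞ X 0) ⊞ K 0 ⊞ X 1) ⊞ X 2) (X 0 ⊞ X 0 ⊞ X 2 ⊞ (K 1 ⊞ X 1) ⊞ K 1) (lt ⊕ b1) refl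
            moved : (L' : LeafySpider k) → Leafy (Spider.c (LeafySpider.sp L')) → ¬ Leafy c → (fl : Bool) → (fl ≡ true → Leafy c) →
              n + n ≤ k + k + b2n fl + suc fuel → Covering
            moved L' Lc' nl true Lc room = ⊥-elim (nl (Lc refl))
            moved L' Lc' nl false Lc room = grow-all fuel k L' true k2 (λ _ → Lc') (≮⇒≥ λ lt → refute (k ∷ fuel ∷ n ∷ []) (K 1 ⊞ (X 0 ⊞ X 0 ⊞ K 1 ⊞ X 1) ⊞ (X 2 ⊞ X 2)) (X 2 ⊞ X 2 ⊞ (X 0 ⊞ X 0 ⊞ K 0 ⊞ (K 1 ⊞ X 1))) (lt ⊕ room) refl)

        covering : LeafySpider 2 → Covering
        covering L = grow-all (n + n) 2 L false ≤-refl (λ ()) (m≤n+m (n + n) 4)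

        -- A vertex off a spider that sees two legs

        module Vertex {k : ℕ} (L : LeafySpider k) (k3 : 3 ≤ k) (v : V) (v-off : Spider.on (LeafySpider.sp L) v ≡ false) where
          open Pairs L
          private
            pp : p ≡ suc p₁
            pp = refl

          -- α is the highest neighbour of v on leg a and x its distance from the leafy end. The
          -- part of the leg from the end down to α meets v only in its last step and so serves as
          -- the start of a bone.
          record MaxOn (a : Fin k) : Set where
            field
              α x : ℕ
              sum : α + x ≡ p₁
              pos : 0 < α
              eα : E (r a α) v
              hi : ∀ j → α < j → j ≤ p₁ → ¬ E (r a j) v
            α≤ : α ≤ p₁
            α≤ = ≤-trans (m≤m+n α x) (≤-reflexive sum)
            x≤ : x ≤ p₁
            x≤ = ≤-trans (m≤n+m x α) (≤-reflexive sum)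
            p∸x : p₁ ∸ x ≡ α
            p∸x = trans (cong (_∸ x) (sym sum)) (m+n∸n≡m α x)
            above : ∀ {i} → i ≤ x → α ≤ p₁ ∸ i
            above {i} ix = ≤-trans (≤-reflexive (sym p∸x)) (∸-monoʳ-≤ p₁ ix)
            strictly : ∀ {i} → i < x → α < p₁ ∸ i
            strictly {i} ix = ≤-trans (s≤s (≤-reflexive (sym p∸x))) (∸-monoʳ-< {p₁} ix x≤)
            path : Ind (λ j → r a (p₁ ∸ j)) x
            path = ind-prefix (ind-rev (leg a)) x≤
            last : E (r a (p₁ ∸ x)) v
            last = subst (λ y → E (r a y) v) (sym p∸x) eα
            clear : ∀ i → i < x → Far (r a (p₁ ∸ i)) v
            clear i ix = ¬E⇒ (hi (p₁ ∸ i) (strictly ix) (m∸n≤m p₁ i)) , off-≢ v-off a (p₁ ∸ i) (m∸n≤m p₁ i)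

          max-on : ∀ a j → 0 < j → j ≤ p₁ → E (r a j) v → ∃ λ (M : MaxOn a) → j ≤ MaxOn.α M
          max-on a j j0 jp e = let (x , xj , ex , mn) = least (λ x → Adj G (r a (p₁ ∸ x)) v) (p₁ ∸ j) (subst (λ y → E (r a y) v) (sym (m∸[m∸n]≡n jp)) e)
                                   xp = ≤-trans xj (m∸n≤m p₁ j)
                                   jα = ≤-trans (≤-reflexive (sym (m∸[m∸n]≡n jp))) (∸-monoʳ-≤ p₁ xj)
            in record { α = p₁ ∸ x ; x = x ; sum = m∸n+n≡m xp ; pos = ≤-trans j0 jα ; eα = ex
                      ; hi = λ i lt ip ei → true≢false (subst (λ y → E (r a y) v) (sym (m∸[m∸n]≡n ip)) ei)
                          (mn (p₁ ∸ i) (≤-trans (∸-monoʳ-< {p₁} lt ip) (≤-reflexive (m∸[m∸n]≡n xp)))) } , jα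

          via-legs : ∀ {a b} → a ≢ b → (A : MaxOn a) (B : MaxOn b) → Q (suc (suc (suc (MaxOn.x A + MaxOn.x B))))
          via-legs {a} {b} ab A B = via A.path (ends a) A.last A.clear (ind-shift (leg b) B.α B.x (≤-reflexive B.sum))
              (subst (λ y → E v (r b y)) (sym (+-identityʳ B.α)) (E-sym B.eα))
              (λ j j0 jx → Far-sym (¬E⇒ (B.hi (B.α + j) (m<m+n B.α j0) (bound jx)) , off-≢ v-off b (B.α + j) (bound jx)))
              (λ i j ix jx → cross ab (p₁ ∸ i) (B.α + j) (≤-trans A.pos (A.above ix)) (m∸n≤m p₁ i) (≤-trans B.pos (m≤m+n B.α j)) (bound jx))
              (subst (Leafy ∘ r b) (sym B.sum) (ends b))
            where
            module A = MaxOn A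
            module B = MaxOn B
            bound : ∀ {j} → j ≤ B.x → B.α + j ≤ p₁
            bound jx = ≤-trans (+-monoʳ-≤ B.α jx) (≤-reflexive B.sum)

          fork : ∀ {a} (A : MaxOn a) {b₁ b₂} → E v b₁ → E v b₂ → Far b₁ b₂ →
            (∀ j → MaxOn.α A ≤ j → j ≤ p₁ → Far (r a j) b₁) → (∀ j → MaxOn.α A ≤ j → j ≤ p₁ → Far (r a j) b₂) → Q (suc (suc (MaxOn.x A)))
          fork {a} A e₁ e₂ bb f₁ f₂ = claw-at A.path (ends a) A.last A.clear e₁ e₂ bb
              (λ i ix → f₁ (p₁ ∸ i) (A.above ix) (m∸n≤m p₁ i)) (λ i ix → f₂ (p₁ ∸ i) (A.above ix) (m∸n≤m p₁ i))
            where module A = MaxOn A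

          leg-far : ∀ {a b} → a ≢ b → ∀ j j' → 2 ≤ j → j ≤ p₁ → j' ≤ p₁ → Far (r a j) (r b j')
          leg-far {a} {b} ab j zero j2 jp _ = Far-sym (subst (λ x → Far x (r a j)) (trans (r-0 a) (sym (r-0 b))) (far (leg a) 0 j j2 jp))
          leg-far {a} {b} ab j (suc j') j2 jp jp' = cross ab j (suc j') (<⇒≤ j2) jp (s≤s z≤n) jp'

          -- The path runs from the end of the leg b through v, down the leg a to the centre and up the leg d.
          through : ∀ {a b d} → a ≢ b → b ≢ d → (ad : a ≢ d) → (B : MaxOn b) → 2 ≤ MaxOn.α B → ∀ μ → μ ≤ p₁ → E (r a μ) v →
            (∀ j → j < μ → ¬ E (r a j) v) → (∀ j → 0 < j → j ≤ p₁ → ¬ E (r d j) v) → Q (suc (suc (suc (MaxOn.x B + (μ + suc p₂)))))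
          through {a} {b} {d} ab bd ad B β2 μ μp eμ lo free = via B.path (ends b) B.last B.clear
              (ind-shift (arc-Ind a d ad) (p₁ ∸ μ) (μ + suc p₂) (≤-reflexive total))
              (subst (E v) (sym (trans (cong (arc a d ad) (+-identityʳ (p₁ ∸ μ))) (arc-l a d ad μ μp))) (E-sym eμ))
              (λ j j0 je → far-v j j0 je (split p₁ (p₁ ∸ μ + j)) refl)
              (λ i j ix je → far-b i ix (split p₁ (p₁ ∸ μ + j)) (bound je))
              (subst Leafy (sym (cong (arc a d ad) total)) (arc-end a d ad))
            where
            module B = MaxOn B
            total : p₁ ∸ μ + (μ + suc p₂) ≡ Nq
            total = trans (sym (+-assoc (p₁ ∸ μ) μ (suc p₂))) (trans (cong (_+ suc p₂) (m∸n+n≡m μp)) (+-suc p₁ p₂))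
            bound : ∀ {j} → j ≤ μ + suc p₂ → p₁ ∸ μ + j ≤ Nq
            bound je = ≤-trans (+-monoʳ-≤ (p₁ ∸ μ) je) (≤-reflexive total)
            arc-left : ∀ {i} → i ≤ p₁ → arc a d ad i ≡ r a (p₁ ∸ i)
            arc-left {i} ip = trans (cong (arc a d ad) (sym (m∸[m∸n]≡n ip))) (arc-l a d ad (p₁ ∸ i) (m∸n≤m p₁ i))
            far-v : ∀ j → 0 < j → j ≤ μ + suc p₂ → ∀ {i} → Split p₁ i → i ≡ p₁ ∸ μ + j → Far v (arc a d ad i)
            far-v j j0 je (left ip) refl = subst (Far v) (sym (arc-left ip)) (Far-sym
              (¬E⇒ (lo (p₁ ∸ (p₁ ∸ μ + j)) (≤-trans (∸-monoʳ-< {p₁} (m<m+n (p₁ ∸ μ) j0) ip) (≤-reflexive (m∸[m∸n]≡n μp)))) , off-≢ v-off a _ (m∸n≤m p₁ (p₁ ∸ μ + j))))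
            far-v j j0 je (right i) eq = subst (Far v) (sym (arc-r a d ad i)) (Far-sym (¬E⇒ (free (suc i) (s≤s z≤n) ip) , off-≢ v-off d (suc i) ip))
              where
              ip : suc i ≤ p₁
              ip = s≤s (+-cancelˡ-≤ p₁ _ _ (s≤s⁻¹ (≤-trans (≤-reflexive eq) (bound je))))
            far-b : ∀ i → i ≤ B.x → ∀ {y} → Split p₁ y → y ≤ Nq → Far (r b (p₁ ∸ i)) (arc a d ad y)
            far-b i ix (left {y} yp) _ = subst (Far (r b (p₁ ∸ i))) (sym (arc-left yp))
              (leg-far (ab ∘ sym) (p₁ ∸ i) (p₁ ∸ y) (≤-trans β2 (B.above ix)) (m∸n≤m p₁ i) (m∸n≤m p₁ y))
            far-b i ix (right y) yN = subst (Far (r b (p₁ ∸ i))) (sym (arc-r a d ad y))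
              (leg-far bd (p₁ ∸ i) (suc y) (≤-trans β2 (B.above ix)) (m∸n≤m p₁ i) (s≤s (+-cancelˡ-≤ p₁ _ _ (s≤s⁻¹ yN))))

          -- Such a bone has x + 2 = p + 1 - α path vertices, which is less than p as soon as α is
          -- at least 2.
          not-far-up : ∀ {α x} → α + x ≡ p₁ → 2 ≤ α → Q (suc (suc x)) → ⊥
          not-far-up {α} {x} s α2 (inj₁ e) = refute (α ∷ x ∷ p ∷ p₁ ∷ []) (X 0 ⊞ X 1 ⊞ K 2 ⊞ X 2 ⊞ (K 1 ⊞ X 3)) (X 3 ⊞ X 0 ⊞ (K 2 ⊞ X 1) ⊞ X 2) (le s ⊕ α2 ⊕ ge e ⊕ ge pp) refl
          not-far-up {α} {x} s α2 (inj₂ e) = refute (α ∷ x ∷ q ∷ p₁ ∷ p ∷ []) (X 0 ⊞ X 1 ⊞ X 2 ⊞ (K 1 ⊞ X 3) ⊞ (X 4 ⊞ X 4) ⊞ K 3) (X 3 ⊞ (K 2 ⊞ X 1) ⊞ X 4 ⊞ (K 1 ⊞ X 2) ⊞ X 4) (le s ⊕ ge e ⊕ ge pp ⊕ ge qp ⊕ p≥3) refl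

          -- If μ is the lowest neighbour on leg a, the path through d forces β = μ + 2, and a fork at v forces α ≤ μ + 1.
          less : ∀ {a b d} → a ≢ b → b ≢ d → a ≢ d → (A : MaxOn a) (B : MaxOn b) → MaxOn.α A + MaxOn.α B ≡ suc p → MaxOn.α A < MaxOn.α B
          less {a} {b} {d} ab bd ad A B αβ = dec-elim (𝔽.any? (λ j → E? (r d (suc (toℕ j))) v)) touched
              (λ none → dec-elim (suc (suc μ) ≤? A.α) (λ le' → ⊥-elim (spread le')) (λ gt → ≤-trans (≰⇒> gt) (≤-reflexive (sym (β≡ none)))))
            where
            module A = MaxOn A
            module B = MaxOn B
            α β : ℕ
            α = A.α
            β = B.α
            α2 : 2 ≤ α
            α2 = ≮⇒≥ λ lt → refute (α ∷ p ∷ β ∷ p₁ ∷ []) (K 1 ⊞ X 0 ⊞ (K 1 ⊞ X 1) ⊞ X 2 ⊞ (K 1 ⊞ X 3)) (K 2 ⊞ (X 0 ⊞ X 2) ⊞ X 3 ⊞ X 1) (lt ⊕ ge αβ ⊕ β≤ ⊕ ge pp) refl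
              where β≤ = B.α≤
            β2 : 2 ≤ β
            β2 = ≮⇒≥ λ lt → refute (β ∷ p ∷ α ∷ p₁ ∷ []) (K 1 ⊞ X 0 ⊞ (K 1 ⊞ X 1) ⊞ X 2 ⊞ (K 1 ⊞ X 3)) (K 2 ⊞ (X 2 ⊞ X 0) ⊞ X 3 ⊞ X 1) (lt ⊕ ge αβ ⊕ α≤ ⊕ ge pp) refl
              where α≤ = A.α≤
            -- If the third leg d also meets v, then v forks into b and d above the leg a, against
            -- `not-far-up`.
            touched : (∃ λ (j : Fin p₁) → E (r d (suc (toℕ j))) v) → α < β
            touched (j , e) = ⊥-elim (not-far-up A.sum α2 (fork A (E-sym B.eα) (E-sym e)
              (cross bd β (suc (toℕ j)) B.pos B.α≤ (s≤s z≤n) (𝔽.toℕ<n j))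
              (λ i αi ip → cross ab i β (≤-trans A.pos αi) ip B.pos B.α≤)
              (λ i αi ip → cross ad i (suc (toℕ j)) (≤-trans A.pos αi) ip (s≤s z≤n) (𝔽.toℕ<n j))))
            lowest = least (λ j → Adj G (r a j) v) α A.eα
            μ : ℕ
            μ = proj₁ lowest
            eμ : E (r a μ) v
            eμ = proj₁ (proj₂ (proj₂ lowest))
            μp : μ ≤ p₁
            μp = ≤-trans (proj₁ (proj₂ lowest)) A.α≤
            β≡ : ¬ (∃ λ (j : Fin p₁) → E (r d (suc (toℕ j))) v) → β ≡ suc (suc μ)
            β≡ none = fin B.sum (through ab bd ad B β2 μ μp eμ (λ j lt e → true≢false e (proj₂ (proj₂ (proj₂ lowest)) j lt))
                (λ { (suc j) _ jp e → none (fromℕ< jp , subst (λ y → E (r d (suc y)) v) (sym (𝔽.toℕ-fromℕ< jp)) e) }))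
              where
              pp₂ : p₁ ≡ suc p₂
              pp₂ = refl
              fin : ∀ {y} → β + y ≡ p₁ → Q (suc (suc (suc (y + (μ + suc p₂))))) → β ≡ suc (suc μ)
              fin {y} s (inj₁ e) = ⊥-elim (refute (y ∷ μ ∷ p₂ ∷ p ∷ p₁ ∷ []) (K 3 ⊞ (X 0 ⊞ (X 1 ⊞ (K 1 ⊞ X 2))) ⊞ X 3 ⊞ X 4) (X 3 ⊞ (K 1 ⊞ X 4) ⊞ (K 1 ⊞ X 2)) (le e ⊕ le pp ⊕ le pp₂) refl)
              fin {y} s (inj₂ e) = ≤-antisym (≮⇒≥ λ lt → refute (μ ∷ β ∷ y ∷ q ∷ p ∷ p₁ ∷ p₂ ∷ []) (K 1 ⊞ (K 2 ⊞ X 0) ⊞ (X 1 ⊞ X 2) ⊞ X 3 ⊞ (X 4 ⊞ X 4) ⊞ (K 1 ⊞ X 5) ⊞ (K 1 ⊞ X 5) ⊞ (K 1 ⊞ X 6)) (X 1 ⊞ X 5 ⊞ (K 3 ⊞ (X 2 ⊞ (X 0 ⊞ (K 1 ⊞ X 6)))) ⊞ (K 1 ⊞ X 3) ⊞ X 4 ⊞ X 4 ⊞ X 5) (lt ⊕ le s ⊕ ge e ⊕ ge qp ⊕ ge pp ⊕ ge pp ⊕ ge pp₂) refl)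
                                             (≮⇒≥ λ lt → refute (β ∷ p₁ ∷ y ∷ μ ∷ p₂ ∷ q ∷ p ∷ []) (K 1 ⊞ X 0 ⊞ X 1 ⊞ (K 3 ⊞ (X 2 ⊞ (X 3 ⊞ (K 1 ⊞ X 4)))) ⊞ (K 1 ⊞ X 5) ⊞ X 6 ⊞ X 6 ⊞ X 1) (K 2 ⊞ X 3 ⊞ (X 0 ⊞ X 2) ⊞ X 5 ⊞ (X 6 ⊞ X 6) ⊞ (K 1 ⊞ X 1) ⊞ (K 1 ⊞ X 1) ⊞ (K 1 ⊞ X 4)) (lt ⊕ ge s ⊕ le e ⊕ le qp ⊕ le pp ⊕ le pp ⊕ le pp₂) refl)
            spread : suc (suc μ) ≤ α → ⊥
            spread le' = not-far-up B.sum β2 (fork B (E-sym A.eα) (E-sym eμ) (Far-sym (far (leg a) μ α le' A.α≤))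
              (λ i βi ip → cross (ab ∘ sym) i α (≤-trans B.pos βi) ip A.pos A.α≤)
              (λ i βi ip → leg-far (ab ∘ sym) i μ (≤-trans β2 βi) ip μp))

          -- The path between the two leafy ends through v has p or 2p - 1 vertices. With 2p - 1,
          -- both highest neighbours are next to the centre, and `touch-centre` applies. With p,
          -- they satisfy α + β = p + 1, and `less` would hold in both orders.
          two-legs : ∀ a b → a ≢ b → ∀ j j' → 0 < j → j ≤ p₁ → 0 < j' → j' ≤ p₁ → E (r a j) v → E (r b j') v → E c v × j ≤ 1
          two-legs a b ab j j' j0 jp j0' jp' e e' = decide (max-on a j j0 jp e) (max-on b j' j0' jp' e')
            where
            decide : (∃ λ (A : MaxOn a) → j ≤ MaxOn.α A) → (∃ λ (B : MaxOn b) → j' ≤ MaxOn.α B) → E c v × j ≤ 1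
            decide (A , jα) (B , _) = fin A.sum B.sum (via-legs ab A B)
              where
              module A = MaxOn A
              module B = MaxOn B
              α β : ℕ
              α = A.α
              β = B.α
              fin : ∀ {x y} → α + x ≡ p₁ → β + y ≡ p₁ → Q (suc (suc (suc (x + y)))) → E c v × j ≤ 1
              fin {x} {y} s s' (inj₁ w) = ⊥-elim (let (d , ad , bd) = fin-third k3 a b in
                  <-asym (less ab bd ad A B αβ) (less (ab ∘ sym) ad bd B A (trans (+-comm β α) αβ)))
                where
                αβ : α + β ≡ suc p
                αβ = ≤-antisym (≮⇒≥ λ lt → refute (p ∷ α ∷ x ∷ β ∷ y ∷ p₁ ∷ []) (K 1 ⊞ (K 1 ⊞ X 0) ⊞ (X 1 ⊞ X 2) ⊞ (X 3 ⊞ X 4) ⊞ X 0 ⊞ (K 1 ⊞ X 5) ⊞ (K 1 ⊞ X 5)) (X 1 ⊞ X 3 ⊞ X 5 ⊞ X 5 ⊞ (K 3 ⊞ (X 2 ⊞ X 4)) ⊞ X 0 ⊞ X 0) (lt ⊕ le s ⊕ le s' ⊕ ge w ⊕ ge pp ⊕ ge pp) refl)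
                               (≮⇒≥ λ lt → refute (α ∷ β ∷ p₁ ∷ x ∷ y ∷ p ∷ []) (K 1 ⊞ (X 0 ⊞ X 1) ⊞ X 2 ⊞ X 2 ⊞ (K 3 ⊞ (X 3 ⊞ X 4)) ⊞ X 5 ⊞ X 5) (K 1 ⊞ X 5 ⊞ (X 0 ⊞ X 3) ⊞ (X 1 ⊞ X 4) ⊞ X 5 ⊞ (K 1 ⊞ X 2) ⊞ (K 1 ⊞ X 2)) (lt ⊕ ge s ⊕ ge s' ⊕ le w ⊕ le pp ⊕ le pp) refl)
              fin {x} {y} s s' (inj₂ w) = touch-centre a (off-≢ v-off) (subst (λ i → E (r a i) v) α1 A.eα)
                  (λ i lt ip → A.hi i (subst (_< i) (sym α1) lt) ip) , ≤-trans jα (≤-reflexive α1)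
                where
                β0 : 0 < β
                β0 = B.pos
                α1 : α ≡ 1
                α1 = ≤-antisym (≮⇒≥ λ lt → refute (α ∷ x ∷ β ∷ y ∷ q ∷ p ∷ p₁ ∷ []) (K 1 ⊞ K 1 ⊞ (K 1 ⊞ K 0) ⊞ (X 0 ⊞ X 1) ⊞ (X 2 ⊞ X 3) ⊞ X 4 ⊞ (X 5 ⊞ X 5) ⊞ (K 1 ⊞ X 6) ⊞ (K 1 ⊞ X 6)) (X 0 ⊞ X 2 ⊞ X 6 ⊞ X 6 ⊞ (K 3 ⊞ (X 1 ⊞ X 3)) ⊞ (K 1 ⊞ X 4) ⊞ X 5 ⊞ X 5) (lt ⊕ β0 ⊕ le s ⊕ le s' ⊕ ge w ⊕ ge qp ⊕ ge pp ⊕ ge pp) refl) A.pos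

        -- Spiders with at least three legs

        module Spread {d k : ℕ} (crit : DeficiencyCritical G) (D : Def G d) (L : LeafySpider k) (k3 : 3 ≤ k)
          (cov : ∀ u → Leafy u → Spider.on (LeafySpider.sp L) u ≡ true) where

          module Ps = Pairs L

          i₀ : Fin k
          i₀ = first-leg (≤-trans (n≤1+n 2) k3)

          c-on : Ps.on Ps.c ≡ true
          c-on = subst (λ x → Ps.on x ≡ true) (Ps.r-0 i₀) (Ps.on-r i₀ 0 z≤n)

          module Ou = Outer Ps.on (λ v → Ps.c , c-on , proj₂ con Ps.c v) Ps.c c-on Ps.on-connected crit D

          abstract
            near : ∀ v → Ps.on v ≡ false → ∃ λ s → Ps.on s ≡ true × E s v
            near = Ou.outer-nbr cov

            off-indep : ∀ u v → Ps.on u ≡ false → Ps.on v ≡ false → Adj G u v ≡ false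
            off-indep = Ou.outer-indep cov

            two-legs : ∀ v → Ps.on v ≡ false → ∀ a b → a ≢ b → ∀ j j' → 0 < j → j ≤ p₁ → 0 < j' → j' ≤ p₁ →
              E (Ps.r a j) v → E (Ps.r b j') v → E Ps.c v × j ≤ 1
            two-legs v o = Vertex.two-legs L k3 v o

          open Skeleton Ps.sp near off-indep two-legs

          t : Fin k → V
          t i = r i p₁

          -- The path from the end of another leg through the centre to r i (j + 1) has p + j + 1
          -- vertices, strictly between p and q while that vertex is below the end of its leg.
          branch : ∀ {i j w w'} → suc j < p₁ → Child (r i (suc j)) w → Child (r i (suc j)) w' → Far w w' → ⊥
          branch {i} {j} {w} {w'} jp c c' ww = let (b , ib) = fin-other (≤-trans (n≤1+n 2) k3) i in
              bad (claw-path (ind-prefix (Ps.arc-Ind b i (ib ∘ sym)) (s≤s (+-monoʳ-≤ p₁ j≤))) (Ps.arc-start b i (ib ∘ sym))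
                (subst (λ x → E x w) (sym (Ps.arc-r b i (ib ∘ sym) j)) (proj₁ c))
                (subst (λ x → E x w') (sym (Ps.arc-r b i (ib ∘ sym) j)) (proj₁ c')) ww
                (λ y yp → arc-far b ib c (split p₁ y) yp) (λ y yp → arc-far b ib c' (split p₁ y) yp))
            where
            pp : p ≡ suc p₁
            pp = refl
            j≤ : j ≤ p₂
            j≤ = s≤s⁻¹ (<⇒≤ jp)
            bad : Q (suc (suc (p₁ + j))) → ⊥
            bad (inj₁ x) = refute (p₁ ∷ j ∷ p ∷ []) (K 2 ⊞ (X 0 ⊞ X 1) ⊞ X 2) (X 2 ⊞ (K 1 ⊞ X 0)) (le x ⊕ le pp) refl
            bad (inj₂ x) = refute (q ∷ p₁ ∷ p ∷ j ∷ []) (X 0 ⊞ (K 1 ⊞ X 1) ⊞ (K 1 ⊞ X 1) ⊞ (X 2 ⊞ X 2) ⊞ (K 1 ⊞ (K 1 ⊞ X 3))) (K 2 ⊞ (X 1 ⊞ X 3) ⊞ X 2 ⊞ X 2 ⊞ (K 1 ⊞ X 0) ⊞ X 1) (ge x ⊕ ge pp ⊕ ge pp ⊕ ge qp ⊕ jp) refl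
            child-far' : ∀ {w} → Child (r i (suc j)) w → ∀ a j' → j' ≤ p₁ → a ≢ i ⊎ j' < suc j → Far (r a j') w
            child-far' (e , hw) = child-far (s≤s z≤n) (<⇒≤ jp) e (trans hw (cong suc (h-r i (suc j) (<⇒≤ jp))))
            arc-far : ∀ b (ib : i ≢ b) {w} → Child (r i (suc j)) w → ∀ {y} → Split p₁ y → y ≤ p₁ + j → Far (Ps.arc b i (ib ∘ sym) y) w
            arc-far b ib {w} c (left {y} yp) _ = subst (λ x → Far x w) (sym (trans (cong (Ps.arc b i (ib ∘ sym)) (sym (m∸[m∸n]≡n yp))) (Ps.arc-l b i (ib ∘ sym) (p₁ ∸ y) (m∸n≤m p₁ y))))
              (child-far' c b (p₁ ∸ y) (m∸n≤m p₁ y) (inj₁ (ib ∘ sym)))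
            arc-far b ib {w} c (right y) yj = subst (λ x → Far x w) (sym (Ps.arc-r b i (ib ∘ sym) y))
              (child-far' c i (suc y) (≤-trans y<j (≤-trans (n≤1+n j) (<⇒≤ jp))) (inj₂ (s≤s y<j)))
              where
              y<j : suc y ≤ j
              y<j = +-cancelˡ-≤ p₁ _ _ (≤-trans (≤-reflexive (+-suc p₁ y)) yj)

          cost : (Fin k → ℕ) → V → ℕ
          cost w v = point c (suc (suc ν)) v + sumF (λ i → point (t i) (w i) v)

          -- By `branch` only the centre and the ends of the legs can branch. The costs w stay free
          -- so that the actual numbers of leaves can be put in when equality holds.
          tip-bound : (w : Fin k → ℕ) → (∀ i W → (∀ x → W x ≡ true → Child (t i) x) →
            (∀ x y → W x ≡ true → W y ≡ true → Adj G x y ≡ false) → count W ≤ suc (w i)) → d ≤ suc (suc ν) + sumF w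
          tip-bound w tips = ≤-trans (skeleton-bound loc D (cost w) (≤-trans (s≤s z≤n) root-cost) (s≤s (s≤s root-cost)) inner) (≤-reflexive total)
            where
            root-cost : suc (suc ν) ≤ cost w c
            root-cost = ≤-trans (≤-reflexive (sym (point-self c _))) (m≤m+n _ (sumF (λ i → point (t i) (w i) c)))
            total : sumF (cost w) ≡ suc (suc ν) + sumF w
            total = trans (sumF-+ (point c (suc (suc ν))) (λ v → sumF (λ i → point (t i) (w i) v)))
              (cong₂ _+_ (sumF-point c _) (trans (sumF-swap (λ i → point (t i) (w i))) (sumF-cong (λ i → sumF-point (t i) (w i)))))
            tip-cost : ∀ i → w i ≤ cost w (t i)
            tip-cost i = ≤-trans (≤-reflexive (sym (point-self (t i) (w i)))) (≤-trans (sumF-≥ (λ i' → point (t i') (w i') (t i)) i) (m≤n+m _ (point c (suc (suc ν)) (t i))))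
            inner : ∀ i j → 0 < j → j ≤ p₁ → ∀ W → (∀ x → W x ≡ true → Child (r i j) x) →
              (∀ x y → W x ≡ true → W y ≡ true → Adj G x y ≡ false) → count W ≤ suc (cost w (r i j))
            inner i (suc j) j0 jp W Wc Wi = [ (λ lt → ≤-trans (count≤1 W (λ x y a b → dec-elim (x 𝔽.≟ y) id
                  λ ne → ⊥-elim (branch lt (Wc x a) (Wc y b) (Wi x y a b , ne)))) (s≤s z≤n))
              , (λ eq → ≤-trans (tips i W (subst (λ y → ∀ x → W x ≡ true → Child (r i y) x) eq Wc) Wi)
                  (s≤s (subst (λ y → w i ≤ cost w (r i y)) (sym eq) (tip-cost i)))) ]′ (m≤n⇒m<n∨m≡n jp)

          tip-off : ∀ {i x} → childB (t i) x ≡ true → on x ≡ false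
          tip-off {i} {x} e = top-off {i} (childB-out x e)

          tip-only : ∀ {i x} → childB (t i) x ≡ true → ∀ u → E u x → u ≡ t i
          tip-only {i} {x} e u ux = [ (λ o → let (a , j , jp , eq) = on-out o in trans (sym eq)
                (leg-end a j jp (subst (λ y → E y x) (sym eq) ux)))
              , (λ o → ⊥-elim (true≢false ux (off-indep u x o (tip-off {i} e)))) ]′ (on-or-off u)
            where
            far' : ∀ a j → j ≤ p₁ → a ≢ i ⊎ j < p₁ → Far (r a j) x
            far' = child-far (s≤s z≤n) ≤-refl (proj₁ (childB-out x e)) (trans (proj₂ (childB-out x e)) (cong suc (h-r i p₁ ≤-refl)))
            leg-end : ∀ a j → j ≤ p₁ → E (r a j) x → r a j ≡ t i
            leg-end a j jp ax = dec-elim (a 𝔽.≟ i) (λ { refl → [ (λ lt → ⊥-elim (Far-E (far' a j jp (inj₂ lt)) ax)) , (λ { refl → refl }) ]′ (m≤n⇒m<n∨m≡n jp) })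
              λ ne → ⊥-elim (Far-E (far' a j jp (inj₁ ne)) ax)

          w₀ : Fin k → ℕ
          w₀ i = count (childB (t i)) ∸ 1

          tips-indep : ∀ i x y → childB (t i) x ≡ true → childB (t i) y ≡ true → Adj G x y ≡ false
          tips-indep i x y a b = off-indep x y (tip-off {i} a) (tip-off {i} b)

          w₀≤ : ∀ i → w₀ i ≤ suc ν
          w₀≤ i = pred-mono-≤ (s≤s⁻¹ (s≤s⁻¹ (child-count loc i p₁ (s≤s z≤n) ≤-refl (childB (t i)) childB-out (tips-indep i))))

          leaf-bound : d ≤ suc (suc ν) + sumF w₀
          leaf-bound = tip-bound w₀ λ i W Wc _ → ≤-trans (count-mono {P = W} {Q = childB (t i)} (λ x a → childB-in (Wc x a))) (≤-suc-pred _)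

          sum≤ : sumF w₀ ≤ k * suc ν
          sum≤ = ≤-trans (sumF-mono w₀≤) (≤-reflexive (sumF-const k (suc ν)))

          Tips : Fin k → Set
          Tips i = ∃ λ (e : ℕ → V) → (∀ x → x < suc (suc ν) → E (t i) (e x) × (∀ u → E u (e x) → u ≡ t i) × (∀ a j → j ≤ p₁ → e x ≢ r a j)) ×
            (∀ x y → x < suc (suc ν) → y < suc (suc ν) → e x ≡ e y → x ≡ y)

          module _ (k≤ : k ≤ suc (suc (suc ν))) where
            abstract
              spread-bound : d ≤ suc (suc ν) + suc (suc (suc ν)) * suc ν
              spread-bound = ≤-trans leaf-bound (+-monoʳ-≤ (suc (suc ν)) (≤-trans sum≤ (*-monoˡ-≤ (suc ν) k≤)))

              module _ (tight : d ≡ suc (suc ν) + suc (suc (suc ν)) * suc ν) where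
                sum-tight : suc (suc (suc ν)) * suc ν ≤ sumF w₀
                sum-tight = +-cancelˡ-≤ (suc (suc ν)) _ _ (≤-trans (≤-reflexive (sym tight)) leaf-bound)

                -- There are at most n - 1 legs, and each end costs at most n - 3; the sum reaches
                -- (n - 1)(n - 3) only if both limits are attained.
                k-tight : k ≡ suc (suc (suc ν))
                k-tight = ≤-antisym k≤ (*-cancelʳ-≤ _ _ (suc ν) (≤-trans sum-tight sum≤))

                w-tight : ∀ i → suc ν ≤ w₀ i
                w-tight i = ≮⇒≥ λ lt → <-irrefl refl (≤-trans (sumF-strict w₀≤ i lt)
                  (≤-trans (≤-reflexive (sumF-const k (suc ν))) (≤-trans (*-monoˡ-≤ (suc ν) k≤) sum-tight)))

                tips : ∀ i → Tips i
                tips i = let (e , P , inj) = pickℕ (childB (t i)) (suc (suc ν)) (pred-large (w-tight i)) c in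
                  e , (λ x lt → proj₁ (childB-out (e x) (P x lt)) , tip-only {i} (P x lt) , λ a j jp eq → off-≢ (tip-off {i} (P x lt)) a j jp (sym eq)) , inj

        module SpreadIso {d : ℕ} (crit : DeficiencyCritical G) (D : Def G d) (tight : d ≡ suc (suc ν) + suc (suc (suc ν)) * suc ν) where

          iso : ∀ {k} (L : LeafySpider k) (k3 : 3 ≤ k) (k≤ : k ≤ suc (suc (suc ν)))
            (cov : ∀ u → Leafy u → Spider.on (LeafySpider.sp L) u ≡ true) →
            k ≡ suc (suc (suc ν)) → ∀ h → suc (suc p₀) ≡ h + h → G ≅ S (suc (suc (suc ν))) (suc (suc (suc p₀)))
          iso L k3 k≤ cov refl h pe = Recognise.copy-iso sim _ (SGraph.es (suc (suc ν)) (suc p₀)) Co.cover Co.covers-edges crit D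
              (SGraph.SEmbed.S-embedding (suc (suc ν)) (suc p₀) sim Ps.c Ps.r (λ i → proj₁ (tips i)) Ps.r-0 Ps.leg Ps.cross
                (λ i x lt → proj₁ (proj₁ (proj₂ (tips i)) x lt)) (λ i x lt → proj₁ (proj₂ (proj₁ (proj₂ (tips i)) x lt)))
                (λ i x lt → proj₂ (proj₂ (proj₁ (proj₂ (tips i)) x lt))) (λ i → proj₂ (proj₂ (tips i))))
              (SGraph.S-connected (suc (suc ν)) (suc p₀)) (≤-reflexive (Co.cover-size d (trans (cong (_+ 1) tight) (lem ν))))
            where
            module Sp = Spread crit D L k3 cov
            module Ps = Pairs L
            tips : ∀ i → Sp.Tips i
            tips = Sp.tips k≤ tight
            module Co = SGraph.C (suc (suc ν)) (suc p₀) h pe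
            lem : ∀ ν → suc (suc ν) + suc (suc (suc ν)) * suc ν + 1 ≡ suc (suc (suc ν)) * suc (suc ν)
            lem ν = solve (ν ∷ [])

        module TreeResult {d : ℕ} (crit : DeficiencyCritical G) (D : Def G d) where
          open Start crit D
          open Critical crit D

          Result : Set
          Result = d ≤ tree-value × (d ≡ tree-value → G ≅ S (suc (suc (suc ν))) p)

          below : d ≤ path-value → Result
          below le' = ≤-trans le' (<⇒≤ path<tree) , not-tight (≤-trans (s≤s le') path<tree)

          -- With two legs there is no third leg to exclude vertices that see both, but the legs
          -- form one path through all leafy vertices, and the value for a path is already below
          -- that for S.
          two : (L : LeafySpider 2) → (∀ u → Leafy u → Spider.on (LeafySpider.sp L) u ≡ true) → d ≤ path-value
          two L cov = PathCase.path-bound' crit D (arc-Ind zero (suc zero) (λ ())) (arc-start zero (suc zero) (λ ()))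
              (≤-reflexive Nq≡) all (s≤s z≤n)
            where
            open Pairs L
            at : ∀ {u} i j → j ≤ _ → r i j ≡ u → ∃ λ x → x ≤ Nq × arc zero (suc zero) (λ ()) x ≡ u
            at zero j jp e = suc (suc p₀) ∸ j , ≤-trans (m∸n≤m (suc (suc p₀)) j) (≤-trans (m≤m+n (suc (suc p₀)) (suc p₀)) (n≤1+n _)) , trans (arc-l zero (suc zero) (λ ()) j jp) e
            at (suc zero) (suc j) jp e = suc (suc (suc p₀) + j) , s≤s (+-monoʳ-≤ (suc (suc p₀)) (s≤s⁻¹ jp)) , trans (arc-r zero (suc zero) (λ ()) j) e
            at (suc zero) zero jp e = at zero zero z≤n (trans (r-0 zero) (trans (sym (r-0 (suc zero))) e))
            all : ∀ u → Leafy u → ∃ λ x → x ≤ Nq × arc zero (suc zero) (λ ()) x ≡ u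
            all u Lu = let (i , j , jp , e) = on-out (cov u Lu) in at i j jp e

          from-covering : Covering → Result
          from-covering (k , k2 , L , cov) = go (m≤n⇒m<n∨m≡n k2)
            where
            k≤ : k ≤ suc (suc (suc ν))
            k≤ = s≤s⁻¹ (legs<n L)
            go : 2 < k ⊎ 2 ≡ k → Result
            go (inj₂ refl) = below (two L cov)
            go (inj₁ k3) = Spread.spread-bound crit D L k3 cov k≤
              , λ tight → SpreadIso.iso crit D tight L k3 k≤ cov
                  (Spread.k-tight crit D L k3 cov k≤ tight) σ half

          result : Result
          result = [ (λ s → below (<⇒≤ (≤-trans (s≤s s) small<path))) , on-line ]′ start
            where
            on-line : Line → Result
            on-line ℓ = [ (λ all → below (line-bound (Ar.CaseB.p<q qp) all))
                , (λ { (u , Lu , u∉) → from-covering (covering ([ from-short I L₀ L₁ Lu u∉ , from-long I L₀ L₁ ]′ qN)) }) ]′ covered?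
              where
              open Line ℓ
              open OnLine ℓ

-- From critical graphs to all graphs

copy-trans : ∀ {H m} G (f : Fin m → Fin (order G)) → Injective _≡_ _≡_ f → InducedCopy H (induce G f) → InducedCopy H G
copy-trans G f inj (g , ginj , ge) = f ∘ g , (λ e → ginj (inj e)) , ge

-- A counterexample of minimal order is critical.
reduce-to-critical : ∀ p q n b →
  (∀ G → IsSimple G → (∀ i → 2 ≤ i → InducedCopy (bone i) G → (i ≡ p) ⊎ (i ≡ q)) → LocalIndepBelow G n →
     ∀ {d} → DeficiencyCritical G → Def G d → d ≤ b) →
  ∀ N G → order G ≤ N → IsSimple G → InClass p q G → LocalIndepBelow G n → ∀ {d} → Def G d → d ≤ b
reduce-to-critical p q n b crit-bound zero G oN sim ((pos , _) , _) loc D = ⊥-elim (<-irrefl refl (≤-trans pos oN))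
reduce-to-critical p q n b crit-bound (suc N) G oN sim (con , bones) loc {d} D = dec-elim (d ≤? b) id λ large →
  crit-bound G sim bones loc (con , λ m f inj lt con' d' d'' D' D'' →
    ≤-trans (s≤s (reduce-to-critical p q n b crit-bound N (induce G f) (s≤s⁻¹ (≤-trans lt oN)) (induce-simple sim f)
        (con' , λ i i2 cp → bones i i2 (copy-trans G f inj cp)) (λ t cp → loc t (copy-trans G f inj cp)) D'))
      (≤-trans (≰⇒> large) (≤-reflexive (Def-unique sim D D'')))) D

theorem1p8 : (n p q : ℕ) (G : Graph) → 3 < n → 3 ≤ p → Odd p →
    IsSimple G → InClass p q G → LocalIndepBelow G n →
    (q ≡ 2 * p + 1 →
    (∀ d → Def G d → d ≤ 3 * n ∸ 8) ×
    (DeficiencyCritical G → ∀ d → Def G d → ((d ≡ 3 * n ∸ 8) ⇔ (G ≅ T (n ∸ 2) p)))) ×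
    (q ≡ 2 * p ∸ 1 →
    (∀ d → Def G d → d ≤ n * n ∸ 3 * n + 1) ×
    (DeficiencyCritical G → ∀ d → Def G d → ((d ≡ n * n ∸ 3 * n + 1) ⇔ (G ≅ S (n ∸ 1) p))))
theorem1p8 (suc (suc (suc (suc ν)))) (suc (suc (suc p₀))) q G (s≤s (s≤s (s≤s (s≤s z≤n)))) (s≤s (s≤s (s≤s z≤n))) (h , p-odd) sim cls loc =
  (λ qe → (λ d D → subst (d ≤_) (sym path-eq) (path-bound qe d D)) , λ crit d D → mk⇔
      (λ tight → proj₂ (resultA qe G sim (proj₂ cls) loc crit D) (trans tight path-eq))
      -- For the converse d is squeezed between the general bound and the vertex cover of T, whose
      -- doubled size falls short of the order by exactly 3n - 8.
      (λ iso → trans (≤-antisym (path-bound qe d D) (+-cancelʳ-≤ (length CT.cover + length CT.cover) _ _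
        (≤-trans (≤-reflexive (CT.cover-size path-value path-cover)) (Recognise.iso-bound sim _ (TGraph.es k (suc p₀)) CT.cover CT.covers-edges D iso)))) (sym path-eq))) ,
  (λ qe → (λ d D → subst (d ≤_) (sym tree-eq) (tree-bound qe d D)) , λ crit d D → mk⇔
      (λ tight → proj₂ (resultB qe G sim (proj₂ cls) loc crit D) (trans tight tree-eq))
      (λ iso → trans (≤-antisym (tree-bound qe d D) (+-cancelʳ-≤ (length CS.cover + length CS.cover) _ _
        (≤-trans (≤-reflexive (CS.cover-size tree-value tree-cover)) (Recognise.iso-bound sim _ (SGraph.es k (suc p₀)) CS.cover CS.covers-edges D iso)))) (sym tree-eq)))
  where
  k n p : ℕ
  k = suc (suc ν)
  n = suc (suc k)
  p = suc (suc (suc p₀))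
  half : suc (suc p₀) ≡ h + h
  half = trans (suc-injective p-odd) (cong (h +_) (+-identityʳ h))
  module CT = TGraph.C k (suc p₀) h half
  module CS = SGraph.C k (suc p₀) h half
  path-value tree-value : ℕ
  path-value = k + suc ν + suc ν
  tree-value = k + suc k * suc ν
  path-cover : path-value + 2 ≡ k + k + k
  path-cover = lem ν
    where
    lem : ∀ ν → suc (suc ν) + suc ν + suc ν + 2 ≡ suc (suc ν) + suc (suc ν) + suc (suc ν)
    lem ν = solve (ν ∷ [])
  tree-cover : tree-value + 1 ≡ suc k * k
  tree-cover = lem ν
    where
    lem : ∀ ν → suc (suc ν) + suc (suc (suc ν)) * suc ν + 1 ≡ suc (suc (suc ν)) * suc (suc ν)
    lem ν = solve (ν ∷ [])
  path-eq : 3 * n ∸ 8 ≡ path-value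
  path-eq = trans (cong (_∸ 8) (lem ν)) (m+n∸m≡n 8 path-value)
    where
    lem : ∀ ν → 3 * suc (suc (suc (suc ν))) ≡ 8 + (suc (suc ν) + suc ν + suc ν)
    lem ν = solve (ν ∷ [])
  tree-eq : n * n ∸ 3 * n + 1 ≡ tree-value
  tree-eq = trans (cong (λ x → x ∸ 3 * n + 1) (lem ν)) (trans (cong (_+ 1) (m+n∸m≡n (3 * n) (n * suc ν))) (lem' ν))
    where
    lem : ∀ ν → suc (suc (suc (suc ν))) * suc (suc (suc (suc ν))) ≡ 3 * suc (suc (suc (suc ν))) + suc (suc (suc (suc ν))) * suc ν
    lem ν = solve (ν ∷ [])
    lem' : ∀ ν → suc (suc (suc (suc ν))) * suc ν + 1 ≡ suc (suc ν) + suc (suc (suc ν)) * suc ν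
    lem' ν = solve (ν ∷ [])
  module _ (qe : q ≡ 2 * p + 1) where
    qA : q ≡ suc (2 * p)
    qA = trans qe (+-comm (2 * p) 1)
    resultA : ∀ G → IsSimple G → (∀ i → 2 ≤ i → InducedCopy (bone i) G → (i ≡ p) ⊎ (i ≡ q)) → LocalIndepBelow G n →
      ∀ {d} → DeficiencyCritical G → Def G d → d ≤ path-value × (d ≡ path-value → G ≅ T k p)
    resultA G sim bones loc crit D = Main.Setting.Parity.Critical.PathResult.result sim ν p₀ q bones loc (proj₁ crit) h p p-odd qA crit D (trans qA (cong (λ x → suc (p + x)) (+-identityʳ p)))
    path-bound : ∀ d → Def G d → d ≤ path-value
    path-bound d D = reduce-to-critical p q n path-value (λ G sim bones loc crit D → proj₁ (resultA G sim bones loc crit D)) (order G) G ≤-refl sim cls loc D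
  module _ (qe : q ≡ 2 * p ∸ 1) where
    qB : suc q ≡ p + p
    qB = trans (cong suc qe) (cong (p +_) (+-identityʳ p))
    qB-odd : q ≡ suc (2 * suc (suc p₀))
    qB-odd = suc-injective (trans qB (lem p₀))
      where
      lem : ∀ p₀ → suc (suc (suc p₀)) + suc (suc (suc p₀)) ≡ suc (suc (2 * suc (suc p₀)))
      lem p₀ = solve (p₀ ∷ [])
    resultB : ∀ G → IsSimple G → (∀ i → 2 ≤ i → InducedCopy (bone i) G → (i ≡ p) ⊎ (i ≡ q)) → LocalIndepBelow G n →
      ∀ {d} → DeficiencyCritical G → Def G d → d ≤ tree-value × (d ≡ tree-value → G ≅ S (suc k) p)
    resultB G sim bones loc crit D = Main.Setting.Parity.Tree.TreeResult.result sim ν p₀ q bones loc (proj₁ crit) h (suc (suc p₀)) p-odd qB-odd qB crit D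
    tree-bound : ∀ d → Def G d → d ≤ tree-value
    tree-bound d D = reduce-to-critical p q n tree-value (λ G sim bones loc crit D → proj₁ (resultB G sim bones loc crit D)) (order G) G ≤-refl sim cls loc D
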